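{- Let $r\ge 2$, let $2\le s_1\le \cdots\le s_r$ be integers, and let $a_i=\prod_{j<i}s_j$ for $1\le i\le r$ (so $a_1=1$). 1. For every sufficiently large integer $\Delta$ there exists a $\Delta$-regular $r$-graph $H$ such that, as $\Delta\to\infty$, $$\mathrm{ex}(H,K_{s_1,\ldots,s_r})=O\left(\Delta^{ -1/\sum_{i=2}^r a_i}\right)\cdot e(H).$$ 2. There exist functions $f_i:\mathbb{Z}^+\to\mathbb{Z}^+$ for $1<i\le r$ such that if $s_i\ge f_i(s_{i-1})$ for all $1<i\le r$, then for every $r$-graph $H$ with maximum degree $\Delta$, as $\Delta\to\infty$, $$\mathrm{ex}(H,K_{s_1,\ldots,s_r})\ge \Delta^{ -1/\sum_{i=2}^r a_i-o(1)}\cdot e(H).$$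
   Context: An $r$-graph is an $r$-uniform hypergraph. For $r$-graphs $H$ and $F$, $\mathrm{ex}(H,F)$ is the maximum number of edges in a subgraph of $H$ containing no copy of $F$. $K_{s_1,\ldots,s_r}$ is the complete $r$-partite $r$-graph with vertex set $U_1\cup\cdots\cup U_r$, $|U_i|=s_i$, whose edges are all sets $\{u_1,\ldots,u_r\}$ with $u_i\in U_i$. The degree of a vertex is the number of edges containing it; $\Delta$-regular means every vertex has degree $\Delta$. -}

module Defs where

open import Data.Nat using (ℕ; zero; suc; _+_; _*_; _^_; _≤_; _<_; _≤?_; _<?_)
open import Data.Fin using (Fin; toℕ) renaming (_≤_ to _≤ᶠ_)
open import Data.Fin.Subset using (Subset; ⁅_⁆; ⋃; ∣_∣; _∈_)
open import Data.Fin.Subset.Properties using (_∈?_)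
open import Data.List using (List; length; filter; map; allFin)
open import Data.Nat.ListAction using (sum; product)
open import Data.List.Relation.Unary.Unique.Propositional using (Unique)
open import Data.List.Relation.Unary.All using (All)
open import Data.List.Relation.Binary.Sublist.Propositional using (_⊆_)
import Data.List.Membership.Propositional as LM
open import Data.Product using (Σ; ∃; _×_; _,_)
open import Function.Definitions using (Injective)
open import Relation.Binary.PropositionalEquality using (_≡_)

record RGraph (r : ℕ) : Set where
  field
    n       : ℕ
    edges   : List (Subset n)
    unique  : Unique edges
    uniform : All (λ e → ∣ e ∣ ≡ r) edges
open RGraph public

e : ∀ {r} → RGraph r → ℕ
e H = length (edges H)

degIn : ∀ {n} → List (Subset n) → Fin n → ℕ
degIn es v = length (filter (v ∈?_) es)

deg : ∀ {r} (H : RGraph r) → Fin (n H) → ℕ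
deg H v = degIn (edges H) v

Regular : ∀ {r} → RGraph r → ℕ → Set
Regular H Δ = ∀ v → deg H v ≡ Δ

MaxDegree : ∀ {r} → RGraph r → ℕ → Set
MaxDegree H Δ = (∀ v → deg H v ≤ Δ) × (∃ λ v → deg H v ≡ Δ)

-- A list of edges (on Fin n) contains a copy of K_{s_1,...,s_r}:
-- an injective map from the vertex set ⊎_i U_i (|U_i| = s_i) into Fin n
-- such that every transversal {φ(1,u_1),...,φ(r,u_r)} is an edge.
ContainsK : ∀ {n} (r : ℕ) (s : Fin r → ℕ) → List (Subset n) → Set
ContainsK {n} r s es =
  Σ (Σ (Fin r) (λ i → Fin (s i)) → Fin n) λ φ →
    Injective _≡_ _≡_ φ ×
    (∀ (c : (i : Fin r) → Fin (s i)) →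
       ⋃ (map (λ i → ⁅ φ (i , c i) ⁆) (allFin r)) LM.∈ es)

KFreeSub : ∀ {r} (s : Fin r → ℕ) (H : RGraph r) → List (Subset (n H)) → Set
KFreeSub {r} s H G = (G ⊆ edges H) × (ContainsK r s G → Data.Empty.⊥)
  where import Data.Empty

-- a_i = ∏_{j<i} s_j  (indices 0-based here: a i = product of s j, toℕ j < toℕ i)
aCoef : ∀ {r} → (Fin r → ℕ) → Fin r → ℕ
aCoef {r} s i = product (map s (filter (λ j → toℕ j <? toℕ i) (allFin r)))

-- A = Σ_{i=2}^r a_i  (0-based: indices with toℕ i ≥ 1)
sumA : ∀ {r} → (Fin r → ℕ) → ℕ
sumA {r} s = sum (map (aCoef s) (filter (λ i → 1 ≤? toℕ i) (allFin r)))

ValidS : ∀ {r} → (Fin r → ℕ) → Set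
ValidS {r} s = (∀ i → 2 ≤ s i) × (∀ i j → i ≤ᶠ j → s i ≤ s j)

-- Write aₗ = s₁ ⋯ sₗ₋₁ and A = a₂ + ⋯ + a_r.
--
-- Upper bound: by averaging over one part after the other, a K-free subgraph of a complete r-partite
-- r-graph with parts of size N^(aₗ) has density O(1/N), and the vertices of the first part of this r-graph
-- have degree N^A.  Superposing translates of it along a group equalises the degrees.
--
-- Lower bound: pass to an r-partite subgraph.  Call a position of an edge low at level k if at most m^(aₖ)
-- edges differ from it only there, where m^A slightly exceeds r Δ.  If, for each k ≥ 2, one repeatedly
-- discards the edges with at least k low positions at level k, nothing remains: from a remaining edge one
-- could vary the positions one after the other in m^A > r Δ ways altogether.  Hence a constant proportion of
-- the edges has the same k low positions.  Colour the vertices with about m^(aₖ) colours so that for half of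
-- these edges no conflict arises in the low positions, and keep the edges whose k colours satisfy a random-like
-- algebraic equation over a field of prime order p ≥ C m.  Such an equation has no complete k-partite solution set
-- with parts of size s₁, …, sₖ once sₖ is large: fixing all parts but the largest leaves at least aₖ equations,
-- with linearly independent leading parts, on a point of an aₖ-dimensional variety, so that only boundedly many
-- solutions remain.  By pigeonhole a proportion 1/p of the edges is kept.
module Submission where

open import Level using (0ℓ)
open import Algebra.Bundles using (CommutativeMonoid; CommutativeSemiring; CommutativeRing)
open import Data.Bool using (Bool; false; if_then_else_)
import Data.Bool.Properties as Bool
open import Data.Nat using (ℕ; zero; suc; _+_; _*_; _^_; _∸_; _≤_; _<_; z≤n; s≤s; _≤?_; _<?_; NonZero; >-nonZero; >-nonZero⁻¹; nonTrivial⇒n>1)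
import Data.Nat.Properties as ℕ
import Data.Nat.Divisibility as ℕ
open import Data.Nat.DivMod using (_%_; _/_; m≡m%n+[m/n]*n; m%n<n; m/n*n≤m; m<n⇒m%n≡m; m*n/n≡m; /-monoˡ-≤; [m+n]%n≡m%n; %-distribˡ-+)
open import Data.Nat.Induction using (<-rec)
open import Data.Nat.ListAction using (sum) renaming (product to productᴸ)
open import Data.Nat.Primality using (Prime; prime?; prime⇒nonZero; prime⇒nonTrivial; euclidsLemma)
open import Data.Nat.Primality.Factorisation using (factorise)
open import Data.Nat.Solver using (module +-*-Solver)
open import Data.Fin using (Fin; toℕ; fromℕ<; inject≤; combine; finToFun; funToFin)
import Data.Fin.Properties as Fin
open import Data.Fin.Subset using (Subset)
import Data.Fin.Subset.Properties as Subset
open import Data.Vec as Vec using (Vec; []; _∷_; _∷ʳ_; here; there)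
import Data.Vec.Properties as Vec
import Data.Vec.Relation.Binary.Pointwise.Extensional as Ext
open import Data.List using (List; []; _∷_; _++_; length; filter; map; allFin; upTo; applyUpTo; tabulate; concatMap; lookup; replicate; cartesianProduct; cartesianProductWith)
import Data.List.Properties as List
open import Data.List.Relation.Unary.All as All using (All; []; _∷_)
import Data.List.Relation.Unary.All.Properties as All
open import Data.List.Relation.Unary.Any as Any using (here; there)
import Data.List.Relation.Unary.Any.Properties as Any
open import Data.List.Relation.Unary.AllPairs as AllPairs using (AllPairs; []; _∷_)
import Data.List.Relation.Unary.AllPairs.Properties as AllPairs
open import Data.List.Relation.Unary.Unique.Propositional using (Unique)
import Data.List.Relation.Unary.Unique.Propositional.Properties as Unique
open import Data.List.Relation.Binary.Permutation.Propositional as Perm using (_↭_; prep; swap)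
import Data.List.Relation.Binary.Permutation.Propositional.Properties as Perm
open import Data.List.Relation.Binary.Sublist.Propositional as Sublist using (_⊆_; []; _∷_)
import Data.List.Relation.Binary.Sublist.Propositional.Properties as Sublist
open import Data.List.Membership.Propositional using (_∈_; _∉_; find)
import Data.List.Membership.Propositional.Properties as ∈
import Data.List.Membership.DecPropositional as DecMem
open import Data.Product using (Σ; ∃; _×_; _,_; proj₁; proj₂)
import Data.Product.Properties as Product
open import Data.Sum using (_⊎_; inj₁; inj₂)
import Data.Sum as Sum
open import Data.Unit using (⊤; tt)
open import Function using (_∘_; id)
open import Relation.Nullary using (¬_; Dec; yes; no; does; contradiction)
open import Relation.Nullary.Decidable using (¬?; _×-dec_; _⊎-dec_; map′; decidable-stable)
open import Relation.Unary using (Decidable)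
open import Relation.Binary.Definitions using (DecidableEquality; Tri; tri<; tri≈; tri>)
open import Relation.Binary.PropositionalEquality as ≡
  using (_≡_; _≢_; refl; sym; trans; cong; cong₂; subst; subst₂; module ≡-Reasoning)

-- Counting in lists

-- The equation can exclude a copy of K only if the vertices of each part of the copy have different
-- colours, while a variety of dimension aₖ offers only about p^(aₖ) colours. Two vertices of one
-- part can be exchanged within an edge, so they come from two edges that differ in one position
-- only. Low codegree is exactly what makes such pairs rare enough to be kept apart by that many
-- colours. The bound on common solutions uses linear algebra rather than Bézout or dimension
-- theory: every functional on the solution set that kills the monomials of small degree kills all
-- monomials. The colours have far more coordinates than aₖ because any aₖ contexts must yield
-- independent leading parts. Random choices are replaced by pigeonhole and greedy choices. Apart
-- from constants, the loss Δ^o(1) comes only from the prime, which an elementary divisibility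
-- argument finds up to a logarithmic factor above C m. In the upper bound, averaging over a part of
-- size s turns a density 1/Λ into about Λ^(-s); the products aₗ of part sizes therefore appear as
-- exponents.

^-distribʳ-* : ∀ k m n → (m * n) ^ k ≡ m ^ k * n ^ k
^-distribʳ-* zero    m n = refl
^-distribʳ-* (suc k) m n = trans (cong (m * n *_) (^-distribʳ-* k m n)) (ℕ.[m*n]*[o*p]≡[m*o]*[n*p] m n (m ^ k) (n ^ k))

m≤m^n : ∀ m {n} → 0 < n → m ≤ m ^ n
m≤m^n zero            _ = z≤n
m≤m^n (suc m) {suc n} _ = ℕ.m≤m*n (suc m) (suc m ^ n) {{ℕ.m^n≢0 (suc m) n}}

0^n≡0 : ∀ {n} → 0 < n → 0 ^ n ≡ 0
0^n≡0 {suc n} _ = refl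

-- Sums in ℕ, products in ℕ and sums in the field are all instances, so the monoid is kept abstract.
module ListFold (M : CommutativeMonoid 0ℓ 0ℓ) where
  open CommutativeMonoid M renaming (refl to ≈refl; sym to ≈sym; trans to ≈trans)
  open import Algebra.Properties.CommutativeSemigroup commutativeSemigroup using (interchange)

  ∑ : {A : Set} → List A → (A → Carrier) → Carrier
  ∑ []       f = ε
  ∑ (x ∷ xs) f = f x ∙ ∑ xs f

  module _ {A : Set} where

    ∑-cong∈ : ∀ (xs : List A) {f g} → (∀ x → x ∈ xs → f x ≈ g x) → ∑ xs f ≈ ∑ xs g
    ∑-cong∈ []       h = ≈refl
    ∑-cong∈ (x ∷ xs) h = ∙-cong (h x (here refl)) (∑-cong∈ xs λ y y∈ → h y (there y∈))

    ∑-cong : ∀ (xs : List A) {f g} → (∀ x → f x ≈ g x) → ∑ xs f ≈ ∑ xs g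
    ∑-cong xs h = ∑-cong∈ xs λ x _ → h x

    ∑-zero : ∀ (xs : List A) {f} → (∀ x → x ∈ xs → f x ≈ ε) → ∑ xs f ≈ ε
    ∑-zero []       h = ≈refl
    ∑-zero (x ∷ xs) h =
      ≈trans (∙-cong (h x (here refl)) (∑-zero xs λ y y∈ → h y (there y∈))) (identityˡ ε)

    ∑-∙ : ∀ (xs : List A) f g → ∑ xs (λ x → f x ∙ g x) ≈ ∑ xs f ∙ ∑ xs g
    ∑-∙ []       f g = ≈sym (identityˡ ε)
    ∑-∙ (x ∷ xs) f g =
      ≈trans (∙-congˡ (∑-∙ xs f g)) (interchange (f x) (g x) (∑ xs f) (∑ xs g))

    ∑-filter : ∀ {P : A → Set} (P? : Decidable P) (xs : List A) {f} →
               (∀ x → x ∈ xs → ¬ P x → f x ≈ ε) → ∑ xs f ≈ ∑ (filter P? xs) f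
    ∑-filter P? []       h = ≈refl
    ∑-filter P? (x ∷ xs) h with P? x
    ... | yes p = ∙-congˡ (∑-filter P? xs λ y y∈ → h y (there y∈))
    ... | no ¬p = ≈trans (∙-cong (h x (here refl) ¬p) (∑-filter P? xs λ y y∈ → h y (there y∈))) (identityˡ _)

    ∑-single : ∀ {xs : List A} → Unique xs → ∀ {x₀ f} → x₀ ∈ xs →
               (∀ x → x ∈ xs → x ≢ x₀ → f x ≈ ε) → ∑ xs f ≈ f x₀
    ∑-single (x∉ ∷ u) (here refl) h =
      ≈trans (∙-congˡ (∑-zero _ λ y y∈ → h y (there y∈) λ { refl → All.lookup x∉ y∈ refl })) (identityʳ _)
    ∑-single (x∉ ∷ u) (there x₀∈) h =
      ≈trans (∙-cong (h _ (here refl) λ { refl → All.lookup x∉ x₀∈ refl })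
                     (∑-single u x₀∈ λ y y∈ → h y (there y∈))) (identityˡ _)

  ∑-swap : ∀ {A B : Set} (xs : List A) (ys : List B) (f : A → B → Carrier) →
           ∑ xs (λ x → ∑ ys (f x)) ≈ ∑ ys (λ y → ∑ xs (λ x → f x y))
  ∑-swap []       ys f = ≈sym (∑-zero ys λ _ _ → ≈refl)
  ∑-swap (x ∷ xs) ys f =
    ≈trans (∙-congˡ (∑-swap xs ys f)) (≈sym (∑-∙ ys (f x) (λ y → ∑ xs (λ x → f x y))))

module ListSum (S : CommutativeSemiring 0ℓ 0ℓ) where
  open CommutativeSemiring S renaming (_+_ to _⊕_; _*_ to _⊗_; refl to ≈refl; sym to ≈sym; trans to ≈trans)
  open ListFold +-commutativeMonoid public renaming (∑-∙ to ∑-+)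

  module _ {A : Set} where

    ∑-*ˡ : ∀ (xs : List A) c f → ∑ xs (λ x → c ⊗ f x) ≈ c ⊗ ∑ xs f
    ∑-*ˡ []       c f = ≈sym (zeroʳ c)
    ∑-*ˡ (x ∷ xs) c f = ≈trans (+-congˡ (∑-*ˡ xs c f)) (≈sym (distribˡ c (f x) (∑ xs f)))

    ∑-*ʳ : ∀ (xs : List A) c f → ∑ xs (λ x → f x ⊗ c) ≈ ∑ xs f ⊗ c
    ∑-*ʳ xs c f =
      ≈trans (∑-cong xs λ x → *-comm (f x) c) (≈trans (∑-*ˡ xs c f) (*-comm c _))

open ListSum ℕ.+-*-commutativeSemiring public
open ListFold ℕ.*-1-commutativeMonoid public
  using () renaming (∑ to ∏; ∑-cong to ∏-cong; ∑-cong∈ to ∏-cong∈; ∑-zero to ∏-one; ∑-∙ to ∏-*; ∑-filter to ∏-filter; ∑-single to ∏-single)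

ind : {P : Set} → Dec P → ℕ
ind d = if does d then 1 else 0

≤ind : ∀ {P : Set} (d : Dec P) {m} → (P → m ≤ 1) → (¬ P → m ≡ 0) → m ≤ ind d
≤ind (yes p) h _ = h p
≤ind (no ¬p) _ h = ℕ.≤-reflexive (h ¬p)

ind≤ : ∀ {P : Set} (d : Dec P) {m} → (P → 1 ≤ m) → ind d ≤ m
ind≤ (yes p) h = h p
ind≤ (no ¬p) h = z≤n

# : {A : Set} {P : A → Set} → Decidable P → List A → ℕ
# P? xs = length (filter P? xs)

module _ {A : Set} where

  ∑-mono-≤ : ∀ (xs : List A) {f g : A → ℕ} → (∀ x → x ∈ xs → f x ≤ g x) → ∑ xs f ≤ ∑ xs g
  ∑-mono-≤ []       h = z≤n
  ∑-mono-≤ (x ∷ xs) h = ℕ.+-mono-≤ (h x (here refl)) (∑-mono-≤ xs λ y y∈ → h y (there y∈))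

  ∑-const : ∀ (xs : List A) c → ∑ xs (λ _ → c) ≡ length xs * c
  ∑-const []       c = refl
  ∑-const (x ∷ xs) c = cong (c +_) (∑-const xs c)

  ∑-term : ∀ {xs : List A} {x} (f : A → ℕ) → x ∈ xs → f x ≤ ∑ xs f
  ∑-term f (here refl) = ℕ.m≤m+n _ _
  ∑-term f (there x∈)  = ℕ.≤-trans (∑-term f x∈) (ℕ.m≤n+m _ _)

  length≡∑ : ∀ (xs : List A) → length xs ≡ ∑ xs (λ _ → 1)
  length≡∑ xs = trans (sym (ℕ.*-identityʳ _)) (sym (∑-const xs 1))

  ∑≤max : ∀ (xs : List A) (f : A → ℕ) → 0 < length xs → ∃ λ x → x ∈ xs × ∑ xs f ≤ length xs * f x
  ∑≤max (x ∷ [])      f _ = x , here refl , ℕ.≤-refl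
  ∑≤max (x ∷ y ∷ ys)  f _ with ∑≤max (y ∷ ys) f (s≤s z≤n)
  ... | z , z∈ , le with ℕ.≤-total (f x) (f z)
  ...   | inj₁ x≤z = z , there z∈ , ℕ.+-mono-≤ x≤z le
  ...   | inj₂ z≤x = x , here refl ,
                     ℕ.+-monoʳ-≤ (f x) (ℕ.≤-trans le (ℕ.*-monoʳ-≤ (length (y ∷ ys)) z≤x))

  min≤∑ : ∀ (xs : List A) (f : A → ℕ) → 0 < length xs → ∃ λ x → x ∈ xs × length xs * f x ≤ ∑ xs f
  min≤∑ (x ∷ [])      f _ = x , here refl , ℕ.≤-refl
  min≤∑ (x ∷ y ∷ ys)  f _ with min≤∑ (y ∷ ys) f (s≤s z≤n)
  ... | z , z∈ , le with ℕ.≤-total (f x) (f z)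
  ...   | inj₂ z≤x = z , there z∈ , ℕ.+-mono-≤ z≤x le
  ...   | inj₁ x≤z = x , here refl ,
                     ℕ.+-monoʳ-≤ (f x) (ℕ.≤-trans (ℕ.*-monoʳ-≤ (length (y ∷ ys)) x≤z) le)

  module _ {P : A → Set} (P? : Decidable P) where

    #≡∑ : ∀ xs → # P? xs ≡ ∑ xs (λ x → ind (P? x))
    #≡∑ []       = refl
    #≡∑ (x ∷ xs) with P? x
    ... | yes _ = cong suc (#≡∑ xs)
    ... | no  _ = #≡∑ xs

    #-zero : ∀ xs → (∀ x → x ∈ xs → ¬ P x) → # P? xs ≡ 0
    #-zero xs h = cong length (List.filter-none P? (All.tabulate λ x∈ → h _ x∈))

    #-all : ∀ xs → (∀ x → x ∈ xs → P x) → # P? xs ≡ length xs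
    #-all xs h = cong length (List.filter-all P? (All.tabulate λ x∈ → h _ x∈))

    #-split : ∀ xs → length xs ≡ # P? xs + # (¬? ∘ P?) xs
    #-split []       = refl
    #-split (x ∷ xs) with P? x
    ... | yes _ = cong suc (#-split xs)
    ... | no  _ = trans (cong suc (#-split xs)) (sym (ℕ.+-suc _ _))

    #-++ : ∀ xs ys → # P? (xs ++ ys) ≡ # P? xs + # P? ys
    #-++ xs ys = trans (cong length (List.filter-++ P? xs ys)) (List.length-++ (filter P? xs))

    #≤1 : ∀ {xs} → Unique xs → (∀ x y → x ∈ xs → y ∈ xs → P x → P y → x ≡ y) → # P? xs ≤ 1
    #≤1 [] h = z≤n
    #≤1 {x ∷ xs} (x∉ ∷ u) h with P? x
    ... | no _  = #≤1 u λ y z y∈ z∈ → h y z (there y∈) (there z∈)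
    ... | yes p = s≤s (ℕ.≤-reflexive (#-zero xs λ y y∈ py →
                    All.lookup x∉ y∈ (h x y (here refl) (there y∈) p py)))

    #-unique : ∀ {xs x} → Unique xs → x ∈ xs → P x → (∀ y → y ∈ xs → P y → y ≡ x) → # P? xs ≡ 1
    #-unique {xs} u x∈ px h = ℕ.≤-antisym
      (#≤1 u λ y z y∈ z∈ py pz → trans (h y y∈ py) (sym (h z z∈ pz)))
      (∈.∈-length (∈.∈-filter⁺ P? x∈ px))

  module _ {P Q : A → Set} (P? : Decidable P) (Q? : Decidable Q) where

    #-mono : ∀ xs → (∀ x → x ∈ xs → P x → Q x) → # P? xs ≤ # Q? xs
    #-mono [] h = z≤n
    #-mono (x ∷ xs) h with P? x | Q? x
    ... | yes p | yes q = s≤s (#-mono xs λ y y∈ → h y (there y∈))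
    ... | yes p | no ¬q = contradiction (h x (here refl) p) ¬q
    ... | no ¬p | yes q = ℕ.m≤n⇒m≤1+n (#-mono xs λ y y∈ → h y (there y∈))
    ... | no ¬p | no ¬q = #-mono xs λ y y∈ → h y (there y∈)

    #-filter-≤ : ∀ xs → # P? (filter Q? xs) ≤ # P? xs
    #-filter-≤ [] = z≤n
    #-filter-≤ (x ∷ xs) with Q? x
    #-filter-≤ (x ∷ xs) | yes q with P? x
    ... | yes p = s≤s (#-filter-≤ xs)
    ... | no ¬p = #-filter-≤ xs
    #-filter-≤ (x ∷ xs) | no ¬q with P? x
    ... | yes p = ℕ.m≤n⇒m≤1+n (#-filter-≤ xs)
    ... | no ¬p = #-filter-≤ xs

  unique⊆⇒length≤ : ∀ {xs ys : List A} → Unique xs → (∀ x → x ∈ xs → x ∈ ys) → length xs ≤ length ys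
  unique⊆⇒length≤ {[]} u h = z≤n
  unique⊆⇒length≤ {x ∷ xs} {ys} (x∉ ∷ u) h with ∈.∈-∃++ (h x (here refl))
  ... | as , bs , refl = begin
    suc (length xs) ≤⟨ s≤s (unique⊆⇒length≤ u sub) ⟩
    suc (length (as ++ bs)) ≡⟨ cong suc (List.length-++ as) ⟩
    suc (length as + length bs) ≡⟨ sym (ℕ.+-suc (length as) (length bs)) ⟩
    length as + suc (length bs) ≡⟨ sym (List.length-++ as) ⟩
    length (as ++ x ∷ bs) ∎
    where
    open ℕ.≤-Reasoning
    sub : ∀ y → y ∈ xs → y ∈ as ++ bs
    sub y y∈ with ∈.∈-++⁻ as (h y (there y∈))
    ... | inj₁ q            = ∈.∈-++⁺ˡ q
    ... | inj₂ (here refl)  = contradiction refl (All.lookup x∉ y∈)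
    ... | inj₂ (there q)    = ∈.∈-++⁺ʳ as q

∑-upTo-suc : ∀ k (f : ℕ → ℕ) → ∑ (upTo (suc k)) f ≡ ∑ (upTo k) f + f k
∑-upTo-suc k f = trans (cong (λ xs → ∑ xs f) (sym (List.upTo-∷ʳ k))) (snoc (upTo k))
  where
  snoc : ∀ xs → ∑ (xs ++ k ∷ []) f ≡ ∑ xs f + f k
  snoc []       = ℕ.+-identityʳ (f k)
  snoc (x ∷ xs) = trans (cong (f x +_) (snoc xs)) (sym (ℕ.+-assoc (f x) (∑ xs f) (f k)))

double-count : ∀ {A B : Set} {R : A → B → Set} (R? : ∀ x y → Dec (R x y)) xs ys →
               ∑ xs (λ x → # (R? x) ys) ≡ ∑ ys (λ y → # (λ x → R? x y) xs)
double-count R? xs ys = begin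
  ∑ xs (λ x → # (R? x) ys) ≡⟨ ∑-cong xs (λ x → #≡∑ (R? x) ys) ⟩
  ∑ xs (λ x → ∑ ys (λ y → ind (R? x y))) ≡⟨ ∑-swap xs ys (λ x y → ind (R? x y)) ⟩
  ∑ ys (λ y → ∑ xs (λ x → ind (R? x y))) ≡⟨ ∑-cong ys (λ y → sym (#≡∑ (λ x → R? x y) xs)) ⟩
  ∑ ys (λ y → # (λ x → R? x y) xs) ∎
  where open ≡-Reasoning

length-allFin : ∀ k → length (allFin k) ≡ k
length-allFin k = List.length-tabulate {n = k} id

module _ {A : Set} where

  length≡∑# : ∀ {k} (key : A → Fin k) (xs : List A) →
              length xs ≡ ∑ (allFin k) (λ c → # (λ x → key x Fin.≟ c) xs)
  length≡∑# {k} key xs = begin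
    length xs ≡⟨ length≡∑ xs ⟩
    ∑ xs (λ _ → 1) ≡⟨ ∑-cong xs (λ x → sym (one x)) ⟩
    ∑ xs (λ x → # (λ c → key x Fin.≟ c) (allFin k)) ≡⟨ double-count (λ x c → key x Fin.≟ c) xs (allFin k) ⟩
    ∑ (allFin k) (λ c → # (λ x → key x Fin.≟ c) xs) ∎
    where
    open ≡-Reasoning
    one : ∀ x → # (λ c → key x Fin.≟ c) (allFin k) ≡ 1
    one x = #-unique (λ c → key x Fin.≟ c) (Unique.allFin⁺ k) (∈.∈-allFin (key x)) refl (λ y _ e → sym e)

  -- The pigeonhole principle. Together with the greedy `colouring` it replaces the random choices
  -- of the lower bound.
  popular : ∀ {k} → 0 < k → (key : A → Fin k) (xs : List A) →
            ∃ λ c → length xs ≤ k * # (λ x → key x Fin.≟ c) xs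
  popular {k} 0<k key xs with ∑≤max (allFin k) (λ c → # (λ x → key x Fin.≟ c) xs) (subst (0 <_) (sym (length-allFin k)) 0<k)
  ... | c , _ , le = c , (begin
    length xs ≡⟨ length≡∑# key xs ⟩
    ∑ (allFin k) (λ c → # (λ x → key x Fin.≟ c) xs) ≤⟨ le ⟩
    length (allFin k) * # (λ x → key x Fin.≟ c) xs ≡⟨ cong (_* # (λ x → key x Fin.≟ c) xs) (length-allFin k) ⟩
    k * # (λ x → key x Fin.≟ c) xs ∎)
    where open ℕ.≤-Reasoning

fresh : ∀ {r} (L : List (Fin r)) → length L < r → ∃ λ j → j ∉ L
fresh {r} L lt with Fin.any? (λ j → ¬? (DecMem._∈?_ Fin._≟_ j L))
... | yes p = p
... | no ¬p = contradiction (subst (_≤ length L) (length-allFin r) (unique⊆⇒length≤ (Unique.allFin⁺ r) all∈)) (ℕ.<⇒≱ lt)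
  where
  all∈ : ∀ j → j ∈ allFin r → j ∈ L
  all∈ j _ with DecMem._∈?_ Fin._≟_ j L
  ... | yes q = q
  ... | no ¬q = contradiction (j , ¬q) ¬p

-- Monomials over a finite domain

-- Words stand for monomials, and a monomial occurs once for each ordering of its letters. The
-- repetition only enlarges the constants, which have to be independent of the field but not sharp.
wordsUpTo : {L : Set} → List L → ℕ → List (List L)
wordsUpTo ls zero    = [] ∷ []
wordsUpTo ls (suc m) = [] ∷ cartesianProductWith _∷_ ls (wordsUpTo ls m)

∈-wordsUpTo : ∀ {L : Set} {ls : List L} m {w} → All (_∈ ls) w → length w ≤ m → w ∈ wordsUpTo ls m
∈-wordsUpTo zero    []        le       = here refl
∈-wordsUpTo (suc m) []        le       = here refl
∈-wordsUpTo (suc m) (l∈ ∷ w∈) (s≤s le) = there (∈.∈-cartesianProductWith⁺ _∷_ l∈ (∈-wordsUpTo m w∈ le))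

wordsUpTo-length : ∀ {L : Set} (ls : List L) m {w} → w ∈ wordsUpTo ls m → length w ≤ m
wordsUpTo-length ls zero    (here refl) = z≤n
wordsUpTo-length ls (suc m) (here refl) = z≤n
wordsUpTo-length ls (suc m) (there w∈) with ∈.∈-cartesianProductWith⁻ _∷_ ls (wordsUpTo ls m) w∈
... | _ , _ , _ , w'∈ , refl = s≤s (wordsUpTo-length ls m w'∈)

gather : ∀ {n} (j : Fin n) w → w ↭ replicate (# (Fin._≟ j) w) j ++ filter (λ x → ¬? (x Fin.≟ j)) w
gather j [] = Perm.refl
gather j (x ∷ w) with x Fin.≟ j
... | yes refl = prep x (gather j w)
... | no _     = Perm.trans (prep x (gather j w)) (Perm.↭-sym (Perm.shift x (replicate (# (Fin._≟ j) w) j) _))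

extract : ∀ {n} (j : Fin n) d w → d ≤ # (Fin._≟ j) w → ∃ λ w' → w ↭ replicate d j ++ w'
extract j d w d≤ = replicate (c ∸ d) j ++ rest , Perm.trans (gather j w) (Perm.↭-reflexive eq)
  where
  c = # (Fin._≟ j) w
  rest = filter (λ x → ¬? (x Fin.≟ j)) w
  split : ∀ a b → replicate (a + b) j ++ rest ≡ replicate a j ++ replicate b j ++ rest
  split zero    b = refl
  split (suc a) b = cong (j ∷_) (split a b)
  eq : replicate c j ++ rest ≡ replicate d j ++ replicate (c ∸ d) j ++ rest
  eq = trans (cong (λ z → replicate z j ++ rest) (sym (ℕ.m+[n∸m]≡n d≤))) (split d (c ∸ d))

frequent : ∀ {n} d (w : List (Fin n)) → n * d < length w → ∃ λ j → d ≤ # (Fin._≟ j) w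
frequent {suc n} d w lt with popular {k = suc n} (s≤s z≤n) id w
... | j , le with d ≤? # (Fin._≟ j) w
...   | yes d≤ = j , d≤
...   | no  d≰ = contradiction (ℕ.<-≤-trans lt (ℕ.≤-trans le (ℕ.*-monoʳ-≤ (suc n) (ℕ.<⇒≤ (ℕ.≰⇒> d≰))))) (ℕ.<-irrefl refl)
frequent {zero} d (() ∷ w) lt

largest : ∀ {n} {P : Fin n → Set} → Decidable P → ∃ P → ∃ λ j → P j × (∀ k → toℕ j < toℕ k → ¬ P k)
largest {suc n} P? (x , px) with Fin.any? (P? ∘ Fin.suc)
... | yes (k , pk) with largest (P? ∘ Fin.suc) (k , pk)
...   | j , pj , max = Fin.suc j , pj , λ { (Fin.suc k) (s≤s lt) → max k lt }
largest {suc n} P? (Fin.zero , p0) | no ¬s = Fin.zero , p0 , λ { (Fin.suc k) _ pk → ¬s (k , pk) }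
largest {suc n} P? (Fin.suc x , px) | no ¬s = contradiction (x , px) ¬s

funToFin-cong : ∀ {m n} {f g : Fin m → Fin n} → (∀ a → f a ≡ g a) → funToFin f ≡ funToFin g
funToFin-cong {zero}  h = refl
funToFin-cong {suc m} h = cong₂ Data.Fin.combine (h Fin.zero) (funToFin-cong (h ∘ Fin.suc))

-- Equality is a setoid relation so that plain integers can represent residue classes; `code`
-- numbers the classes and makes pigeonhole arguments possible. Cancellation goes through
-- `no-zero-div`.
record FiniteDomain : Set₁ where
  field
    domain      : CommutativeRing 0ℓ 0ℓ
  open CommutativeRing domain public
    using (Carrier; _≈_; 0#; 1#) renaming (_*_ to _⊗_)
  field
    size        : ℕ
    code        : Carrier → Fin size
    decode      : Fin size → Carrier
    code-cong   : ∀ {x y} → x ≈ y → code x ≡ code y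
    code-inj    : ∀ {x y} → code x ≡ code y → x ≈ y
    code-decode : ∀ c → code (decode c) ≡ c
    no-zero-div : ∀ {x y} → x ⊗ y ≈ 0# → x ≈ 0# ⊎ y ≈ 0#
    1<size      : 1 < size

module DomainAlgebra (F : FiniteDomain) where
  open FiniteDomain F using (domain; size; code; decode; code-cong; code-inj; code-decode; no-zero-div; 1<size)
  open CommutativeRing domain public
    renaming (_+_ to _⊕_; _*_ to _⊗_; refl to ≈refl; sym to ≈sym; trans to ≈trans; reflexive to ≈reflexive)
    hiding (zero)
  open ListSum commutativeSemiring public
    renaming (∑ to ∑ᴿ; ∑-cong to ∑ᴿ-cong; ∑-cong∈ to ∑ᴿ-cong∈; ∑-zero to ∑ᴿ-zero; ∑-+ to ∑ᴿ-+; ∑-*ˡ to ∑ᴿ-*ˡ;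
              ∑-*ʳ to ∑ᴿ-*ʳ; ∑-filter to ∑ᴿ-filter; ∑-single to ∑ᴿ-single; ∑-swap to ∑ᴿ-swap)
  open import Relation.Binary.Reasoning.Setoid setoid public

  infix 4 _≟ᴿ_
  _≟ᴿ_ : ∀ x y → Dec (x ≈ y)
  x ≟ᴿ y = map′ code-inj code-cong (code x Fin.≟ code y)

  open import Algebra.Solver.Ring.NaturalCoefficients.Default commutativeSemiring public
    using (solve; _:=_; _:+_; _:*_)

  decode-inj : ∀ {a b} → decode a ≈ decode b → a ≡ b
  decode-inj {a} {b} eq = trans (sym (code-decode a)) (trans (code-cong eq) (code-decode b))

  x-y≈0⇒x≈y : ∀ {x y} → x - y ≈ 0# → x ≈ y
  x-y≈0⇒x≈y {x} {y} h = begin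
    x ≈⟨ ≈sym (≈trans (+-assoc x (- y) y) (≈trans (+-congˡ (-‿inverseˡ y)) (+-identityʳ x))) ⟩
    (x - y) ⊕ y ≈⟨ +-congʳ h ⟩
    0# ⊕ y ≈⟨ +-identityˡ y ⟩
    y ∎

  cancelʳ : ∀ {x y} → ¬ y ≈ 0# → x ⊗ y ≈ 0# → x ≈ 0#
  cancelʳ y≉0 h with no-zero-div h
  ... | inj₁ x≈0 = x≈0
  ... | inj₂ y≈0 = contradiction y≈0 y≉0

  ev : {L : Set} → (L → Carrier) → List L → Carrier
  ev ν []      = 1#
  ev ν (l ∷ w) = ν l ⊗ ev ν w

  ev-++ : ∀ {L : Set} (ν : L → Carrier) w w' → ev ν (w ++ w') ≈ ev ν w ⊗ ev ν w'
  ev-++ ν []      w' = ≈sym (*-identityˡ _)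
  ev-++ ν (l ∷ w) w' = ≈trans (*-congˡ (ev-++ ν w w')) (≈sym (*-assoc _ _ _))

  ev-↭ : ∀ {L : Set} (ν : L → Carrier) {w w'} → w ↭ w' → ev ν w ≈ ev ν w'
  ev-↭ ν Perm.refl        = ≈refl
  ev-↭ ν (prep x p)       = *-congˡ (ev-↭ ν p)
  ev-↭ ν (swap x y p)     = ≈trans (*-congˡ (*-congˡ (ev-↭ ν p)))
    (solve 3 (λ a b c → a :* (b :* c) := b :* (a :* c)) ≈refl (ν x) (ν y) _)
  ev-↭ ν (Perm.trans p q) = ≈trans (ev-↭ ν p) (ev-↭ ν q)

  -- Pigeonhole in place of elimination: there are `size ^ T` vectors and fewer possible images, so
  -- two vectors have the same image, and their difference lies in the kernel.
  nontrivial-kernel : ∀ T (rows : List (Fin T → Carrier)) → length rows < T →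
    ∃ λ (x : Fin T → Carrier) → (∃ λ a → ¬ x a ≈ 0#) ×
      (∀ row → row ∈ rows → ∑ᴿ (allFin T) (λ a → x a ⊗ row a) ≈ 0#)
  nontrivial-kernel T rows lt with
    Fin.pigeonhole (ℕ.^-monoʳ-< size 1<size lt) image
    where
    image : Fin (size ^ T) → Fin (size ^ length rows)
    image v = funToFin λ q → code (∑ᴿ (allFin T) (λ a → decode (finToFun v a) ⊗ lookup rows q a))
  ... | v , v' , v<v' , eq = x , nonzero , kernel
    where
    y y' x : Fin T → Carrier
    y  a = decode (finToFun v a)
    y' a = decode (finToFun v' a)
    x  a = y a - y' a

    nonzero : ∃ λ a → ¬ x a ≈ 0#
    nonzero = Fin.¬∀⟶∃¬ T _ (λ a → x a ≟ᴿ 0#) λ all0 →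
      Fin.<-irrefl (≡.trans (sym (Fin.funToFin-finToFin {T} {size} v))
        (≡.trans (funToFin-cong λ a → decode-inj (x-y≈0⇒x≈y (all0 a)))
                 (Fin.funToFin-finToFin {T} {size} v'))) v<v'

    kernel : ∀ row → row ∈ rows → ∑ᴿ (allFin T) (λ a → x a ⊗ row a) ≈ 0#
    kernel row row∈ = begin
      ∑ᴿ as (λ a → x a ⊗ row a)
        ≈⟨ ∑ᴿ-cong as (λ a → distribʳ (row a) (y a) (- y' a)) ⟩
      ∑ᴿ as (λ a → y a ⊗ row a ⊕ (- y' a) ⊗ row a)
        ≈⟨ ∑ᴿ-+ as _ _ ⟩
      ∑ᴿ as (λ a → y a ⊗ row a) ⊕ ∑ᴿ as (λ a → (- y' a) ⊗ row a)
        ≈⟨ +-congʳ same ⟩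
      ∑ᴿ as (λ a → y' a ⊗ row a) ⊕ ∑ᴿ as (λ a → (- y' a) ⊗ row a)
        ≈⟨ ≈sym (∑ᴿ-+ as _ _) ⟩
      ∑ᴿ as (λ a → y' a ⊗ row a ⊕ (- y' a) ⊗ row a)
        ≈⟨ ∑ᴿ-zero as (λ a _ → ≈trans (≈sym (distribʳ (row a) (y' a) (- y' a)))
             (≈trans (*-congʳ (-‿inverseʳ (y' a))) (zeroˡ (row a)))) ⟩
      0# ∎
      where
      as = allFin T
      q = Any.index row∈
      row≡ : row ≡ lookup rows q
      row≡ = Any.lookup-index row∈
      same : ∑ᴿ as (λ a → y a ⊗ row a) ≈ ∑ᴿ as (λ a → y' a ⊗ row a)
      same rewrite row≡ = code-inj (≡.trans (sym (Fin.finToFun-funToFin _ q))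
        (≡.trans (cong (λ z → finToFun z q) eq) (Fin.finToFun-funToFin _ q)))

  -- Multiplying the coefficients by ν b l - ν x l removes the point x.
  separation : ∀ {I L : Set} (ν : I → L → Carrier) (c : I → Carrier) (xs : List I) →
    AllPairs (λ a b → ∃ λ l → ¬ ν a l ≈ ν b l) xs →
    (∀ w → length w < length xs → ∑ᴿ xs (λ a → c a ⊗ ev (ν a) w) ≈ 0#) →
    ∀ a → a ∈ xs → c a ≈ 0#
  separation ν c (x ∷ xs) (x≉ ∷ ps) kills = result
    where
    tail-zero : ∀ b → b ∈ xs → c b ≈ 0#
    tail-zero b b∈ with All.lookup x≉ b∈
    ... | l , x≉b = cancelʳ (λ eq → x≉b (≈sym (x-y≈0⇒x≈y eq))) (separation ν c' xs ps kills' b b∈)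
      where
      c' : _ → Carrier
      c' a = c a ⊗ (ν a l - ν x l)
      kills' : ∀ w → length w < length xs → ∑ᴿ xs (λ a → c' a ⊗ ev (ν a) w) ≈ 0#
      kills' w lt = begin
        ∑ᴿ xs (λ a → c' a ⊗ ev (ν a) w)
          ≈⟨ ≈sym (+-identityˡ _) ⟩
        0# ⊕ ∑ᴿ xs (λ a → c' a ⊗ ev (ν a) w)
          ≈⟨ +-congʳ (≈sym (≈trans (*-congʳ (≈trans (*-congˡ (-‿inverseʳ (ν x l))) (zeroʳ (c x)))) (zeroˡ _))) ⟩
        ∑ᴿ (x ∷ xs) (λ a → c' a ⊗ ev (ν a) w)
          ≈⟨ ∑ᴿ-cong (x ∷ xs) (λ a → solve 4 (λ c n m e → c :* (n :+ m) :* e := c :* (n :* e) :+ m :* (c :* e))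
               ≈refl (c a) (ν a l) (- ν x l) (ev (ν a) w)) ⟩
        ∑ᴿ (x ∷ xs) (λ a → c a ⊗ ev (ν a) (l ∷ w) ⊕ (- ν x l) ⊗ (c a ⊗ ev (ν a) w))
          ≈⟨ ∑ᴿ-+ (x ∷ xs) _ _ ⟩
        ∑ᴿ (x ∷ xs) (λ a → c a ⊗ ev (ν a) (l ∷ w)) ⊕ ∑ᴿ (x ∷ xs) (λ a → (- ν x l) ⊗ (c a ⊗ ev (ν a) w))
          ≈⟨ +-cong (kills (l ∷ w) (s≤s lt)) (∑ᴿ-*ˡ (x ∷ xs) (- ν x l) _) ⟩
        0# ⊕ (- ν x l) ⊗ ∑ᴿ (x ∷ xs) (λ a → c a ⊗ ev (ν a) w)
          ≈⟨ +-identityˡ _ ⟩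
        (- ν x l) ⊗ ∑ᴿ (x ∷ xs) (λ a → c a ⊗ ev (ν a) w)
          ≈⟨ *-congˡ (kills w (ℕ.m≤n⇒m≤1+n lt)) ⟩
        (- ν x l) ⊗ 0#
          ≈⟨ zeroʳ _ ⟩
        0# ∎
    result : ∀ a → a ∈ x ∷ xs → c a ≈ 0#
    result a (there a∈)  = tail-zero a a∈
    result a (here refl) = begin
      c a ≈⟨ ≈sym (*-identityʳ (c a)) ⟩
      c a ⊗ 1# ≈⟨ ≈sym (+-identityʳ _) ⟩
      c a ⊗ 1# ⊕ 0# ≈⟨ +-congˡ (≈sym (∑ᴿ-zero xs λ b b∈ → ≈trans (*-congʳ (tail-zero b b∈)) (zeroˡ 1#))) ⟩
      ∑ᴿ (x ∷ xs) (λ a → c a ⊗ ev (ν a) []) ≈⟨ kills [] (s≤s z≤n) ⟩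
      0# ∎

  -- Linear functionals on the functions on the points `Y`, given by coefficients `c`. They are the
  -- dual form of reducing polynomials modulo the equations and avoid division with remainder.
  module Functional {n T : ℕ} (Y : Fin T → Fin n → Carrier) (c : Fin T → Carrier) where

    ⟨_⟩ : (Fin T → Carrier) → Carrier
    ⟨ g ⟩ = ∑ᴿ (allFin T) (λ b → c b ⊗ g b)

    Kills : ℕ → Set
    Kills k = ∀ w → length w < k → ⟨ (λ b → ev (Y b) w) ⟩ ≈ 0#

    moment : ℕ → List (Fin n) → Fin n → Carrier
    moment D u j = ⟨ (λ b → ev (Y b) (replicate D j ++ u)) ⟩

    support : ℕ → List (Fin n) → List (Fin n)
    support D u = filter (λ j → ¬? (moment D u j ≟ᴿ 0#)) (allFin n)

    ⟨⟩-cong : ∀ {g h} → (∀ b → g b ≈ h b) → ⟨ g ⟩ ≈ ⟨ h ⟩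
    ⟨⟩-cong e = ∑ᴿ-cong (allFin T) λ b → *-congˡ (e b)

    ⟨⟩-* : ∀ s g → ⟨ (λ b → s ⊗ g b) ⟩ ≈ s ⊗ ⟨ g ⟩
    ⟨⟩-* s g = ≈trans (∑ᴿ-cong (allFin T) λ b → solve 3 (λ a s g → a :* (s :* g) := s :* (a :* g)) ≈refl (c b) s (g b))
                      (∑ᴿ-*ˡ (allFin T) s _)

    ⟨⟩-∑ : ∀ {A : Set} (xs : List A) (g : A → Fin T → Carrier) →
           ⟨ (λ b → ∑ᴿ xs (λ x → g x b)) ⟩ ≈ ∑ᴿ xs (λ x → ⟨ g x ⟩)
    ⟨⟩-∑ xs g = ≈trans (∑ᴿ-cong (allFin T) λ b → ≈sym (∑ᴿ-*ˡ xs (c b) (λ x → g x b)))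
                       (∑ᴿ-swap (allFin T) xs (λ b x → c b ⊗ g x b))

  -- A functional on the values at the points Y that kills all monomials of degree at most nD kills
  -- every monomial: a longer one contains some D-th power, and the D-th powers are eliminated by the
  -- Vandermonde relations together with the bound on the support of the moments.
  module _ {n T M D : ℕ} (Y : Fin T → Fin n → Carrier) (α : Fin n → Carrier)
           (α-inj : ∀ {i j} → i ≢ j → ¬ α i ≈ α j)
           (rows : ∀ (w : List ⊤) → length w < M →
                   ∃ λ d → ∀ b → ∑ᴿ (allFin n) (λ j → ev (λ _ → α j) w ⊗ ev (Y b) (replicate D j)) ≈ d)
           (0<D : 0 < D) where

    module _ (c : Fin T → Carrier)
             (support≤M : ∀ k → Functional.Kills Y c k → ∀ u → length u + D ≤ k → length (Functional.support Y c D u) ≤ M) where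
      open Functional Y c

      -- Apply the functional to a relation multiplied by `u`. The right side becomes a constant
      -- times the value at `u`, whose degree is below k, so it vanishes. The moments thus satisfy
      -- the first M Vandermonde relations, which have only the zero solution on a support of at
      -- most M positions.
      moment-zero : ∀ k → Kills k → ∀ u → length u + D ≤ k → ∀ j → moment D u j ≈ 0#
      moment-zero k kills u le j with moment D u j ≟ᴿ 0#
      ... | yes eq = eq
      ... | no neq = separation (λ j _ → α j) v supp pairs killed j
                       (∈.∈-filter⁺ (λ j → ¬? (moment D u j ≟ᴿ 0#)) (∈.∈-allFin j) neq)
        where
        v = moment D u
        supp = support D u
        pairs : AllPairs (λ a b → ∃ λ (l : ⊤) → ¬ α a ≈ α b) supp
        pairs = AllPairs.map (λ a≢b → tt , α-inj a≢b) (Unique.filter⁺ (λ j → ¬? (moment D u j ≟ᴿ 0#)) (Unique.allFin⁺ n))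
        killed : ∀ w → length w < length supp → ∑ᴿ supp (λ j → v j ⊗ ev (λ _ → α j) w) ≈ 0#
        killed w lt with rows w (ℕ.<-≤-trans lt (support≤M k kills u le))
        ... | d , hd = begin
          ∑ᴿ supp (λ j → v j ⊗ ev (λ _ → α j) w)
            ≈⟨ ≈sym (∑ᴿ-filter (λ j → ¬? (moment D u j ≟ᴿ 0#)) (allFin n) λ j _ ¬¬z →
                 ≈trans (*-congʳ (decidable-stable (moment D u j ≟ᴿ 0#) ¬¬z)) (zeroˡ _)) ⟩
          ∑ᴿ (allFin n) (λ j → v j ⊗ ev (λ _ → α j) w)
            ≈⟨ ∑ᴿ-cong (allFin n) (λ j → ≈trans (*-comm _ _) (≈sym (⟨⟩-* _ _))) ⟩
          ∑ᴿ (allFin n) (λ j → ⟨ (λ b → ev (λ _ → α j) w ⊗ ev (Y b) (replicate D j ++ u)) ⟩)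
            ≈⟨ ≈sym (⟨⟩-∑ (allFin n) (λ j b → ev (λ _ → α j) w ⊗ ev (Y b) (replicate D j ++ u))) ⟩
          ⟨ (λ b → ∑ᴿ (allFin n) (λ j → ev (λ _ → α j) w ⊗ ev (Y b) (replicate D j ++ u))) ⟩
            ≈⟨ ⟨⟩-cong (λ b → ∑ᴿ-cong (allFin n) λ j →
                 ≈trans (*-congˡ (ev-++ (Y b) (replicate D j) u)) (≈sym (*-assoc _ _ _))) ⟩
          ⟨ (λ b → ∑ᴿ (allFin n) (λ j → (ev (λ _ → α j) w ⊗ ev (Y b) (replicate D j)) ⊗ ev (Y b) u)) ⟩
            ≈⟨ ⟨⟩-cong (λ b → ≈trans (∑ᴿ-*ʳ (allFin n) (ev (Y b) u) _) (*-congʳ (hd b))) ⟩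
          ⟨ (λ b → d ⊗ ev (Y b) u) ⟩
            ≈⟨ ⟨⟩-* d _ ⟩
          d ⊗ ⟨ (λ b → ev (Y b) u) ⟩
            ≈⟨ *-congˡ (kills u (ℕ.<-≤-trans (ℕ.m<m+n (length u) 0<D) le)) ⟩
          d ⊗ 0#
            ≈⟨ zeroʳ d ⟩
          0# ∎

      kills-all : ∀ m → Kills (suc (n * D)) → Kills (m + suc (n * D))
      kills-all zero    base = base
      kills-all (suc m) base w (s≤s lt) with ℕ.m≤n⇒m<n∨m≡n lt
      ... | inj₁ lt' = kills-all m base w lt'
      ... | inj₂ eq with frequent D w (ℕ.<-≤-trans (ℕ.m≤n+m (suc (n * D)) m) (ℕ.≤-reflexive (sym eq)))
      ...   | j , D≤ with extract j D w D≤
      ...     | u , w↭ = ≈trans (⟨⟩-cong λ b → ev-↭ (Y b) w↭)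
                  (moment-zero (m + suc (n * D)) (kills-all m base) u (ℕ.≤-reflexive len) j)
        where
        len : length u + D ≡ m + suc (n * D)
        len = ≡.trans (ℕ.+-comm (length u) D)
              (≡.trans (cong (_+ length u) (sym (List.length-replicate D)))
              (≡.trans (sym (List.length-++ (replicate D j)))
              (≡.trans (sym (Perm.↭-length w↭)) eq)))

    -- With more points than words of length at most `n * D`, some nonzero functional would kill all
    -- these words, hence all words whatsoever, and `separation` would force it to be zero.
    few-points :
      (∀ c → let open Functional Y c in
        ∀ k → Kills k → ∀ u → length u + D ≤ k → length (support D u) ≤ M) →
      (∀ {a b} → a ≢ b → ∃ λ j → ¬ Y a j ≈ Y b j) →
      T ≤ length (wordsUpTo (allFin n) (n * D))
    few-points sup distinct = ℕ.≮⇒≥ contra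
      where
      ws = wordsUpTo (allFin n) (n * D)
      contra : ¬ length ws < T
      contra lt with nontrivial-kernel T (map (λ w b → ev (Y b) w) ws)
                       (subst (_< T) (sym (List.length-map _ ws)) lt)
      ... | c , (a , ca≉0) , ker = ca≉0 (separation Y c (allFin T)
               (AllPairs.map distinct (Unique.allFin⁺ T)) killed a (∈.∈-allFin a))
        where
        open Functional Y c
        base : Kills (suc (n * D))
        base w (s≤s le) = ker _ (∈.∈-map⁺ (λ w b → ev (Y b) w) (∈-wordsUpTo (n * D) {w} (All.tabulate λ {j} _ → ∈.∈-allFin j) le))
        killed : ∀ w → length w < length (allFin T) → ⟨ (λ b → ev (Y b) w) ⟩ ≈ 0#
        killed w _ = kills-all c (sup c) (suc (length w)) base w (ℕ.<-≤-trans (ℕ.n<1+n _) (ℕ.m≤m+n _ _))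

-- Colours without large common neighbourhoods

lookup-unique-injective : ∀ {A : Set} {xs : List A} → Unique xs → ∀ {a b} → lookup xs a ≡ lookup xs b → a ≡ b
lookup-unique-injective (x∉ ∷ u) {Fin.zero}  {Fin.zero}  eq = refl
lookup-unique-injective (x∉ ∷ u) {Fin.zero}  {Fin.suc b} eq = contradiction eq (All.lookup x∉ (∈.∈-lookup b))
lookup-unique-injective (x∉ ∷ u) {Fin.suc a} {Fin.zero}  eq = contradiction (sym eq) (All.lookup x∉ (∈.∈-lookup a))
lookup-unique-injective (x∉ ∷ u) {Fin.suc a} {Fin.suc b} eq = cong Fin.suc (lookup-unique-injective u eq)

funToFin-injective : ∀ {m n} {f g : Fin m → Fin n} → funToFin f ≡ funToFin g → ∀ a → f a ≡ g a
funToFin-injective {f = f} {g} eq a =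
  trans (sym (Fin.finToFun-funToFin f a)) (trans (cong (λ z → finToFun z a) eq) (Fin.finToFun-funToFin g a))

finToFun-injective : ∀ {m n} {v w : Fin (n ^ m)} → (∀ a → finToFun {n} {m} v a ≡ finToFun w a) → v ≡ w
finToFun-injective {m} {n} {v} {w} h = trans (sym (Fin.funToFin-finToFin {m} {n} v))
  (trans (funToFin-cong h) (Fin.funToFin-finToFin {m} {n} w))

power-cancel : ∀ {p m S k} → 0 < p → S ≤ m → p ^ m ≤ p ^ (m ∸ S) * k → p ^ S ≤ k
power-cancel {p} {m} {S} {k} 0<p S≤m le = ℕ.*-cancelˡ-≤ (p ^ (m ∸ S)) {{ℕ.m^n≢0 p (m ∸ S) {{>-nonZero 0<p}}}} (begin
  p ^ (m ∸ S) * p ^ S ≡⟨ sym (ℕ.^-distribˡ-+-* p (m ∸ S) S) ⟩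
  p ^ (m ∸ S + S) ≡⟨ cong (p ^_) (ℕ.m∸n+n≡m S≤m) ⟩
  p ^ m ≤⟨ le ⟩
  p ^ (m ∸ S) * k ∎)
  where open ℕ.≤-Reasoning

complement-length : ∀ {m S} (base : Fin S → Fin m) → (∀ {s t} → base s ≡ base t → s ≡ t) →
                    ∀ xs → Unique xs → (∀ s → base s ∉ xs) → length xs ≤ m ∸ S
complement-length {m} {S} base inj xs u avoid = ℕ.m+n≤o⇒m≤o∸n (length xs) (begin
  length xs + S ≡⟨ cong (length xs +_) (sym (trans (List.length-map base (allFin S)) (length-allFin S))) ⟩
  length xs + length (map base (allFin S)) ≡⟨ sym (List.length-++ xs) ⟩
  length (xs ++ map base (allFin S)) ≤⟨ unique⊆⇒length≤ unique (λ x _ → ∈.∈-allFin x) ⟩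
  length (allFin m) ≡⟨ length-allFin m ⟩
  m ∎)
  where
  open ℕ.≤-Reasoning
  disjoint : ∀ {j} → j ∈ xs → ¬ (∃ λ s → s ∈ allFin S × j ≡ base s)
  disjoint j∈ (s , _ , refl) = avoid s j∈
  unique : Unique (xs ++ map base (allFin S))
  unique = Unique.++⁺ u (Unique.map⁺ inj (Unique.allFin⁺ S)) λ { (j∈ , j∈base) → disjoint j∈ (∈.∈-map⁻ base j∈base) }

letters : ∀ i S → List (Fin i × Fin S)
letters i S = cartesianProduct (allFin i) (allFin S)

-- The S empty words only ensure that there are at least S words.
words : ∀ i S → List (List (Fin i × Fin S))
words i S = replicate S [] ++ wordsUpTo (letters i S) S

dim : ℕ → ℕ → ℕ
dim i S = length (words i S)

-- Larger than every exponent `suc S + toℕ w` occurring in the value, so that each leading power can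
-- be multiplied up to the common degree D of the diagonal equations.
power : ℕ → ℕ → ℕ
power i S = suc S + dim i S

-- Depends on i and S but not on the field; this allows the growth condition on the part sizes to be
-- fixed before Δ and the prime are known.
bound : ℕ → ℕ → ℕ
bound i S = length (wordsUpTo (allFin (dim i S)) (dim i S * power i S))

S≤dim : ∀ i S → S ≤ dim i S
S≤dim i S = ℕ.≤-trans (ℕ.m≤m+n S _) (ℕ.≤-reflexive (sym (trans (List.length-++ (replicate S []))
              (cong (_+ length (wordsUpTo (letters i S) S)) (List.length-replicate S)))))

word-length : ∀ i S {w} → w ∈ words i S → length w ≤ S
word-length i S w∈ with ∈.∈-++⁻ (replicate S []) w∈
... | inj₂ q = wordsUpTo-length (letters i S) S q
... | inj₁ q with All.lookup (All.replicate⁺ {P = _≡ []} S refl) q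
...   | refl = z≤n

-- The colours are points of F^n, n = dim i S, satisfying n ∸ S diagonal equations of degree `power i S`
-- with Vandermonde coefficients; the key of a colour consists of its first S coordinates.  The value of
-- a tuple is ∑ⱼ ∑_w w(xₖ : k ≠ j) · (xⱼ)_w ^ (S + 1 + w), where w runs over the monomials of degree at
-- most S in the keys.  Fixing S different contexts off position j₀ and the value leaves S equations on
-- the colour at j₀ whose parts of degree above S are linearly independent.
module Palette (F : FiniteDomain) (i S : ℕ) (dim≤size : dim i S ≤ FiniteDomain.size F) where
  open FiniteDomain F using (size; code; decode; code-cong; code-inj; code-decode; no-zero-div; 1<size)
  open DomainAlgebra F

  private
    n D : ℕ
    n = dim i S
    D = power i S

  Letter : Set
  Letter = Fin i × Fin S

  word : Fin n → List Letter
  word = lookup (words i S)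

  base : Fin S → Fin n
  base s = inject≤ s (S≤dim i S)

  α : Fin n → Carrier
  α j = decode (inject≤ j dim≤size)

  α-injective : ∀ {j k} → j ≢ k → ¬ α j ≈ α k
  α-injective j≢k eq = j≢k (Fin.inject≤-injective dim≤size dim≤size _ _ (decode-inj eq))

  point : Fin (size ^ n) → Fin n → Carrier
  point v j = decode (finToFun v j)

  row : Fin (n ∸ S) → Fin (size ^ n) → Carrier
  row q v = ∑ᴿ (allFin n) λ j → ev (λ _ → α j) (replicate (toℕ q) tt) ⊗ ev (point v) (replicate D j)

  class : Fin (size ^ n) → Fin (size ^ (n ∸ S))
  class v = funToFin λ q → code (row q v)

  private
    0<size : 0 < size
    0<size = ℕ.<-trans (s≤s z≤n) 1<size

    popular-class = popular (ℕ.m^n>0 size {{>-nonZero 0<size}} (n ∸ S)) class (allFin (size ^ n))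

  -- The right-hand sides of the `n ∸ S` diagonal equations: the most popular ones are taken, so
  -- that at least `size ^ S` points remain.
  chosen : Fin (size ^ (n ∸ S))
  chosen = proj₁ popular-class

  points : List (Fin (size ^ n))
  points = filter (λ v → class v Fin.≟ chosen) (allFin (size ^ n))

  points-unique : Unique points
  points-unique = Unique.filter⁺ (λ v → class v Fin.≟ chosen) (Unique.allFin⁺ (size ^ n))

  colours : ℕ
  colours = length points

  many-colours : size ^ S ≤ colours
  many-colours = power-cancel 0<size (S≤dim i S)
    (subst (_≤ size ^ (n ∸ S) * colours) (length-allFin (size ^ n)) (proj₂ popular-class))

  colour : Fin colours → Fin n → Carrier
  colour c = point (lookup points c)

  key : Fin colours → Fin (size ^ S)
  key c = funToFin λ s → finToFun (lookup points c) (base s)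

  different-key : ∀ {c c'} → key c ≢ key c' → ∃ λ s → ¬ colour c (base s) ≈ colour c' (base s)
  different-key {c} {c'} neq = Fin.¬∀⟶∃¬ S _ (λ s → colour c (base s) ≟ᴿ colour c' (base s))
    λ all → neq (funToFin-cong λ s → decode-inj (all s))

  different-colour : ∀ {c c'} → c ≢ c' → ∃ λ j → ¬ colour c j ≈ colour c' j
  different-colour {c} {c'} neq = Fin.¬∀⟶∃¬ n _ (λ j → colour c j ≟ᴿ colour c' j)
    λ all → neq (lookup-unique-injective points-unique (finToFun-injective {n} λ j → decode-inj (all j)))

  rows : ∀ {T} (g : Fin T → Fin colours) (w : List ⊤) → length w < n ∸ S →
         ∃ λ d → ∀ b → ∑ᴿ (allFin n) (λ j → ev (λ _ → α j) w ⊗ ev (colour (g b)) (replicate D j)) ≈ d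
  rows g w lt = decode (finToFun chosen q) , λ b → code-inj (trans
      (cong code (cong (λ z → ∑ᴿ (allFin n) (λ j → ev (λ _ → α j) z ⊗ ev (colour (g b)) (replicate D j)))
        (trans (units w) (cong (λ z → replicate z tt) (sym (Fin.toℕ-fromℕ< lt))))))
      (trans (sym (Fin.finToFun-funToFin (λ q → code (row q (lookup points (g b)))) q))
      (trans (cong (λ z → finToFun z q) (in-class (g b))) (sym (code-decode _)))))
    where
    q = fromℕ< lt
    units : ∀ (w : List ⊤) → w ≡ replicate (length w) tt
    units []       = refl
    units (tt ∷ w) = cong (tt ∷_) (units w)
    in-class : ∀ c → class (lookup points c) ≡ chosen
    in-class c = proj₂ (∈.∈-filter⁻ (λ v → class v Fin.≟ chosen) {xs = allFin (size ^ n)} (∈.∈-lookup {xs = points} c))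

  -- The base coordinates are constant on a key class. Hence a D-th power of a base coordinate
  -- equals a scalar times a shorter monomial, which is killed already, and the support of the
  -- moments misses all S base positions.
  small-key-classes : ∀ κ → # (λ c → key c Fin.≟ κ) (allFin colours) ≤ bound i S
  small-key-classes κ = few-points {D = D} Y α α-injective (rows (lookup cs)) (s≤s z≤n) sup distinct
    where
    cs = filter (λ c → key c Fin.≟ κ) (allFin colours)
    cs-unique : Unique cs
    cs-unique = Unique.filter⁺ (λ c → key c Fin.≟ κ) (Unique.allFin⁺ colours)
    Y : Fin (length cs) → Fin n → Carrier
    Y b = colour (lookup cs b)
    distinct : ∀ {a b} → a ≢ b → ∃ λ j → ¬ Y a j ≈ Y b j
    distinct a≢b = different-colour λ eq → a≢b (lookup-unique-injective cs-unique eq)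
    Y-base : ∀ b s → Y b (base s) ≡ decode (finToFun κ s)
    Y-base b s = cong decode (trans (sym (Fin.finToFun-funToFin _ s)) (cong (λ z → finToFun z s)
      (proj₂ (∈.∈-filter⁻ (λ c → key c Fin.≟ κ) {xs = allFin colours} (∈.∈-lookup {xs = cs} b)))))
    sup : ∀ c → let open Functional Y c in
          ∀ k → Kills k → ∀ u → length u + D ≤ k → length (support D u) ≤ n ∸ S
    sup c k kills u le = complement-length base (Fin.inject≤-injective (S≤dim i S) (S≤dim i S) _ _) supp
        (Unique.filter⁺ (λ j → ¬? (moment D u j ≟ᴿ 0#)) (Unique.allFin⁺ n))
        λ s s∈ → proj₂ (∈.∈-filter⁻ (λ j → ¬? (moment D u j ≟ᴿ 0#)) {xs = allFin n} s∈) (base-moment s)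
      where
      open Functional Y c
      supp = support D u
      base-moment : ∀ s → moment D u (base s) ≈ 0#
      base-moment s = begin
        ⟨ (λ b → Y b (base s) ⊗ ev (Y b) v) ⟩
          ≈⟨ ⟨⟩-cong (λ b → *-congʳ (≈reflexive (Y-base b s))) ⟩
        ⟨ (λ b → decode (finToFun κ s) ⊗ ev (Y b) v) ⟩
          ≈⟨ ⟨⟩-* _ _ ⟩
        decode (finToFun κ s) ⊗ ⟨ (λ b → ev (Y b) v) ⟩
          ≈⟨ *-congˡ (kills v (ℕ.<-≤-trans (ℕ.≤-reflexive v-length) le)) ⟩
        decode (finToFun κ s) ⊗ 0#
          ≈⟨ zeroʳ _ ⟩
        0# ∎
        where
        v = replicate (S + n) (base s) ++ u
        v-length : suc (length v) ≡ length u + D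
        v-length = trans (cong suc (trans (List.length-++ (replicate (S + n) (base s)))
                     (cong (_+ length u) (List.length-replicate (S + n))))) (ℕ.+-comm D (length u))

  1#-if : {P : Set} → Dec P → Carrier → Carrier
  1#-if (yes _) y = 1#
  1#-if (no _)  y = y

  1#-if-no : ∀ {P : Set} (d : Dec P) → ¬ P → ∀ y → 1#-if d y ≡ y
  1#-if-no (yes p) ¬p y = contradiction p ¬p
  1#-if-no (no _)  ¬p y = refl

  -- Setting the letters of position j to 1 makes the coefficients at position j independent of
  -- `x j`.
  val : Fin i → (Fin i → Fin n → Carrier) → Letter → Carrier
  val j x (k , s) = 1#-if (k Fin.≟ j) (x k (base s))

  -- The exponent exceeds S, the largest degree that a word can reach, and increases with w. Among
  -- the powers left in a linear combination of equations, the one with the largest w is therefore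
  -- the unique leading term.
  summand : Fin i → Fin n → (Fin i → Fin n → Carrier) → Carrier
  summand j w x = ev (val j x) (word w) ⊗ ev (x j) (replicate (suc S + toℕ w) w)

  total : (Fin i → Fin n → Carrier) → Carrier
  total x = ∑ᴿ (allFin i) λ j → ∑ᴿ (allFin n) λ w → summand j w x

  value : (Fin i → Fin colours) → Fin size
  value χ = code (total (colour ∘ χ))

  ev-cong : ∀ {L : Set} {ν ν' : L → Carrier} → (∀ l → ν l ≈ ν' l) → ∀ w → ev ν w ≈ ev ν' w
  ev-cong h []      = ≈refl
  ev-cong h (l ∷ w) = *-cong (h l) (ev-cong h w)

  value-cong : ∀ {χ χ'} → (∀ j → χ j ≡ χ' j) → value χ ≡ value χ'
  value-cong {χ} {χ'} h = code-cong (∑ᴿ-cong (allFin i) λ j → ∑ᴿ-cong (allFin n) λ w →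
      *-cong (ev-cong (λ { (k , s) → letter k s (k Fin.≟ j) }) (word w))
             (≈reflexive (cong (λ z → ev (colour z) (replicate (suc S + toℕ w) w)) (h j))))
    where
    letter : ∀ k s {P : Set} (d : Dec P) → 1#-if d (colour (χ k) (base s)) ≈ 1#-if d (colour (χ' k) (base s))
    letter k s (yes _) = ≈refl
    letter k s (no _)  = ≈reflexive (cong (λ z → colour z (base s)) (h k))

  ev-replicate-+ : ∀ {L : Set} (ν : L → Carrier) a b l →
                   ev ν (replicate (a + b) l) ≈ ev ν (replicate a l) ⊗ ev ν (replicate b l)
  ev-replicate-+ ν zero    b l = ≈sym (*-identityˡ _)
  ev-replicate-+ ν (suc a) b l = ≈trans (*-congˡ (ev-replicate-+ ν a b l)) (≈sym (*-assoc _ _ _))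

  -- S contexts off `j₀` and T colours at `j₀`, every combination of which solves the equation: this
  -- is what a complete i-partite solution set provides.
  module _ {T : ℕ} (j₀ : Fin i) (ctx : Fin S → Fin i → Fin colours) (ys : Fin T → Fin colours)
           (x : Fin S → Fin T → Fin i → Fin colours) (c₀ : Fin size)
           (x-off : ∀ a b j → j ≢ j₀ → x a b j ≡ ctx a j)
           (x-at : ∀ a b → x a b j₀ ≡ ys b)
           (ctx-distinct : ∀ {a a'} → a ≢ a' → ∃ λ j → j ≢ j₀ × key (ctx a j) ≢ key (ctx a' j))
           (ys-distinct : ∀ {b b'} → b ≢ b' → key (ys b) ≢ key (ys b'))
           (constant : ∀ a b → value (x a b) ≡ c₀) where

    private
      Y : Fin T → Fin n → Carrier
      Y b = colour (ys b)

      X : Fin S → Fin i → Fin n → Carrier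
      X a j = colour (ctx a j)

      XY : Fin S → Fin T → Fin i → Fin n → Carrier
      XY a b j = colour (x a b j)

      Θ : Fin S → Fin n → Carrier
      Θ a w = ev (val j₀ (X a)) (word w)

      separated : ∀ {a a'} → a ≢ a' → ∃ λ l → ¬ val j₀ (X a) l ≈ val j₀ (X a') l
      separated {a} {a'} a≢a' =
        let j , j≢j₀ , neq = ctx-distinct a≢a'
            s , neq' = different-key neq
        in (j , s) , λ eq → neq' (≈trans (≈reflexive (sym (1#-if-no (j Fin.≟ j₀) j≢j₀ _)))
                             (≈trans eq (≈reflexive (1#-if-no (j Fin.≟ j₀) j≢j₀ _))))

      module _ (c : Fin T → Carrier) (k : ℕ) (kills : Functional.Kills Y c k) where
        open Functional Y c

        -- To the functional, g looks like a polynomial of degree at most d. Degrees are measured in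
        -- this way because g is given only by its values at the points.
        Low : ℕ → (Fin T → Carrier) → Set
        Low d g = ∀ v → length v + d < k → ⟨ (λ b → ev (Y b) v ⊗ g b) ⟩ ≈ 0#

        low-one : Low 0 (λ _ → 1#)
        low-one v lt = ≈trans (⟨⟩-cong λ b → *-identityʳ _) (kills v (subst (_< k) (ℕ.+-identityʳ _) lt))

        low-scale : ∀ {d g} r → Low d g → Low d (λ b → r ⊗ g b)
        low-scale r low v lt = ≈trans (⟨⟩-cong λ b → solve 3 (λ e r g → e :* (r :* g) := r :* (e :* g)) ≈refl (ev (Y b) v) r _)
          (≈trans (⟨⟩-* r _) (≈trans (*-congˡ (low v lt)) (zeroʳ r)))

        low-var : ∀ {d g} j → Low d g → Low (suc d) (λ b → Y b j ⊗ g b)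
        low-var {d} j low v lt = ≈trans (⟨⟩-cong λ b → solve 3 (λ e y g → e :* (y :* g) := (y :* e) :* g) ≈refl (ev (Y b) v) (Y b j) _)
          (low (j ∷ v) (subst (_< k) (ℕ.+-suc (length v) d) lt))

        low-cong : ∀ {d g h} → (∀ b → h b ≈ g b) → Low d g → Low d h
        low-cong e low v lt = ≈trans (⟨⟩-cong λ b → *-congˡ (e b)) (low v lt)

        low-suc : ∀ {d g} → Low d g → Low (suc d) g
        low-suc {d} low v lt = low v (ℕ.≤-<-trans (ℕ.+-monoʳ-≤ (length v) (ℕ.n≤1+n d)) lt)

        low-∑ : ∀ {A : Set} {d} (xs : List A) (g : A → Fin T → Carrier) → (∀ x → Low d (g x)) → Low d (λ b → ∑ᴿ xs (λ x → g x b))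
        low-∑ xs g low v lt =
          ≈trans (⟨⟩-cong λ b → ≈sym (∑ᴿ-*ˡ xs (ev (Y b) v) (λ x → g x b)))
          (≈trans (⟨⟩-∑ xs (λ x b → ev (Y b) v ⊗ g x b)) (∑ᴿ-zero xs λ x _ → low x v lt))

        low-mono : ∀ {d d' g} → d ≤ d' → Low d g → Low d' g
        low-mono le low v lt = low v (ℕ.≤-<-trans (ℕ.+-monoʳ-≤ (length v) le) lt)

        low-letter : ∀ a {j} → j ≢ j₀ → ∀ l s (d : Dec (l ≡ j)) (d₀ : Dec (l ≡ j₀)) {e g} →
                     Low e g → Low (suc e) (λ b → 1#-if d (XY a b l (base s)) ⊗ g b)
        low-letter a j≢ l s (yes _) _         low = low-suc (low-cong (λ b → *-identityˡ _) low)
        low-letter a j≢ l s (no _) (yes refl) low =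
          low-cong (λ b → *-congʳ (≈reflexive (cong (λ z → colour z (base s)) (x-at a b)))) (low-var (base s) low)
        low-letter a j≢ l s (no _) (no l≢)    low =
          low-suc (low-cong (λ b → *-congʳ (≈reflexive (cong (λ z → colour z (base s)) (x-off a b l l≢))))
                            (low-scale (X a l (base s)) low))

        low-word : ∀ a {j} → j ≢ j₀ → ∀ w → Low (length w) (λ b → ev (val j (XY a b)) w)
        low-word a j≢ [] = low-one
        low-word a {j} j≢ ((l , s) ∷ w) = low-letter a j≢ l s (l Fin.≟ j) (l Fin.≟ j₀) (low-word a j≢ w)

        -- Off `j₀` the power does not depend on b; the unknown colour enters through the word
        -- alone, which has length at most S.
        low-summands : ∀ a j → j ≢ j₀ → Low S (λ b → ∑ᴿ (allFin n) λ w → summand j w (XY a b))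
        low-summands a j j≢ = low-∑ (allFin n) (λ w b → summand j w (XY a b)) λ w →
          low-cong (λ b → ≈trans (*-congˡ (≈reflexive (cong (λ z → ev (colour z) (replicate (suc S + toℕ w) w)) (x-off a b j j≢)))) (*-comm _ _))
            (low-scale (ev (X a j) (replicate (suc S + toℕ w) w)) (low-mono (word-length i S (∈.∈-lookup w)) (low-word a j≢ (word w))))

        same-letter : ∀ a b l s (d : Dec (l ≡ j₀)) → 1#-if d (XY a b l (base s)) ≈ 1#-if d (X a l (base s))
        same-letter a b l s (yes _) = ≈refl
        same-letter a b l s (no l≢) = ≈reflexive (cong (λ z → colour z (base s)) (x-off a b l l≢))

        leading : ∀ a b w → summand j₀ w (XY a b) ≈ Θ a w ⊗ ev (Y b) (replicate (suc S + toℕ w) w)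
        leading a b w = *-cong (ev-cong (λ { (l , s) → same-letter a b l s (l Fin.≟ j₀) }) (word w))
            (≈reflexive (cong (λ z → ev (colour z) (replicate (suc S + toℕ w) w)) (x-at a b)))

        total-value : ∀ a b → total (XY a b) ≈ decode c₀
        total-value a b = code-inj (trans (constant a b) (sym (code-decode c₀)))

        module _ (u : List (Fin n)) (le : length u + D ≤ k) where

          Z : List (Fin n)
          Z = filter (λ j → moment D u j ≟ᴿ 0#) (allFin n)

          module _ (μ : Fin S → Carrier) where

            ℓ : Fin n → Carrier
            ℓ w = ∑ᴿ (allFin S) (λ a → μ a ⊗ Θ a w)

            -- Combine the S equations with weights μ and multiply by `h`. The summands of other
            -- positions, the constant, and the powers with w below `w₀` all have degree less than k
            -- and are killed; the powers above `w₀` have coefficient zero. Only the term of `w₀`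
            -- survives.
            leading-moment : ∀ w₀ → (∀ w → toℕ w₀ < toℕ w → ℓ w ≈ 0#) → ℓ w₀ ⊗ moment D u w₀ ≈ 0#
            leading-moment w₀ above = begin
              ℓ w₀ ⊗ moment D u w₀
                ≈⟨ *-congˡ (⟨⟩-cong split) ⟩
              ℓ w₀ ⊗ Q w₀
                ≈⟨ ≈sym (∑ᴿ-single (Unique.allFin⁺ n) (∈.∈-allFin w₀) (λ w _ w≢ → other w w≢ (ℕ.<-cmp (toℕ w) (toℕ w₀)))) ⟩
              ∑ᴿ (allFin n) (λ w → ℓ w ⊗ Q w)
                ≈⟨ ∑ᴿ-cong (allFin n) (λ w → ≈sym (≈trans (∑ᴿ-cong (allFin S) λ a → ≈sym (*-assoc _ _ _)) (∑ᴿ-*ʳ (allFin S) (Q w) _))) ⟩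
              ∑ᴿ (allFin n) (λ w → ∑ᴿ (allFin S) (λ a → μ a ⊗ (Θ a w ⊗ Q w)))
                ≈⟨ ∑ᴿ-swap (allFin n) (allFin S) _ ⟩
              ∑ᴿ (allFin S) (λ a → ∑ᴿ (allFin n) (λ w → μ a ⊗ (Θ a w ⊗ Q w)))
                ≈⟨ ∑ᴿ-zero (allFin S) (λ a _ → ≈trans (∑ᴿ-*ˡ (allFin n) (μ a) _) (≈trans (*-congˡ (context a)) (zeroʳ _))) ⟩
              0# ∎
              where
              h : List (Fin n)
              -- The number of copies of `w₀` raises its exponent `suc S + toℕ w₀` to exactly D.
              h = replicate (n ∸ toℕ w₀) w₀ ++ u
              h-length : length h ≡ (n ∸ toℕ w₀) + length u
              h-length = trans (List.length-++ (replicate (n ∸ toℕ w₀) w₀)) (cong (_+ length u) (List.length-replicate (n ∸ toℕ w₀)))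
              Q : Fin n → Carrier
              Q w = ⟨ (λ b → ev (Y b) h ⊗ ev (Y b) (replicate (suc S + toℕ w) w)) ⟩

              exponents : D ≡ (n ∸ toℕ w₀) + (suc S + toℕ w₀)
              exponents = trans (cong (suc S +_) (sym (ℕ.m∸n+n≡m (ℕ.<⇒≤ (Fin.toℕ<n w₀)))))
                (trans (sym (ℕ.+-assoc (suc S) (n ∸ toℕ w₀) (toℕ w₀)))
                (trans (cong (_+ toℕ w₀) (ℕ.+-comm (suc S) (n ∸ toℕ w₀))) (ℕ.+-assoc (n ∸ toℕ w₀) (suc S) (toℕ w₀))))

              split : ∀ b → ev (Y b) (replicate D w₀ ++ u) ≈ ev (Y b) h ⊗ ev (Y b) (replicate (suc S + toℕ w₀) w₀)
              split b = begin
                ev (Y b) (replicate D w₀ ++ u)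
                  ≈⟨ ev-++ (Y b) (replicate D w₀) u ⟩
                ev (Y b) (replicate D w₀) ⊗ ev (Y b) u
                  ≈⟨ *-congʳ (≈trans (≈reflexive (cong (λ z → ev (Y b) (replicate z w₀)) exponents))
                       (ev-replicate-+ (Y b) (n ∸ toℕ w₀) (suc S + toℕ w₀) w₀)) ⟩
                (ev (Y b) (replicate (n ∸ toℕ w₀) w₀) ⊗ ev (Y b) (replicate (suc S + toℕ w₀) w₀)) ⊗ ev (Y b) u
                  ≈⟨ solve 3 (λ p q r → (p :* q) :* r := (p :* r) :* q) ≈refl _ (ev (Y b) (replicate (suc S + toℕ w₀) w₀)) (ev (Y b) u) ⟩
                (ev (Y b) (replicate (n ∸ toℕ w₀) w₀) ⊗ ev (Y b) u) ⊗ ev (Y b) (replicate (suc S + toℕ w₀) w₀)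
                  ≈⟨ *-congʳ (≈sym (ev-++ (Y b) (replicate (n ∸ toℕ w₀) w₀) u)) ⟩
                ev (Y b) h ⊗ ev (Y b) (replicate (suc S + toℕ w₀) w₀) ∎

              short : ∀ e → e + (n ∸ toℕ w₀) < D → length h + e < k
              short e lt = ℕ.<-≤-trans (ℕ.≤-<-trans (ℕ.≤-reflexive
                  (trans (cong (_+ e) (trans h-length (ℕ.+-comm (n ∸ toℕ w₀) (length u))))
                  (trans (ℕ.+-assoc (length u) (n ∸ toℕ w₀) e) (cong (length u +_) (ℕ.+-comm (n ∸ toℕ w₀) e)))))
                  (ℕ.+-monoʳ-< (length u) lt)) le

              other : ∀ w → w ≢ w₀ → Tri (toℕ w < toℕ w₀) (toℕ w ≡ toℕ w₀) (toℕ w₀ < toℕ w) → ℓ w ⊗ Q w ≈ 0#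
              other w w≢ (tri> _ _ gt) = ≈trans (*-congʳ (above w gt)) (zeroˡ _)
              other w w≢ (tri≈ _ eq _) = contradiction (Fin.toℕ-injective eq) w≢
              other w w≢ (tri< lt _ _) = ≈trans (*-congˡ (≈trans (⟨⟩-cong λ b → ≈sym (ev-++ (Y b) h _))
                    (kills (h ++ replicate (suc S + toℕ w) w) (subst (_< k)
                      (sym (trans (List.length-++ h) (cong (length h +_) (List.length-replicate (suc S + toℕ w)))))
                      (short (suc S + toℕ w) (subst (suc S + toℕ w + (n ∸ toℕ w₀) <_)
                        (sym (trans exponents (ℕ.+-comm (n ∸ toℕ w₀) (suc S + toℕ w₀))))
                        (ℕ.+-monoˡ-< (n ∸ toℕ w₀) (ℕ.+-monoʳ-< (suc S) lt)))))))) (zeroʳ _)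

              context : ∀ a → ∑ᴿ (allFin n) (λ w → Θ a w ⊗ Q w) ≈ 0#
              context a = begin
                ∑ᴿ (allFin n) (λ w → Θ a w ⊗ Q w)
                  ≈⟨ ∑ᴿ-cong (allFin n) (λ w → ≈sym (⟨⟩-* (Θ a w) _)) ⟩
                ∑ᴿ (allFin n) (λ w → ⟨ (λ b → Θ a w ⊗ (ev (Y b) h ⊗ ev (Y b) (replicate (suc S + toℕ w) w))) ⟩)
                  ≈⟨ ∑ᴿ-cong (allFin n) (λ w → ⟨⟩-cong λ b → ≈trans
                       (solve 3 (λ p q r → p :* (q :* r) := q :* (p :* r)) ≈refl (Θ a w) (ev (Y b) h) (ev (Y b) (replicate (suc S + toℕ w) w)))
                       (*-congˡ (≈sym (leading a b w)))) ⟩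
                ∑ᴿ (allFin n) (λ w → ⟨ (λ b → ev (Y b) h ⊗ summand j₀ w (XY a b)) ⟩)
                  ≈⟨ ≈sym (≈trans (⟨⟩-cong λ b → ≈sym (∑ᴿ-*ˡ (allFin n) (ev (Y b) h) (λ w → summand j₀ w (XY a b))))
                                  (⟨⟩-∑ (allFin n) (λ w b → ev (Y b) h ⊗ summand j₀ w (XY a b)))) ⟩
                G j₀
                  ≈⟨ ≈sym (∑ᴿ-single (Unique.allFin⁺ i) (∈.∈-allFin j₀) λ j _ j≢ →
                       low-summands a j j≢ h (short S (s≤s (ℕ.+-monoʳ-≤ S (ℕ.m∸n≤m n (toℕ w₀)))))) ⟩
                ∑ᴿ (allFin i) G
                  ≈⟨ ≈sym (≈trans (⟨⟩-cong λ b → ≈sym (∑ᴿ-*ˡ (allFin i) (ev (Y b) h) (λ j → ∑ᴿ (allFin n) λ w → summand j w (XY a b))))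
                                  (⟨⟩-∑ (allFin i) (λ j b → ev (Y b) h ⊗ ∑ᴿ (allFin n) λ w → summand j w (XY a b)))) ⟩
                ⟨ (λ b → ev (Y b) h ⊗ total (XY a b)) ⟩
                  ≈⟨ ⟨⟩-cong (λ b → ≈trans (*-comm _ _) (*-congʳ (total-value a b))) ⟩
                ⟨ (λ b → decode c₀ ⊗ ev (Y b) h) ⟩
                  ≈⟨ ⟨⟩-* _ _ ⟩
                decode c₀ ⊗ ⟨ (λ b → ev (Y b) h) ⟩
                  ≈⟨ *-congˡ (kills h (subst (_< k) (ℕ.+-identityʳ _) (short 0 (s≤s (ℕ.≤-trans (ℕ.m∸n≤m n (toℕ w₀)) (ℕ.m≤n+m n S)))))) ⟩
                decode c₀ ⊗ 0#
                  ≈⟨ zeroʳ _ ⟩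
                0# ∎
                where
                G : Fin i → Carrier
                G j = ⟨ (λ b → ev (Y b) h ⊗ ∑ᴿ (allFin n) λ w → summand j w (XY a b)) ⟩

          -- Otherwise some nonzero μ makes ℓ vanish on Z. By independence ℓ is not zero everywhere;
          -- at the largest `w₀` with nonzero coefficient the moment vanishes by `leading-moment`,
          -- so `w₀` lies in Z after all.
          few-zeros-impossible : ¬ length Z < S
          few-zeros-impossible lt =
            let μ , (a , μa≉0) , ker = nontrivial-kernel S (map (λ w a → Θ a w) Z)
                                         (subst (_< S) (sym (List.length-map _ Z)) lt)
                w₀ , ℓ≉0 , max = largest (λ w → ¬? (ℓ μ w ≟ᴿ 0#))
                  (Fin.¬∀⟶∃¬ n _ (λ w → ℓ μ w ≟ᴿ 0#) λ all0 → μa≉0 (independent μ all0 a))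
            in ℓ≉0 (ker _ (∈.∈-map⁺ (λ w a → Θ a w)
                 (∈.∈-filter⁺ (λ j → moment D u j ≟ᴿ 0#) (∈.∈-allFin w₀)
                   (cancelʳ ℓ≉0 (≈trans (*-comm _ _)
                     (leading-moment μ w₀ λ w lt → decidable-stable (ℓ μ w ≟ᴿ 0#) (max w lt)))))))
            where
            -- Any two contexts differ in a letter off `j₀`, so the words of length below S separate
            -- the S contexts; this is what the words in `words i S` are for.
            independent : ∀ μ → (∀ w → ℓ μ w ≈ 0#) → ∀ a → μ a ≈ 0#
            independent μ all0 a = separation (λ a → val j₀ (X a)) μ (allFin S)
                (AllPairs.map separated (Unique.allFin⁺ S)) killed a (∈.∈-allFin a)
              where
              killed : ∀ w → length w < length (allFin S) → ∑ᴿ (allFin S) (λ a → μ a ⊗ ev (val j₀ (X a)) w) ≈ 0#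
              killed w w<S = subst (λ z → ∑ᴿ (allFin S) (λ a → μ a ⊗ ev (val j₀ (X a)) z) ≈ 0#)
                  (sym (Any.lookup-index w∈)) (all0 (Any.index w∈))
                where
                w∈ : w ∈ words i S
                w∈ = ∈.∈-++⁺ʳ (replicate S []) (∈-wordsUpTo S {w}
                  (All.tabulate λ _ → ∈.∈-cartesianProduct⁺ (∈.∈-allFin _) (∈.∈-allFin _))
                  (ℕ.<⇒≤ (subst (length w <_) (length-allFin S) w<S)))

          support-bound : length (support D u) ≤ n ∸ S
          support-bound = ℕ.≤-trans (ℕ.≤-reflexive (sym (ℕ.m+n∸m≡n (length Z) (length (support D u)))))
            (ℕ.≤-trans (ℕ.≤-reflexive (cong (_∸ length Z) (trans (sym (#-split (λ j → moment D u j ≟ᴿ 0#) (allFin n))) (length-allFin n))))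
                       (ℕ.∸-monoʳ-≤ n (ℕ.≮⇒≥ few-zeros-impossible)))

    few-common-extensions : T ≤ bound i S
    few-common-extensions = few-points {D = D} Y α α-injective (rows ys) (s≤s z≤n) support-bound
      λ b≢b' → let s , neq = different-key (ys-distinct b≢b') in base s , neq

-- The integers modulo a prime

module PrimeField (p : ℕ) (p-prime : Prime p) where
  open import Data.Integer as ℤ using (ℤ; +_; 0ℤ; 1ℤ; ∣_∣)
  import Data.Integer.Properties as ℤ
  open import Data.Integer.Divisibility.Signed using (_∣_; divides; ∣ᵤ⇒∣; ∣⇒∣ᵤ; ∣m∣n⇒∣m+n; ∣m⇒∣-m; ∣n⇒∣m*n)
  open import Data.Integer.DivMod using (_%ℕ_; _/ℕ_; n%ℕd<d; a≡a%ℕn+[a/ℕn]*n)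
  open import Data.Integer.Solver using () renaming (module +-*-Solver to ℤ-Solver)
  open ℤ-Solver

  private instance
    p≢0 : NonZero p
    p≢0 = prime⇒nonZero p-prime

  infix 4 _≋_
  _≋_ : ℤ → ℤ → Set
  x ≋ y = + p ∣ (x ℤ.- y)

  ≡⇒≋ : ∀ {x y} → x ≡ y → x ≋ y
  ≡⇒≋ {x} refl = divides 0ℤ (ℤ.+-inverseʳ x)

  ≋-sym : ∀ x y → x ≋ y → y ≋ x
  ≋-sym x y h = subst (+ p ∣_) (solve 2 (λ x y → :- (x :- y) := y :- x) refl x y) (∣m⇒∣-m h)

  ≋-trans : ∀ x y z → x ≋ y → y ≋ z → x ≋ z
  ≋-trans x y z h k = subst (+ p ∣_) (solve 3 (λ x y z → (x :- y) :+ (y :- z) := x :- z) refl x y z) (∣m∣n⇒∣m+n h k)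

  +-cong-≋ : ∀ x y u v → x ≋ y → u ≋ v → x ℤ.+ u ≋ y ℤ.+ v
  +-cong-≋ x y u v h k = subst (+ p ∣_)
    (solve 4 (λ x y u v → (x :- y) :+ (u :- v) := (x :+ u) :- (y :+ v)) refl x y u v) (∣m∣n⇒∣m+n h k)

  *-cong-≋ : ∀ x y u v → x ≋ y → u ≋ v → x ℤ.* u ≋ y ℤ.* v
  *-cong-≋ x y u v h k = subst (+ p ∣_)
    (solve 4 (λ x y u v → u :* (x :- y) :+ y :* (u :- v) := (x :* u) :- (y :* v)) refl x y u v)
    (∣m∣n⇒∣m+n (∣n⇒∣m*n u h) (∣n⇒∣m*n y k))

  neg-cong-≋ : ∀ x y → x ≋ y → ℤ.- x ≋ ℤ.- y
  neg-cong-≋ x y h = subst (+ p ∣_) (solve 2 (λ x y → :- (x :- y) := (:- x) :- (:- y)) refl x y) (∣m⇒∣-m h)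

  integersMod : CommutativeRing 0ℓ 0ℓ
  integersMod = record
    { Carrier = ℤ ; _≈_ = _≋_ ; _+_ = ℤ._+_ ; _*_ = ℤ._*_ ; -_ = ℤ.-_ ; 0# = 0ℤ ; 1# = 1ℤ
    ; isCommutativeRing = record
      { isRing = record
        { +-isAbelianGroup = record
          { isGroup = record
            { isMonoid = record
              { isSemigroup = record
                { isMagma = record
                  { isEquivalence = record
                    { refl = λ {x} → ≡⇒≋ {x} refl
                    ; sym = λ {x} {y} → ≋-sym x y
                    ; trans = λ {x} {y} {z} → ≋-trans x y z }
                  ; ∙-cong = λ {x} {y} {u} {v} → +-cong-≋ x y u v }
                ; assoc = λ x y z → ≡⇒≋ (ℤ.+-assoc x y z) }
              ; identity = (λ x → ≡⇒≋ (ℤ.+-identityˡ x)) , λ x → ≡⇒≋ (ℤ.+-identityʳ x) }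
            ; inverse = (λ x → ≡⇒≋ (ℤ.+-inverseˡ x)) , λ x → ≡⇒≋ (ℤ.+-inverseʳ x)
            ; ⁻¹-cong = λ {x} {y} → neg-cong-≋ x y }
          ; comm = λ x y → ≡⇒≋ (ℤ.+-comm x y) }
        ; *-cong = λ {x} {y} {u} {v} → *-cong-≋ x y u v
        ; *-assoc = λ x y z → ≡⇒≋ (ℤ.*-assoc x y z)
        ; *-identity = (λ x → ≡⇒≋ (ℤ.*-identityˡ x)) , λ x → ≡⇒≋ (ℤ.*-identityʳ x)
        ; distrib = (λ x y z → ≡⇒≋ (ℤ.*-distribˡ-+ x y z)) , λ x y z → ≡⇒≋ (ℤ.*-distribʳ-+ x y z) }
      ; *-comm = λ x y → ≡⇒≋ (ℤ.*-comm x y) } }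

  residue-≋ : ∀ x → x ≋ + (x %ℕ p)
  residue-≋ x = divides (x /ℕ p) (trans (cong (ℤ._- + (x %ℕ p)) (a≡a%ℕn+[a/ℕn]*n x p))
    (solve 2 (λ r q → (r :+ q) :- r := q) refl (+ (x %ℕ p)) (x /ℕ p ℤ.* + p)))

  -- The difference is a multiple of p whose absolute value is less than p.
  residue-unique : ∀ {m n} → m < p → n < p → + m ≋ + n → m ≡ n
  residue-unique {m} {n} m<p n<p h with ∣ m ℤ.⊖ n ∣ in eq
  ... | zero  = ℤ.+-injective (ℤ.i-j≡0⇒i≡j (+ m) (+ n) (trans (ℤ.m-n≡m⊖n m n) (ℤ.∣i∣≡0⇒i≡0 eq)))
  ... | suc d = contradiction (subst (p ℕ.∣_) (trans (cong ∣_∣ (ℤ.m-n≡m⊖n m n)) eq) (∣⇒∣ᵤ h))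
                  (ℕ.>⇒∤ (subst (_< p) eq (ℕ.≤-<-trans (ℤ.∣m⊝n∣≤m⊔n m n) (ℕ.⊔-lub m<p n<p))))

  primeField : FiniteDomain
  primeField = record
    { domain = integersMod
    ; size = p
    ; code = λ x → fromℕ< (n%ℕd<d x p)
    ; decode = λ c → + toℕ c
    ; code-cong = λ {x} {y} h → Fin.fromℕ<-cong _ _ (residue-unique (n%ℕd<d x p) (n%ℕd<d y p)
        (≋-trans (+ (x %ℕ p)) x (+ (y %ℕ p)) (≋-sym x _ (residue-≋ x)) (≋-trans x y _ h (residue-≋ y)))) _ _
    ; code-inj = λ {x} {y} h → ≋-trans x _ y (residue-≋ x) (≋-sym y _ (subst (λ r → y ≋ + r)
        (sym (trans (sym (Fin.toℕ-fromℕ< (n%ℕd<d x p))) (trans (cong toℕ h) (Fin.toℕ-fromℕ< (n%ℕd<d y p))))) (residue-≋ y)))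
    ; code-decode = λ c → Fin.toℕ-injective (trans (Fin.toℕ-fromℕ< (n%ℕd<d (+ toℕ c) p)) (m<n⇒m%n≡m (Fin.toℕ<n c)))
    ; no-zero-div = λ {x} {y} h → Sum.map (zero-div x) (zero-div y)
        (euclidsLemma ∣ x ∣ ∣ y ∣ p-prime (subst (p ℕ.∣_) (ℤ.abs-* x y)
          (∣⇒∣ᵤ (subst (+ p ∣_) (ℤ.+-identityʳ (x ℤ.* y)) h))))
    ; 1<size = nonTrivial⇒n>1 p {{prime⇒nonTrivial p-prime}}
    }
    where
    zero-div : ∀ x → p ℕ.∣ ∣ x ∣ → x ≋ 0ℤ
    zero-div x d = subst (+ p ∣_) (sym (ℤ.+-identityʳ x)) (∣ᵤ⇒∣ d)

-- Primes

module Primes where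
  open import Data.Nat.Divisibility

  -- A discrete intermediate value theorem; it supplies the integer roots and logarithms used later.
  crossing : ∀ (g : ℕ → ℕ) {X} B → g 0 ≤ X → X < g B → ∃ λ m → g m ≤ X × X < g (suc m)
  crossing g zero    lo hi = contradiction lo (ℕ.<⇒≱ hi)
  crossing g {X} (suc B) lo hi with g B ≤? X
  ... | yes le = B , le , hi
  ... | no  nle = crossing g B lo (ℕ.≰⇒> nle)

  n<2^n : ∀ n → n < 2 ^ n
  n<2^n zero    = s≤s z≤n
  n<2^n (suc n) = ℕ.≤-trans (ℕ.+-mono-≤ (ℕ.m^n>0 2 n) (n<2^n n)) (ℕ.≤-reflexive (cong (2 ^ n +_) (sym (ℕ.+-identityʳ (2 ^ n)))))

  n<b^n : ∀ {b} n → 2 ≤ b → n < b ^ n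
  n<b^n n 2≤b = ℕ.<-≤-trans (n<2^n n) (ℕ.^-monoˡ-≤ n 2≤b)

  -- binomial i j is the binomial coefficient (i + j choose i).
  binomial : ℕ → ℕ → ℕ
  binomial zero    j       = 1
  binomial (suc i) zero    = 1
  binomial (suc i) (suc j) = binomial i (suc j) + binomial (suc i) j

  module _ where
    open +-*-Solver

    -- The two absorption identities of binomial coefficients. They are proved together because
    -- Pascal's rule reduces either of them to both at the preceding entry.
    absorbˡ : ∀ i j → suc i * binomial (suc i) j ≡ suc (i + j) * binomial i j
    absorbʳ : ∀ i j → suc j * binomial i (suc j) ≡ suc (i + j) * binomial i j

    absorbˡ zero    zero    = refl
    absorbˡ (suc i) zero    = cong (λ z → suc (suc z) * 1) (sym (ℕ.+-identityʳ i))
    absorbˡ i       (suc j) = begin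
      suc i * (binomial i (suc j) + binomial (suc i) j)
        ≡⟨ ℕ.*-distribˡ-+ (suc i) (binomial i (suc j)) (binomial (suc i) j) ⟩
      suc i * binomial i (suc j) + suc i * binomial (suc i) j
        ≡⟨ cong (suc i * binomial i (suc j) +_) (trans (absorbˡ i j) (sym (absorbʳ i j))) ⟩
      suc i * binomial i (suc j) + suc j * binomial i (suc j)
        ≡⟨ solve 3 (λ i j b → (con 1 :+ i) :* b :+ (con 1 :+ j) :* b := (con 1 :+ (i :+ (con 1 :+ j))) :* b) refl i j (binomial i (suc j)) ⟩
      suc (i + suc j) * binomial i (suc j) ∎
      where open ≡-Reasoning

    absorbʳ zero    j = refl
    absorbʳ (suc i) j = begin
      suc j * (binomial i (suc j) + binomial (suc i) j)
        ≡⟨ ℕ.*-distribˡ-+ (suc j) (binomial i (suc j)) (binomial (suc i) j) ⟩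
      suc j * binomial i (suc j) + suc j * binomial (suc i) j
        ≡⟨ cong (_+ suc j * binomial (suc i) j) (trans (absorbʳ i j) (sym (absorbˡ i j))) ⟩
      suc i * binomial (suc i) j + suc j * binomial (suc i) j
        ≡⟨ solve 3 (λ i j b → (con 1 :+ i) :* b :+ (con 1 :+ j) :* b := (con 1 :+ (con 1 :+ i :+ j)) :* b) refl i j (binomial (suc i) j) ⟩
      suc (suc i + j) * binomial (suc i) j ∎
      where open ≡-Reasoning

  binomial-monoʳ : ∀ i j → binomial i j ≤ binomial i (suc j)
  binomial-monoʳ zero    j       = ℕ.≤-refl
  binomial-monoʳ (suc i) zero    = ℕ.m≤n+m 1 (binomial i 1)
  binomial-monoʳ (suc i) (suc j) = ℕ.m≤n+m _ (binomial i (suc (suc j)))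

  binomial-monoˡ : ∀ i j → binomial i j ≤ binomial (suc i) j
  binomial-monoˡ zero    zero    = ℕ.≤-refl
  binomial-monoˡ (suc i) zero    = ℕ.≤-refl
  binomial-monoˡ i       (suc j) = ℕ.m≤m+n (binomial i (suc j)) _

  2^n≤binomial : ∀ n → 2 ^ n ≤ binomial n n
  2^n≤binomial zero    = ℕ.≤-refl
  2^n≤binomial (suc n) = ℕ.≤-trans (ℕ.≤-reflexive (cong (2 ^ n +_) (ℕ.+-identityʳ (2 ^ n))))
    (ℕ.+-mono-≤ (ℕ.≤-trans (2^n≤binomial n) (binomial-monoʳ n n)) (ℕ.≤-trans (2^n≤binomial n) (binomial-monoˡ n n)))

  binomial>0 : ∀ i j → 0 < binomial i j
  binomial>0 zero    j       = s≤s z≤n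
  binomial>0 (suc i) zero    = s≤s z≤n
  binomial>0 (suc i) (suc j) = ℕ.<-≤-trans (binomial>0 i (suc j)) (ℕ.m≤m+n _ _)

  -- Entries of the Leibniz harmonic triangle: 1/a = 1/b + 1/c for an entry a and the two entries b, c below it.
  leibniz : ℕ → ℕ → ℕ
  leibniz i j = suc (i + j) * binomial i j

  leibniz>0 : ∀ i j → 0 < leibniz i j
  leibniz>0 i j = ℕ.≤-trans (binomial>0 i j) (ℕ.m≤n*m (binomial i j) (suc (i + j)))

  -- The identity says 1/a = 1/b + 1/c, so Q/c = Q/a - Q/b is an integer.
  harmonic-∣ : ∀ {a b c Q} → 0 < a → 0 < b → c * b ≡ a * b + a * c → a ∣ Q → b ∣ Q → c ∣ Q
  harmonic-∣ {a} {b} {c} 0<a 0<b id (divides x refl) (divides y eq) =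
    ∣m+n∣m⇒∣n (subst (c ∣_) cx (m∣m*n x)) (m∣m*n y)
    where
    open +-*-Solver
    open ≡-Reasoning
    instance
      ab≢0 : NonZero (a * b)
      ab≢0 = >-nonZero (ℕ.*-mono-< 0<a 0<b)
    cx : c * x ≡ c * y + x * a
    cx = ℕ.*-cancelˡ-≡ _ _ (a * b) (begin
      a * b * (c * x) ≡⟨ solve 4 (λ a b c x → a :* b :* (c :* x) := (c :* b) :* (x :* a)) refl a b c x ⟩
      c * b * (x * a) ≡⟨ cong (_* (x * a)) id ⟩
      (a * b + a * c) * (x * a) ≡⟨ solve 4 (λ a b c q → (a :* b :+ a :* c) :* q := a :* c :* q :+ a :* b :* q) refl a b c (x * a) ⟩
      a * c * (x * a) + a * b * (x * a) ≡⟨ cong (λ z → a * c * z + a * b * (x * a)) eq ⟩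
      a * c * (y * b) + a * b * (x * a) ≡⟨ solve 5 (λ a b c y q → a :* c :* (y :* b) :+ a :* b :* q := a :* b :* (c :* y :+ q)) refl a b c y (x * a) ⟩
      a * b * (c * y + x * a) ∎)

  -- The row i = 0 consists of the numbers j + 1, and `harmonic-∣` leads from each row to the next.
  -- In this way a common multiple of 1, ..., N is forced to be exponentially large.
  leibniz-∣ : ∀ {Q N} → (∀ k → 0 < k → k ≤ N → k ∣ Q) → ∀ i j → i + j < N → leibniz i j ∣ Q
  leibniz-∣ {Q} h zero j lt = subst (_∣ Q) (sym (ℕ.*-identityʳ (suc j))) (h (suc j) (s≤s z≤n) lt)
  leibniz-∣ {Q} {N} h (suc i) j lt = harmonic-∣ {leibniz i j} {leibniz i (suc j)} {leibniz (suc i) j}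
      (leibniz>0 i j) (leibniz>0 i (suc j)) identity
      (leibniz-∣ h i j (ℕ.<-trans (ℕ.n<1+n (i + j)) lt)) (leibniz-∣ h i (suc j) (subst (_< N) (sym (ℕ.+-suc i j)) lt))
    where
    open +-*-Solver
    open ≡-Reasoning
    u = binomial (suc i) j
    v = binomial i (suc j)
    identity : leibniz (suc i) j * leibniz i (suc j) ≡ leibniz i j * leibniz i (suc j) + leibniz i j * leibniz (suc i) j
    identity = begin
      suc (suc i + j) * u * (suc (i + suc j) * v)
        ≡⟨ solve 4 (λ i j u v →
             (con 1 :+ (con 1 :+ i :+ j)) :* u :* ((con 1 :+ (i :+ (con 1 :+ j))) :* v) :=
             ((con 1 :+ i) :* u) :* ((con 1 :+ (i :+ (con 1 :+ j))) :* v) :+ ((con 1 :+ j) :* v) :* ((con 1 :+ (con 1 :+ i :+ j)) :* u))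
             refl i j u v ⟩
      suc i * u * leibniz i (suc j) + suc j * v * leibniz (suc i) j
        ≡⟨ cong₂ (λ p q → p * leibniz i (suc j) + q * leibniz (suc i) j) (absorbˡ i j) (absorbʳ i j) ⟩
      leibniz i j * leibniz i (suc j) + leibniz i j * leibniz (suc i) j ∎

  strip : ∀ d k → 2 ≤ d → 0 < k → ∃ λ a → ∃ λ k' → k ≡ d ^ a * k' × ¬ d ∣ k' × 0 < k'
  strip d k 2≤d = <-rec (λ k → 0 < k → ∃ λ a → ∃ λ k' → k ≡ d ^ a * k' × ¬ d ∣ k' × 0 < k') step k
    where
    step : ∀ k → (∀ {m} → m < k → 0 < m → ∃ λ a → ∃ λ k' → m ≡ d ^ a * k' × ¬ d ∣ k' × 0 < k') →
           0 < k → ∃ λ a → ∃ λ k' → k ≡ d ^ a * k' × ¬ d ∣ k' × 0 < k'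
    step k rec 0<k with d ∣? k
    ... | no ∤ = 0 , k , sym (ℕ.+-identityʳ k) , ∤ , 0<k
    ... | yes (divides zero refl) = contradiction 0<k λ ()
    ... | yes (divides (suc q) refl) with rec (ℕ.m<m*n (suc q) d 2≤d) (s≤s z≤n)
    ...   | a , k' , eq , ∤ , 0<k' = suc a , k' , trans (cong (_* d) eq) (trans (ℕ.*-comm (d ^ a * k') d) (sym (ℕ.*-assoc d (d ^ a) k'))) , ∤ , 0<k'

  module SmoothPart {N : ℕ} (0<N : 0 < N) where

    top : ∀ d → 2 ≤ d → ∃ λ a → d ^ a ≤ N × N < d ^ suc a
    top d 2≤d = crossing (d ^_) N 0<N (n<b^n N 2≤d)

    smooth : ∀ {ds} → All (2 ≤_) ds → ℕ
    smooth []              = 1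
    smooth (_∷_ {d} p ps)  = d ^ proj₁ (top d p) * smooth ps

    smooth-≤ : ∀ {ds} (ps : All (2 ≤_) ds) → smooth ps ≤ N ^ length ds
    smooth-≤ []             = ℕ.≤-refl
    smooth-≤ (_∷_ {d} p ps) = ℕ.*-mono-≤ (proj₁ (proj₂ (top d p))) (smooth-≤ ps)

    smooth>0 : ∀ {ds} (ps : All (2 ≤_) ds) → 0 < smooth ps
    smooth>0 []             = s≤s z≤n
    smooth>0 (_∷_ {d} p ps) = ℕ.*-mono-< (ℕ.m^n>0 d {{>-nonZero (ℕ.<-trans (s≤s z≤n) p)}} (proj₁ (top d p))) (smooth>0 ps)

    -- The numbers d are stripped from k one after the other. Each stripped power is at most N,
    -- hence divides the largest such power, which is a factor of `smooth`.
    rough-part : ∀ {ds} (ps : All (2 ≤_) ds) k → 0 < k → k ≤ N →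
                 ∃ λ k' → k' ∣ k × (∀ d → d ∈ ds → ¬ d ∣ k') × k ∣ smooth ps * k'
    rough-part [] k 0<k k≤N = k , ∣-refl , (λ _ ()) , ∣-reflexive (sym (ℕ.+-identityʳ k))
    rough-part (_∷_ {d} p ps) k 0<k k≤N with strip d k p 0<k
    ... | a , k₁ , refl , d∤k₁ , 0<k₁ with rough-part ps k₁ 0<k₁ (ℕ.≤-trans (ℕ.m≤n*m k₁ (d ^ a) {{ℕ.m^n≢0 d a {{>-nonZero (ℕ.<-trans (s≤s z≤n) p)}}}}) k≤N)
    ...   | k' , k'∣k₁ , rough , k₁∣ = k' , ∣-trans k'∣k₁ (n∣m*n (d ^ a)) , rough' ,
              subst (d ^ a * k₁ ∣_) (sym (ℕ.*-assoc (d ^ e) (smooth ps) k')) (*-pres-∣ (^-∣ a≤e) k₁∣)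
      where
      e = proj₁ (top d p)
      rough' : ∀ d' → d' ∈ d ∷ _ → ¬ d' ∣ k'
      rough' d' (here refl) d∣k' = d∤k₁ (∣-trans d∣k' k'∣k₁)
      rough' d' (there d'∈)      = rough d' d'∈
      ^-∣ : ∀ {a e} → a ≤ e → d ^ a ∣ d ^ e
      ^-∣ {a} {e} le = subst (d ^ a ∣_) (trans (sym (ℕ.^-distribˡ-+-* d a (e ∸ a))) (cong (d ^_) (ℕ.m+[n∸m]≡n le))) (m∣m*n (d ^ (e ∸ a)))
      a≤e : a ≤ e
      a≤e with a ≤? e
      ... | yes le = le
      ... | no nle = contradiction (ℕ.≤-trans (ℕ.^-monoʳ-≤ d {{>-nonZero (ℕ.<-trans (s≤s z≤n) p)}} (ℕ.≰⇒> nle))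
                       (ℕ.≤-trans (ℕ.m≤m*n (d ^ a) k₁ {{>-nonZero 0<k₁}}) k≤N)) (ℕ.<⇒≱ (proj₂ (proj₂ (top d p))))

  prime-divisor : ∀ k → 1 < k → ∃ λ p → Prime p × p ∣ k
  prime-divisor k 1<k with factorise k {{>-nonZero (ℕ.<-trans (s≤s z≤n) 1<k)}}
  ... | record { factors = [] ; isFactorisation = eq } = contradiction (subst (1 <_) eq 1<k) λ { (s≤s ()) }
  ... | record { factors = p ∷ ps ; isFactorisation = eq ; factorsPrime = pp ∷ _ } =
          p , pp , subst (p ∣_) (sym eq) (m∣m*n (productᴸ ps))

  -- If no prime lies between M and N = 2n + 1, then every k ≤ N divides the product of the largest powers
  -- d ^ e ≤ N with d < M; so does the entry (2n + 1)(2n choose n) of the harmonic triangle.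
  prime-between : ∀ M n → suc (n + n) ^ M < 2 ^ n → ∃ λ p → Prime p × M ≤ p × p ≤ suc (n + n)
  prime-between M n small with Fin.any? {n = suc (suc (n + n))} (λ q → prime? (toℕ q) ×-dec (M ≤? toℕ q))
  ... | yes (q , pq , M≤q) = toℕ q , pq , M≤q , ℕ.≤-pred (Fin.toℕ<n q)
  ... | no none = contradiction small (ℕ.≤⇒≯ (begin
        2 ^ n ≤⟨ 2^n≤binomial n ⟩
        binomial n n ≤⟨ ℕ.m≤n*m (binomial n n) (suc (n + n)) ⟩
        leibniz n n ≤⟨ ∣⇒≤ {{>-nonZero (smooth>0 ≥2)}} (leibniz-∣ divides-all n n ℕ.≤-refl) ⟩
        smooth ≥2 ≤⟨ smooth-≤ ≥2 ⟩
        N ^ length ds ≡⟨ cong (N ^_) (trans (List.length-map (2 +_) (upTo (M ∸ 2))) (List.length-upTo (M ∸ 2))) ⟩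
        N ^ (M ∸ 2) ≤⟨ ℕ.^-monoʳ-≤ N (ℕ.m∸n≤m M 2) ⟩
        N ^ M ∎))
    where
    open ℕ.≤-Reasoning
    N = suc (n + n)
    open SmoothPart {N} (s≤s z≤n)
    ds = map (2 +_) (upTo (M ∸ 2))
    ≥2 : All (2 ≤_) ds
    ≥2 = All.tabulate λ d∈ → let _ , _ , eq = ∈.∈-map⁻ (2 +_) d∈ in subst (2 ≤_) (sym eq) (s≤s (s≤s z≤n))
    in-ds : ∀ {d} → 2 ≤ d → d < M → d ∈ ds
    in-ds {suc (suc d)} (s≤s (s≤s z≤n)) lt = ∈.∈-map⁺ (2 +_) (∈.∈-upTo⁺ (ℕ.∸-monoˡ-≤ 2 lt))
    divides-all : ∀ k → 0 < k → k ≤ N → k ∣ smooth ≥2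
    divides-all k 0<k k≤N with rough-part ≥2 k 0<k k≤N
    ... | zero , 0∣k , _ , _ = contradiction (subst (0 <_) (0∣⇒≡0 0∣k) 0<k) λ ()
    ... | suc zero , _ , _ , k∣ = subst (k ∣_) (ℕ.*-identityʳ (smooth ≥2)) k∣
    -- A cofactor above 1 has a prime divisor. It is at least M by roughness and at most N because
    -- it divides k, which `none` excludes.
    ... | suc (suc k') , k'∣k , rough , _ with prime-divisor (suc (suc k')) (s≤s (s≤s z≤n))
    ...   | p , pp , p∣ with M ≤? p
    ...     | no M≰p = contradiction p∣ (rough p (in-ds (nonTrivial⇒n>1 p {{prime⇒nonTrivial pp}}) (ℕ.≰⇒> M≰p)))
    ...     | yes M≤p = contradiction (fromℕ< p<  , subst Prime (sym (Fin.toℕ-fromℕ< p<)) pp , subst (M ≤_) (sym (Fin.toℕ-fromℕ< p<)) M≤p) none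
      where
      p< : p < suc N
      p< = s≤s (ℕ.≤-trans (∣⇒≤ {{>-nonZero 0<k}} (∣-trans p∣ k'∣k)) k≤N)

  -- With K = k + 1 and h = l / (2K), the base is at most (h + 1)², hence at most 2^(2h), and 2hK ≤
  -- l. The assumption on l is what (h + 1)² needs.
  poly≤exp : ∀ k l → 2 * suc k * (8 * suc k + 13) ≤ l → (4 * l + 13) ^ suc k ≤ 2 ^ l
  poly≤exp k l large = begin
    (4 * l + 13) ^ K ≤⟨ ℕ.^-monoˡ-≤ K base ⟩
    (suc h * suc h) ^ K ≤⟨ ℕ.^-monoˡ-≤ K (ℕ.*-mono-≤ (n<2^n h) (n<2^n h)) ⟩
    (2 ^ h * 2 ^ h) ^ K ≡⟨ cong (_^ K) (sym (ℕ.^-distribˡ-+-* 2 h h)) ⟩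
    (2 ^ (h + h)) ^ K ≡⟨ ℕ.^-*-assoc 2 (h + h) K ⟩
    2 ^ ((h + h) * K) ≡⟨ cong (2 ^_) (solve 2 (λ h k → (h :+ h) :* k := h :* (con 2 :* k)) refl h K) ⟩
    2 ^ (h * (2 * K)) ≤⟨ ℕ.^-monoʳ-≤ 2 (m/n*n≤m l (2 * K)) ⟩
    2 ^ l ∎
    where
    open ℕ.≤-Reasoning
    open +-*-Solver
    K = suc k
    C = 8 * K + 13
    h = l / (2 * K)
    l< : l ≤ suc h * (2 * K)
    l< = begin
      l ≡⟨ m≡m%n+[m/n]*n l (2 * K) ⟩
      _ + h * (2 * K) ≤⟨ ℕ.+-monoˡ-≤ (h * (2 * K)) (ℕ.<⇒≤ (m%n<n l (2 * K))) ⟩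
      2 * K + h * (2 * K) ∎
    C≤h : C ≤ suc h
    C≤h = ℕ.*-cancelˡ-≤ (2 * K) (begin
      2 * K * C ≤⟨ large ⟩
      l ≤⟨ l< ⟩
      suc h * (2 * K) ≡⟨ ℕ.*-comm (suc h) (2 * K) ⟩
      2 * K * suc h ∎)
    base : 4 * l + 13 ≤ suc h * suc h
    base = begin
      4 * l + 13 ≤⟨ ℕ.+-mono-≤ (ℕ.*-monoʳ-≤ 4 l<) (ℕ.m≤m*n 13 (suc h)) ⟩
      4 * (suc h * (2 * K)) + 13 * suc h ≡⟨ solve 2 (λ h k → con 4 :* (h :* (con 2 :* k)) :+ con 13 :* h := (con 8 :* k :+ con 13) :* h) refl (suc h) K ⟩
      C * suc h ≤⟨ ℕ.*-monoˡ-≤ (suc h) C≤h ⟩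
      suc h * suc h ∎

  -- If l is the integer part of log₂ M, there is a prime between M and M (4 l + 13). The
  -- logarithmic factor raised to the power k + 1 is at most M for large M, whence the slightly
  -- larger exponent on the right.
  prime-near : ∀ k → ∃ λ M₀ → ∀ M → M₀ ≤ M → ∃ λ p → Prime p × M ≤ p × p ^ suc k ≤ M ^ suc (suc k)
  prime-near k = 2 ^ l₀ , λ M M₀≤M →
      let l , 2^l≤M , M<2^l = crossing (2 ^_) M (ℕ.≤-trans (ℕ.m^n>0 2 l₀) M₀≤M) (n<2^n M)
      in near M l 2^l≤M M<2^l (ℕ.≮⇒≥ λ l<l₀ → ℕ.<⇒≱ M<2^l (ℕ.≤-trans (ℕ.^-monoʳ-≤ 2 l<l₀) M₀≤M))
    where
    open ℕ.≤-Reasoning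
    open +-*-Solver
    l₀ = 2 * suc k * (8 * suc k + 13)
    near : ∀ M l → 2 ^ l ≤ M → M < 2 ^ suc l → l₀ ≤ l → ∃ λ p → Prime p × M ≤ p × p ^ suc k ≤ M ^ suc (suc k)
    near M@(suc m) l 2^l≤M M<2^l l₀≤l =
      let p , pp , M≤p , p≤N = prime-between M n small
      in p , pp , M≤p , (begin
        p ^ suc k ≤⟨ ℕ.^-monoˡ-≤ (suc k) (ℕ.≤-trans p≤N N≤) ⟩
        (M * (4 * l + 13)) ^ suc k ≡⟨ ^-distribʳ-* (suc k) M (4 * l + 13) ⟩
        M ^ suc k * (4 * l + 13) ^ suc k ≤⟨ ℕ.*-monoʳ-≤ (M ^ suc k) (ℕ.≤-trans (poly≤exp k l l₀≤l) 2^l≤M) ⟩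
        M ^ suc k * M ≡⟨ ℕ.*-comm (M ^ suc k) M ⟩
        M ^ suc (suc k) ∎)
      where
      -- Chosen so that 2n + 1 < 2^t, which gives the condition (2n + 1)^M < 2^(tM) = 2^n of
      -- `prime-between`.
      t = 2 * l + 6
      n = M * t
      N≤ : suc (n + n) ≤ M * (4 * l + 13)
      N≤ = begin
        1 + (M * t + M * t) ≤⟨ s≤s (ℕ.m≤n+m (M * t + M * t) m) ⟩
        M + (M * t + M * t) ≡⟨ solve 2 (λ m l → m :+ (m :* (con 2 :* l :+ con 6) :+ m :* (con 2 :* l :+ con 6)) := m :* (con 4 :* l :+ con 13)) refl M l ⟩
        M * (4 * l + 13) ∎
      N<2^t : suc (n + n) < 2 ^ t
      N<2^t = begin-strict
        suc (n + n) ≤⟨ N≤ ⟩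
        M * (4 * l + 13) <⟨ ℕ.*-monoˡ-< (4 * l + 13) {{>-nonZero (ℕ.m≤n⇒m≤o+n (4 * l) (s≤s z≤n))}} M<2^l ⟩
        2 ^ suc l * (4 * l + 13) ≤⟨ ℕ.*-monoʳ-≤ (2 ^ suc l) (begin
            4 * l + 13 ≤⟨ ℕ.m≤m+n (4 * l + 13) (28 * l + 19) ⟩
            4 * l + 13 + (28 * l + 19) ≡⟨ solve 1 (λ l → con 4 :* l :+ con 13 :+ (con 28 :* l :+ con 19) := con 32 :* (con 1 :+ l)) refl l ⟩
            32 * suc l ≤⟨ ℕ.*-monoʳ-≤ 32 (n<2^n l) ⟩
            2 ^ 5 * 2 ^ l ∎) ⟩
        2 ^ suc l * (2 ^ 5 * 2 ^ l) ≡⟨ cong (2 ^ suc l *_) (sym (ℕ.^-distribˡ-+-* 2 5 l)) ⟩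
        2 ^ suc l * 2 ^ (5 + l) ≡⟨ sym (ℕ.^-distribˡ-+-* 2 (suc l) (5 + l)) ⟩
        2 ^ (suc l + (5 + l)) ≡⟨ cong (2 ^_) (solve 1 (λ l → con 1 :+ l :+ (con 5 :+ l) := con 2 :* l :+ con 6) refl l) ⟩
        2 ^ t ∎
      small : suc (n + n) ^ M < 2 ^ n
      small = begin-strict
        suc (n + n) ^ M <⟨ ℕ.^-monoˡ-< M N<2^t ⟩
        (2 ^ t) ^ M ≡⟨ ℕ.^-*-assoc 2 t M ⟩
        2 ^ (t * M) ≡⟨ cong (2 ^_) (ℕ.*-comm t M) ⟩
        2 ^ n ∎
    near zero l 2^l≤M _ _ = contradiction (ℕ.≤-trans (ℕ.m^n>0 2 l) 2^l≤M) λ ()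

open Primes using (crossing; prime-near)

-- Colourings and regularisation

tuples : ∀ {A : Set} {r} → Vec (List A) r → List (Vec A r)
tuples []       = [] ∷ []
tuples (P ∷ Ps) = cartesianProductWith _∷_ P (tuples Ps)

∈-tuples⁺ : ∀ {A : Set} {r} (Ps : Vec (List A) r) (t : Vec A r) →
            (∀ l → Vec.lookup t l ∈ Vec.lookup Ps l) → t ∈ tuples Ps
∈-tuples⁺ []       []      h = here refl
∈-tuples⁺ (P ∷ Ps) (x ∷ t) h = ∈.∈-cartesianProductWith⁺ _∷_ (h Fin.zero) (∈-tuples⁺ Ps t (h ∘ Fin.suc))

∈-tuples⁻ : ∀ {A : Set} {r} (Ps : Vec (List A) r) {t : Vec A r} →
            t ∈ tuples Ps → ∀ l → Vec.lookup t l ∈ Vec.lookup Ps l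
∈-tuples⁻ (P ∷ Ps) t∈ l with ∈.∈-cartesianProductWith⁻ _∷_ P (tuples Ps) t∈
∈-tuples⁻ (P ∷ Ps) t∈ Fin.zero    | x , t , x∈ , t∈' , refl = x∈
∈-tuples⁻ (P ∷ Ps) t∈ (Fin.suc l) | x , t , x∈ , t∈' , refl = ∈-tuples⁻ Ps t∈' l

product : ∀ {r} → Vec ℕ r → ℕ
product []       = 1
product (m ∷ ms) = m * product ms

length-cartesian : ∀ {A B C : Set} (f : A → B → C) xs ys → length (cartesianProductWith f xs ys) ≡ length xs * length ys
length-cartesian f []       ys = refl
length-cartesian f (x ∷ xs) ys = trans (List.length-++ (map (f x) ys))
  (cong₂ _+_ (List.length-map (f x) ys) (length-cartesian f xs ys))

length-tuples : ∀ {A : Set} {r} (Ps : Vec (List A) r) → length (tuples Ps) ≡ product (Vec.map length Ps)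
length-tuples []       = refl
length-tuples (P ∷ Ps) = trans (length-cartesian _∷_ P (tuples Ps)) (cong (length P *_) (length-tuples Ps))

tuples-unique : ∀ {A : Set} {r} (Ps : Vec (List A) r) → (∀ l → Unique (Vec.lookup Ps l)) → Unique (tuples Ps)
tuples-unique []       h = [] ∷ []
tuples-unique (P ∷ Ps) h = Unique.cartesianProductWith⁺ _∷_ Vec.∷-injective (h Fin.zero) (tuples-unique Ps (h ∘ Fin.suc))

vec-ext : ∀ {A : Set} {r} {s t : Vec A r} → (∀ l → Vec.lookup s l ≡ Vec.lookup t l) → s ≡ t
vec-ext h = Ext.Pointwise-≡⇒≡ (Ext.ext h)

module _ {k q C : ℕ} (key : Fin k → Fin q) (0<k : 0 < k)
         (classes : ∀ κ → # (λ c → key c Fin.≟ κ) (allFin k) ≤ C) where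

  Clash : ∀ {n} → (Fin n → Fin k) → Fin n × Fin n → Set
  Clash φ (u , v) = key (φ u) ≡ key (φ v)

  clash? : ∀ {n} (φ : Fin n → Fin k) p → Dec (Clash φ p)
  clash? φ (u , v) = key (φ u) Fin.≟ key (φ v)

  private
    inner : ∀ {n} → List (Fin (suc n) × Fin (suc n)) → List (Fin n × Fin n)
    inner [] = []
    inner ((Fin.suc u , Fin.suc v) ∷ ps) = (u , v) ∷ inner ps
    inner ((Fin.zero , _) ∷ ps) = inner ps
    inner ((Fin.suc _ , Fin.zero) ∷ ps) = inner ps

    outer : ∀ {n} → List (Fin (suc n) × Fin (suc n)) → List (Fin n)
    outer [] = []
    outer ((Fin.suc u , Fin.suc v) ∷ ps) = outer ps
    outer ((Fin.zero , Fin.zero) ∷ ps) = outer ps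
    outer ((Fin.zero , Fin.suc v) ∷ ps) = v ∷ outer ps
    outer ((Fin.suc u , Fin.zero) ∷ ps) = u ∷ outer ps

    inner+outer : ∀ {n} (ps : List (Fin (suc n) × Fin (suc n))) → length (inner ps) + length (outer ps) ≤ length ps
    inner+outer [] = z≤n
    inner+outer ((Fin.suc u , Fin.suc v) ∷ ps) = s≤s (inner+outer ps)
    inner+outer ((Fin.zero , Fin.zero) ∷ ps) = ℕ.m≤n⇒m≤1+n (inner+outer ps)
    inner+outer ((Fin.zero , Fin.suc v) ∷ ps) = ℕ.≤-trans (ℕ.≤-reflexive (ℕ.+-suc (length (inner ps)) (length (outer ps)))) (s≤s (inner+outer ps))
    inner+outer ((Fin.suc u , Fin.zero) ∷ ps) = ℕ.≤-trans (ℕ.≤-reflexive (ℕ.+-suc (length (inner ps)) (length (outer ps)))) (s≤s (inner+outer ps))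

    inner-≢ : ∀ {n} {ps : List (Fin (suc n) × Fin (suc n))} → All (λ p → proj₁ p ≢ proj₂ p) ps →
              All (λ p → proj₁ p ≢ proj₂ p) (inner ps)
    inner-≢ [] = []
    inner-≢ {ps = (Fin.suc u , Fin.suc v) ∷ _} (p ∷ ps) = (λ eq → p (cong Fin.suc eq)) ∷ inner-≢ ps
    inner-≢ {ps = (Fin.zero , _) ∷ _} (p ∷ ps) = inner-≢ ps
    inner-≢ {ps = (Fin.suc _ , Fin.zero) ∷ _} (p ∷ ps) = inner-≢ ps

    extend : ∀ {n} → Fin k → (Fin n → Fin k) → Fin (suc n) → Fin k
    extend c φ Fin.zero    = c
    extend c φ (Fin.suc v) = φ v

    clashes : ∀ {n} c (φ : Fin n → Fin k) ps → All (λ p → proj₁ p ≢ proj₂ p) ps →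
      # (clash? (extend c φ)) ps ≤ # (clash? φ) (inner ps) + # (λ v → key c Fin.≟ key (φ v)) (outer ps)
    clashes c φ [] [] = z≤n
    clashes c φ ((Fin.zero , Fin.zero) ∷ ps) (p ∷ h) = contradiction refl p
    clashes c φ ((Fin.suc u , Fin.suc v) ∷ ps) (p ∷ h) with key (φ u) Fin.≟ key (φ v)
    ... | yes _ = s≤s (clashes c φ ps h)
    ... | no _  = clashes c φ ps h
    clashes c φ ((Fin.zero , Fin.suc v) ∷ ps) (p ∷ h) with key c Fin.≟ key (φ v)
    ... | yes _ = ℕ.≤-trans (s≤s (clashes c φ ps h)) (ℕ.≤-reflexive (sym (ℕ.+-suc (# (clash? φ) (inner ps)) _)))
    ... | no _  = clashes c φ ps h
    clashes c φ ((Fin.suc u , Fin.zero) ∷ ps) (p ∷ h) with key (φ u) Fin.≟ key c | key c Fin.≟ key (φ u)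
    ... | yes _  | yes _ = ℕ.≤-trans (s≤s (clashes c φ ps h)) (ℕ.≤-reflexive (sym (ℕ.+-suc (# (clash? φ) (inner ps)) _)))
    ... | no _   | no _  = clashes c φ ps h
    ... | yes eq | no ¬e = contradiction (sym eq) ¬e
    ... | no ¬e  | yes e = contradiction (sym e) ¬e

  -- A derandomised random colouring. The vertices are coloured one by one, each with the colour
  -- that clashes least with its partners coloured before; averaged over all colours, a partner
  -- contributes at most C/k.
  colouring : ∀ n (ps : List (Fin n × Fin n)) → All (λ p → proj₁ p ≢ proj₂ p) ps →
              ∃ λ (φ : Fin n → Fin k) → k * # (clash? φ) ps ≤ C * length ps
  colouring zero []             h = (λ ()) , ℕ.≤-reflexive (trans (ℕ.*-zeroʳ k) (sym (ℕ.*-zeroʳ C)))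
  colouring zero ((() , _) ∷ _) h
  colouring (suc n) ps h with colouring n (inner ps) (inner-≢ h)
  ... | φ , le with min≤∑ (allFin k) (λ c → # (λ v → key c Fin.≟ key (φ v)) (outer ps)) (subst (0 <_) (sym (length-allFin k)) 0<k)
  ...   | c , _ , min = extend c φ , (begin
    k * # (clash? (extend c φ)) ps
      ≤⟨ ℕ.*-monoʳ-≤ k (clashes c φ ps h) ⟩
    k * (# (clash? φ) (inner ps) + out c)
      ≡⟨ ℕ.*-distribˡ-+ k (# (clash? φ) (inner ps)) (out c) ⟩
    k * # (clash? φ) (inner ps) + k * out c
      ≤⟨ ℕ.+-mono-≤ le (begin
        k * out c ≡⟨ cong (_* out c) (sym (length-allFin k)) ⟩
        length (allFin k) * out c ≤⟨ min ⟩
        ∑ (allFin k) out ≡⟨ double-count (λ c v → key c Fin.≟ key (φ v)) (allFin k) (outer ps) ⟩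
        ∑ (outer ps) (λ v → # (λ c → key c Fin.≟ key (φ v)) (allFin k))
                                     ≤⟨ ∑-mono-≤ (outer ps) (λ v _ → classes (key (φ v))) ⟩
        ∑ (outer ps) (λ _ → C) ≡⟨ ∑-const (outer ps) C ⟩
        length (outer ps) * C ≡⟨ ℕ.*-comm (length (outer ps)) C ⟩
        C * length (outer ps) ∎) ⟩
    C * length (inner ps) + C * length (outer ps)
      ≡⟨ sym (ℕ.*-distribˡ-+ C (length (inner ps)) (length (outer ps))) ⟩
    C * (length (inner ps) + length (outer ps))
      ≤⟨ ℕ.*-monoʳ-≤ C (inner+outer ps) ⟩
    C * length ps ∎)
    where
    open ℕ.≤-Reasoning
    out : Fin k → ℕ
    out c = # (λ v → key c Fin.≟ key (φ v)) (outer ps)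

AgreeOff : ∀ {n r} → Fin r → Vec (Fin n) r → Vec (Fin n) r → Set
AgreeOff j e e' = ∀ l → l ≡ j ⊎ Vec.lookup e l ≡ Vec.lookup e' l

abstract
  agreeOff? : ∀ {n r} (j : Fin r) (e e' : Vec (Fin n) r) → Dec (AgreeOff j e e')
  agreeOff? j e e' = Fin.all? λ l → (l Fin.≟ j) ⊎-dec (Vec.lookup e l Fin.≟ Vec.lookup e' l)

agree-off : ∀ {n r} {j : Fin r} (e e' : Vec (Fin n) r) → AgreeOff j e e' → ∀ l → l ≢ j → Vec.lookup e l ≡ Vec.lookup e' l
agree-off e e' h l l≢ with h l
... | inj₁ eq = contradiction eq l≢
... | inj₂ eq = eq

codegree : ∀ {n r} → List (Vec (Fin n) r) → Fin r → Vec (Fin n) r → ℕ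
codegree E j e = # (agreeOff? j e) E

codegree-filter : ∀ {n r} {P : Vec (Fin n) r → Set} (P? : ∀ e → Dec (P e)) E j e →
                  codegree (filter P? E) j e ≤ codegree E j e
codegree-filter P? E j e = #-filter-≤ (agreeOff? j e) P? E

-- stage k consists of the edges that survive k rounds, where round k discards the edges having at least
-- k + 1 positions of codegree at most threshold k.  From an edge of stage k one can vary k positions one
-- after the other, each in more than threshold k, …, threshold 1 ways, so the last stage is empty.
module Regularisation {n r' : ℕ} (T : List (Vec (Fin n) (suc r'))) (T-unique : Unique T) (Δ : ℕ)
                      (degree : ∀ v l → # (λ t → Vec.lookup t l Fin.≟ v) T ≤ Δ) (threshold : ℕ → ℕ) where
  private
    r = suc r'
    Edge = Vec (Fin n) r

  lows : List Edge → ℕ → Edge → List (Fin r)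
  lows E k e = filter (λ j → codegree E j e ≤? threshold (suc k)) (allFin r)

  -- The index counts from 0, so `light? E k` is the test of round k + 1: at least k + 2 positions
  -- that are low for `threshold (suc k)`.
  light? : ∀ (E : List Edge) k e → Dec (suc (suc k) ≤ length (lows E k e))
  light? E k e = suc (suc k) ≤? length (lows E k e)

  stage : ℕ → List Edge
  stage zero    = T
  stage (suc k) = filter (λ e → ¬? (light? (stage k) k e)) (stage k)

  light : ℕ → List Edge
  light k = filter (light? (stage k) k) (stage k)

  stage⊆T : ∀ k {e} → e ∈ stage k → e ∈ T
  stage⊆T zero    e∈ = e∈
  stage⊆T (suc k) e∈ = stage⊆T k (proj₁ (∈.∈-filter⁻ (λ e → ¬? (light? (stage k) k e)) {xs = stage k} e∈))

  stage-unique : ∀ k → Unique (stage k)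
  stage-unique zero    = T-unique
  stage-unique (suc k) = Unique.filter⁺ (λ e → ¬? (light? (stage k) k e)) (stage-unique k)

  ways : ℕ → ℕ
  ways zero    = 1
  ways (suc k) = threshold (suc k) * ways k

  -- J lists the positions varied so far, whose entries are kept from then on. The further index i
  -- is a position that is never varied; its entry lets the degrees bound the number of edges
  -- reached.
  Reach : List (Fin r) → Edge → Edge → Set
  Reach J e e' = All (λ j → Vec.lookup e j ≡ Vec.lookup e' j) J × ∃ λ i → i ∉ J × Vec.lookup e i ≡ Vec.lookup e' i

  abstract
    reach? : ∀ J e e' → Dec (Reach J e e')
    reach? J e e' = All.all? (λ j → Vec.lookup e j Fin.≟ Vec.lookup e' j) J ×-dec
      Fin.any? (λ i → ¬? (DecMem._∈?_ Fin._≟_ i J) ×-dec (Vec.lookup e i Fin.≟ Vec.lookup e' i))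

  -- J and the low positions together do not exhaust all r positions, so some new position j can be
  -- varied in many ways. Different ways lead to disjoint sets of edges, because a reached edge
  -- keeps its entry at j; hence the numbers of ways multiply.
  reach-many : ∀ k J e → length J + suc k ≤ r → e ∈ stage k → ways k ≤ # (reach? J e) T
  reach-many zero J e le e∈ = ∈.∈-length (∈.∈-filter⁺ (reach? J e) e∈
    (All.tabulate (λ _ → refl) , proj₁ free , proj₂ free , refl))
    where free = fresh J (ℕ.≤-trans (ℕ.≤-reflexive (ℕ.+-comm 1 (length J))) le)
  reach-many (suc k) J e le e∈ with ∈.∈-filter⁻ (λ e → ¬? (light? (stage k) k e)) {xs = stage k} e∈
  ... | e∈k , heavy with fresh (J ++ lows (stage k) k e)
          (ℕ.<-≤-trans (subst (_< length J + suc (suc k)) (sym (List.length-++ J)) (ℕ.+-monoʳ-< (length J) (ℕ.≰⇒> heavy))) le)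
  ...   | j , j∉ = begin
    threshold (suc k) * ways k
      ≤⟨ ℕ.*-monoˡ-≤ (ways k) (ℕ.<⇒≤ (ℕ.≰⇒> λ low → j∉ (∈.∈-++⁺ʳ J (∈.∈-filter⁺ (λ j → codegree (stage k) j e ≤? threshold (suc k)) (∈.∈-allFin j) low)))) ⟩
    length N * ways k
      ≡⟨ sym (∑-const N (ways k)) ⟩
    ∑ N (λ _ → ways k)
      ≤⟨ ∑-mono-≤ N (λ e'' e''∈ → reach-many k (j ∷ J) e'' (subst (_≤ r) (ℕ.+-suc (length J) (suc k)) le) (proj₁ (N⁻ e''∈))) ⟩
    ∑ N (λ e'' → # (reach? (j ∷ J) e'') T)
      ≡⟨ double-count (reach? (j ∷ J)) N T ⟩
    ∑ T (λ e' → # (λ e'' → reach? (j ∷ J) e'' e') N)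
      ≤⟨ ∑-mono-≤ T (λ e' _ → at-most-one e') ⟩
    ∑ T (λ e' → ind (reach? J e e'))
      ≡⟨ sym (#≡∑ (reach? J e) T) ⟩
    # (reach? J e) T ∎
    where
    open ℕ.≤-Reasoning
    N : List Edge
    N = filter (agreeOff? j e) (stage k)
    N⁻ : ∀ {e''} → e'' ∈ N → e'' ∈ stage k × AgreeOff j e e''
    N⁻ = ∈.∈-filter⁻ (agreeOff? j e) {xs = stage k}
    j∉J : j ∉ J
    j∉J j∈ = j∉ (∈.∈-++⁺ˡ j∈)
    at-most-one : ∀ e' → # (λ e'' → reach? (j ∷ J) e'' e') N ≤ ind (reach? J e e')
    at-most-one e' = ≤ind (reach? J e e')
        (λ _ → #≤1 (λ e'' → reach? (j ∷ J) e'' e') (Unique.filter⁺ (agreeOff? j e) (stage-unique k)) same)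
        (λ ¬R → #-zero (λ e'' → reach? (j ∷ J) e'' e') N λ e'' e''∈ R → ¬R (transfer e'' (proj₂ (N⁻ e''∈)) R))
      where
      same : ∀ x y → x ∈ N → y ∈ N → Reach (j ∷ J) x e' → Reach (j ∷ J) y e' → x ≡ y
      same x y x∈ y∈ (x≡ ∷ _ , _) (y≡ ∷ _ , _) = vec-ext eq
        where
        eq : ∀ l → Vec.lookup x l ≡ Vec.lookup y l
        eq l with l Fin.≟ j
        ... | yes refl = trans x≡ (sym y≡)
        ... | no l≢    = trans (sym (agree-off e x (proj₂ (N⁻ x∈)) l l≢)) (agree-off e y (proj₂ (N⁻ y∈)) l l≢)
      transfer : ∀ e'' → AgreeOff j e e'' → Reach (j ∷ J) e'' e' → Reach J e e'
      transfer e'' off (_ ∷ J≡ , i , i∉ , i≡) =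
        All.tabulate (λ {j'} j'∈ → trans (agree-off e e'' off j' λ { refl → j∉J j'∈ }) (All.lookup J≡ j'∈)) ,
        i , (λ i∈ → i∉ (there i∈)) , trans (agree-off e e'' off i λ i≡j → i∉ (here i≡j)) i≡

  -- A reached edge shares with e the entry of some position, and each of the r entries occurs at
  -- its position in at most Δ edges.
  reach-few : ∀ e → # (reach? [] e) T ≤ r * Δ
  reach-few e = begin
    # (reach? [] e) T ≡⟨ #≡∑ (reach? [] e) T ⟩
    ∑ T (λ e' → ind (reach? [] e e')) ≤⟨ ∑-mono-≤ T (λ e' _ → ind≤ (reach? [] e e') (some e')) ⟩
    ∑ T (λ e' → # (λ i → Vec.lookup e' i Fin.≟ Vec.lookup e i) (allFin r))
                                                      ≡⟨ double-count (λ e' i → Vec.lookup e' i Fin.≟ Vec.lookup e i) T (allFin r) ⟩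
    ∑ (allFin r) (λ i → # (λ e' → Vec.lookup e' i Fin.≟ Vec.lookup e i) T)
                                                      ≤⟨ ∑-mono-≤ (allFin r) (λ i _ → degree (Vec.lookup e i) i) ⟩
    ∑ (allFin r) (λ _ → Δ) ≡⟨ ∑-const (allFin r) Δ ⟩
    length (allFin r) * Δ ≡⟨ cong (_* Δ) (length-allFin r) ⟩
    r * Δ ∎
    where
    open ℕ.≤-Reasoning
    some : ∀ e' → Reach [] e e' → 1 ≤ # (λ i → Vec.lookup e' i Fin.≟ Vec.lookup e i) (allFin r)
    some e' (_ , i , _ , eq) = ∈.∈-length (∈.∈-filter⁺ (λ i → Vec.lookup e' i Fin.≟ Vec.lookup e i) (∈.∈-allFin i) (sym eq))

  last-stage-empty : r * Δ < ways r' → length (stage r') ≡ 0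
  last-stage-empty big = no-members (stage r') λ e e∈ →
    ℕ.<⇒≱ big (ℕ.≤-trans (reach-many r' [] e ℕ.≤-refl e∈) (reach-few e))
    where
    no-members : ∀ {A : Set} (xs : List A) → (∀ x → x ∉ xs) → length xs ≡ 0
    no-members []       h = refl
    no-members (x ∷ xs) h = contradiction (here refl) (h x)

  stages : ∀ k → length T ≡ ∑ (upTo k) (λ j → length (light j)) + length (stage k)
  stages zero    = refl
  stages (suc k) = begin
    length T ≡⟨ stages k ⟩
    S k + length (stage k) ≡⟨ cong (S k +_) (#-split (light? (stage k) k) (stage k)) ⟩
    S k + (length (light k) + length (stage (suc k))) ≡⟨ sym (ℕ.+-assoc (S k) _ _) ⟩
    S k + length (light k) + length (stage (suc k)) ≡⟨ cong (_+ length (stage (suc k))) (sym (∑-upTo-suc k (λ j → length (light j)))) ⟩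
    S (suc k) + length (stage (suc k)) ∎
    where
    open ≡-Reasoning
    S : ℕ → ℕ
    S k = ∑ (upTo k) (λ j → length (light j))

  Low : ∀ {i} → ℕ → List Edge → (Fin i → Fin r) → Set
  Low k E ι = ∀ e → e ∈ E → (∀ {a b} → ι a ≡ ι b → a ≡ b) × (∀ l → codegree E (ι l) e ≤ threshold (suc k))

  positions : ∀ k e → Dec (suc (suc k) ≤ length (lows (stage k) k e)) → Fin (suc (suc k)) → Fin r
  positions k e (yes enough) l = lookup (lows (stage k) k e) (inject≤ l enough)
  -- A default for edges with too few low positions; such edges lie outside `light k`.
  positions k e (no _)       l = Fin.zero

  abstract
    position-key : ∀ k → Edge → Fin (r ^ suc (suc k))
    position-key k e = funToFin (positions k e (light? (stage k) k e))

    position-key-spec : ∀ k e → suc (suc k) ≤ length (lows (stage k) k e) → ∃ λ enough →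
      ∀ l → finToFun {r} {suc (suc k)} (position-key k e) l ≡ lookup (lows (stage k) k e) (inject≤ l enough)
    position-key-spec k e ok = spec (light? (stage k) k e) ok
      where
      spec : ∀ (d : Dec (suc (suc k) ≤ length (lows (stage k) k e))) → suc (suc k) ≤ length (lows (stage k) k e) → ∃ λ enough →
             ∀ l → finToFun {r} {suc (suc k)} (funToFin (positions k e d)) l ≡ lookup (lows (stage k) k e) (inject≤ l enough)
      spec (yes enough) _  = enough , Fin.finToFun-funToFin (positions k e (yes enough))
      spec (no ¬ok)     ok = contradiction ok ¬ok

  module _ (k : ℕ) (κ : Fin (r ^ suc (suc k))) where

    in-class? : ∀ e → Dec (position-key k e ≡ κ)
    in-class? e = position-key k e Fin.≟ κ

    class-edges : List Edge
    class-edges = filter in-class? (light k)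

    class-unique : Unique class-edges
    class-unique = Unique.filter⁺ in-class? (Unique.filter⁺ (light? (stage k) k) (stage-unique k))

    class-member : ∀ e → e ∈ class-edges → e ∈ stage k × suc (suc k) ≤ length (lows (stage k) k e) × position-key k e ≡ κ
    class-member e e∈ = let e∈l , eq = ∈.∈-filter⁻ in-class? {xs = light k} e∈
                            e∈k , ok = ∈.∈-filter⁻ (light? (stage k) k) {xs = stage k} e∈l
                        in e∈k , ok , eq

    class-low : Low k class-edges (finToFun {r} {suc (suc k)} κ)
    class-low e e∈ =
        (λ {a} {b} ιa≡ιb → Fin.inject≤-injective enough enough a b
          (lookup-unique-injective (Unique.filter⁺ (λ j → codegree (stage k) j e ≤? threshold (suc k)) (Unique.allFin⁺ r))
            (trans (sym (pos a)) (trans ιa≡ιb (pos b))))) ,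
        λ l → ℕ.≤-trans (codegree-filter in-class? (light k) (ι l) e)
          (ℕ.≤-trans (codegree-filter (light? (stage k) k) (stage k) (ι l) e)
          (subst (λ j → codegree (stage k) j e ≤ threshold (suc k)) (sym (pos l))
            (proj₂ (∈.∈-filter⁻ (λ j → codegree (stage k) j e ≤? threshold (suc k)) {xs = allFin r}
              (∈.∈-lookup {xs = lows (stage k) k e} (inject≤ l enough))))))
      where
      ι : Fin (suc (suc k)) → Fin r
      ι = finToFun κ
      eq = proj₂ (proj₂ (class-member e e∈))
      spec = position-key-spec k e (proj₁ (proj₂ (class-member e e∈)))
      enough = proj₁ spec
      pos : ∀ l → ι l ≡ lookup (lows (stage k) k e) (inject≤ l enough)
      pos l = trans (cong (λ z → finToFun {r} {suc (suc k)} z l) (sym eq)) (proj₂ spec l)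

  -- Two pigeonholes: one over the r' rounds, which discard every edge since the last stage is
  -- empty, and one over the at most `r ^ r` choices of low positions.
  regular-part : 0 < r' → r * Δ < ways r' →
    ∃ λ k → k < r' × ∃ λ (ι : Fin (suc (suc k)) → Fin r) → ∃ λ E →
      Unique E × (∀ e → e ∈ E → e ∈ T) × length T ≤ r' * r ^ r * length E × Low k E ι
  regular-part 0<r' big =
    let k , k∈ , le = ∑≤max (upTo r') (λ j → length (light j)) (subst (0 <_) (sym (List.length-upTo r')) 0<r')
        κ , le' = popular {k = r ^ suc (suc k)} (ℕ.m^n>0 r (suc (suc k))) (position-key k) (light k)
        k<r' = ∈.∈-upTo⁻ k∈
    in k , k<r' , finToFun κ , class-edges k κ , class-unique k κ ,
       (λ e e∈ → stage⊆T k (proj₁ (class-member k κ e e∈))) , count k k<r' (class-edges k κ) le le' , class-low k κ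
    where
    open ℕ.≤-Reasoning
    count : ∀ k → k < r' → ∀ (E : List Edge) → ∑ (upTo r') (λ j → length (light j)) ≤ length (upTo r') * length (light k) →
            length (light k) ≤ r ^ suc (suc k) * length E → length T ≤ r' * r ^ r * length E
    count k k<r' E le le' = begin
      length T ≡⟨ stages r' ⟩
      ∑ (upTo r') (λ j → length (light j)) + length (stage r') ≡⟨ trans (cong (∑ (upTo r') (λ j → length (light j)) +_) (last-stage-empty big)) (ℕ.+-identityʳ _) ⟩
      ∑ (upTo r') (λ j → length (light j)) ≤⟨ le ⟩
      length (upTo r') * length (light k) ≡⟨ cong (_* length (light k)) (List.length-upTo r') ⟩
      r' * length (light k) ≤⟨ ℕ.*-monoʳ-≤ r' le' ⟩
      r' * (r ^ suc (suc k) * length E) ≡⟨ sym (ℕ.*-assoc r' (r ^ suc (suc k)) (length E)) ⟩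
      r' * r ^ suc (suc k) * length E ≤⟨ ℕ.*-monoˡ-≤ (length E) (ℕ.*-monoʳ-≤ r' (ℕ.^-monoʳ-≤ r (s≤s k<r'))) ⟩
      r' * r ^ r * length E ∎

-- Selecting edges by an equation between their colours

-- All that the selection has to know about the colours. From here on the field and its polynomials
-- are out of sight.
record ColourScheme (p i S B : ℕ) : Set where
  field
    colours keys  : ℕ
    key           : Fin colours → Fin keys
    many-colours  : p ^ S ≤ colours
    small-classes : ∀ κ → # (λ c → key c Fin.≟ κ) (allFin colours) ≤ B
    value         : (Fin i → Fin colours) → Fin p
    value-cong    : ∀ {χ χ'} → (∀ j → χ j ≡ χ' j) → value χ ≡ value χ'
    few-common    : ∀ {T} (j₀ : Fin i) (ctx : Fin S → Fin i → Fin colours) (ys : Fin T → Fin colours)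
                    (x : Fin S → Fin T → Fin i → Fin colours) (c₀ : Fin p) →
                    (∀ a b j → j ≢ j₀ → x a b j ≡ ctx a j) → (∀ a b → x a b j₀ ≡ ys b) →
                    (∀ {a a'} → a ≢ a' → ∃ λ j → j ≢ j₀ × key (ctx a j) ≢ key (ctx a' j)) →
                    (∀ {b b'} → b ≢ b' → key (ys b) ≢ key (ys b')) →
                    (∀ a b → value (x a b) ≡ c₀) → T ≤ B

prime-scheme : ∀ {p} i S → Prime p → dim i S ≤ p → ColourScheme p i S (bound i S)
prime-scheme {p} i S p-prime dim≤p = record
  { colours = colours ; keys = p ^ S ; key = key ; many-colours = many-colours
  ; small-classes = small-key-classes ; value = value ; value-cong = value-cong ; few-common = few-common-extensions }
  where open Palette (PrimeField.primeField p p-prime) i S dim≤p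

#-concatMap : ∀ {A B : Set} {P : B → Set} (P? : ∀ b → Dec (P b)) (f : A → List B) xs →
              # P? (concatMap f xs) ≡ ∑ xs (λ x → # P? (f x))
#-concatMap P? f []       = refl
#-concatMap P? f (x ∷ xs) = trans (#-++ P? (f x) (concatMap f xs)) (cong (# P? (f x) +_) (#-concatMap P? f xs))

length-concatMap : ∀ {A B : Set} (f : A → List B) xs → length (concatMap f xs) ≡ ∑ xs (λ x → length (f x))
length-concatMap f []       = refl
length-concatMap f (x ∷ xs) = trans (List.length-++ (f x)) (cong (length (f x) +_) (length-concatMap f xs))

infixl 6 _[_↦_]
_[_↦_] : ∀ {i} {A : Set} → (Fin i → A) → Fin i → A → Fin i → A
(g [ l ↦ u ]) l' = if does (l' Fin.≟ l) then u else g l'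

[↦]-at : ∀ {i} {A : Set} (g : Fin i → A) l u → (g [ l ↦ u ]) l ≡ u
[↦]-at g l u with l Fin.≟ l
... | yes _ = refl
... | no ¬p = contradiction refl ¬p

[↦]-off : ∀ {i} {A : Set} (g : Fin i → A) l u l' → l' ≢ l → (g [ l ↦ u ]) l' ≡ g l'
[↦]-off g l u l' l'≢ with l' Fin.≟ l
... | yes p = contradiction p l'≢
... | no _  = refl

module _ {k q C : ℕ} (key : Fin k → Fin q) (0<k : 0 < k) (classes : ∀ κ → # (λ c → key c Fin.≟ κ) (allFin k) ≤ C)
         {n : ℕ} {X : Set} (conflicts : X → List (Fin n × Fin n)) where

  bad : (Fin n → Fin k) → X → ℕ
  bad φ x = # (clash? key 0<k classes φ) (conflicts x)

  good? : ∀ φ x → Dec (bad φ x ≡ 0)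
  good? φ x = bad φ x ℕ.≟ 0

  -- The total number of clashes is at most C σ |E| / k, hence at most half of |E|, so at least half
  -- of E has no clash.
  good-colouring : ∀ σ (E : List X) → All (λ p → proj₁ p ≢ proj₂ p) (concatMap conflicts E) →
                   (∀ x → x ∈ E → length (conflicts x) ≤ σ) → 0 < C * σ → 2 * (C * σ) ≤ k →
                   ∃ λ φ → length E ≤ 2 * # (good? φ) E
  good-colouring σ E ≢s few 0<Cσ enough = φ , ℕ.+-cancelʳ-≤ (length E) (length E) (2 * # (good? φ) E) (begin
      length E + length E ≡⟨ cong (length E +_) (sym (ℕ.+-identityʳ (length E))) ⟩
      2 * length E ≡⟨ cong (2 *_) (#-split (good? φ) E) ⟩
      2 * (# (good? φ) E + # (λ x → ¬? (good? φ x)) E) ≡⟨ ℕ.*-distribˡ-+ 2 (# (good? φ) E) _ ⟩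
      2 * # (good? φ) E + 2 * # (λ x → ¬? (good? φ x)) E
        ≤⟨ ℕ.+-monoʳ-≤ (2 * # (good? φ) E) (ℕ.≤-trans (ℕ.*-monoʳ-≤ 2 few-bad) total-bad) ⟩
      2 * # (good? φ) E + length E ∎)
    where
    open ℕ.≤-Reasoning
    coloured = colouring key 0<k classes n (concatMap conflicts E) ≢s
    φ = proj₁ coloured
    total-bad : 2 * ∑ E (bad φ) ≤ length E
    total-bad = ℕ.*-cancelˡ-≤ (C * σ) {{>-nonZero 0<Cσ}} (begin
      C * σ * (2 * ∑ E (bad φ)) ≡⟨ trans (sym (ℕ.*-assoc (C * σ) 2 _)) (cong (_* ∑ E (bad φ)) (ℕ.*-comm (C * σ) 2)) ⟩
      2 * (C * σ) * ∑ E (bad φ) ≤⟨ ℕ.*-monoˡ-≤ (∑ E (bad φ)) enough ⟩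
      k * ∑ E (bad φ) ≡⟨ cong (k *_) (sym (#-concatMap (clash? key 0<k classes φ) conflicts E)) ⟩
      k * # (clash? key 0<k classes φ) (concatMap conflicts E)
                                             ≤⟨ proj₂ coloured ⟩
      C * length (concatMap conflicts E) ≡⟨ cong (C *_) (length-concatMap conflicts E) ⟩
      C * ∑ E (length ∘ conflicts) ≤⟨ ℕ.*-monoʳ-≤ C (∑-mono-≤ E few) ⟩
      C * ∑ E (λ _ → σ) ≡⟨ cong (C *_) (trans (∑-const E σ) (ℕ.*-comm (length E) σ)) ⟩
      C * (σ * length E) ≡⟨ sym (ℕ.*-assoc C σ (length E)) ⟩
      C * σ * length E ∎)
    few-bad : # (λ x → ¬? (good? φ x)) E ≤ ∑ E (bad φ)
    few-bad = ℕ.≤-trans (ℕ.≤-reflexive (#≡∑ (λ x → ¬? (good? φ x)) E))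
      (∑-mono-≤ E λ x _ → ind≤ (¬? (good? φ x)) ℕ.n≢0⇒n>0)

module Selection {n r i p S B : ℕ} (scheme : ColourScheme p i S B) (ι : Fin i → Fin r) where
  open ColourScheme scheme
  Edge = Vec (Fin n) r

  at : Fin i → Edge → Fin n
  at l e = Vec.lookup e (ι l)

  -- Exchanging a vertex of a complete subgraph for another one of the same part leads from an edge
  -- to a neighbour of it. If neighbours have different keys, the keys are therefore injective on
  -- every such part.
  Neighbour : Fin i → Edge → Edge → Set
  Neighbour l e e' = AgreeOff (ι l) e e' × at l e ≢ at l e'

  abstract
    neighbour? : ∀ l e e' → Dec (Neighbour l e e')
    neighbour? l e e' = agreeOff? (ι l) e e' ×-dec ¬? (at l e Fin.≟ at l e')

  conflicts : List Edge → Edge → List (Fin n × Fin n)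
  conflicts E e = concatMap (λ l → map (λ e' → at l e , at l e') (filter (neighbour? l e) E)) (allFin i)

  conflicts-few : ∀ E τ → (∀ e → e ∈ E → ∀ l → codegree E (ι l) e ≤ τ) → ∀ e → e ∈ E → length (conflicts E e) ≤ i * τ
  conflicts-few E τ low e e∈ = begin
    length (conflicts E e)
      ≡⟨ length-concatMap (λ l → map (λ e' → at l e , at l e') (filter (neighbour? l e) E)) (allFin i) ⟩
    ∑ (allFin i) (λ l → length (map (λ e' → at l e , at l e') (filter (neighbour? l e) E)))
      ≡⟨ ∑-cong (allFin i) (λ l → List.length-map (λ e' → at l e , at l e') (filter (neighbour? l e) E)) ⟩
    ∑ (allFin i) (λ l → # (neighbour? l e) E)
      ≤⟨ ∑-mono-≤ (allFin i) (λ l _ → ℕ.≤-trans (#-mono (neighbour? l e) (agreeOff? (ι l) e) E (λ _ _ → proj₁)) (low e e∈ l)) ⟩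
    ∑ (allFin i) (λ _ → τ)
      ≡⟨ trans (∑-const (allFin i) τ) (cong (_* τ) (length-allFin i)) ⟩
    i * τ ∎
    where open ℕ.≤-Reasoning

  conflicts-≢ : ∀ E → All (λ q → proj₁ q ≢ proj₂ q) (concatMap (conflicts E) E)
  conflicts-≢ E = All.tabulate λ q∈ →
    let e , _ , q∈e = find (∈.∈-concatMap⁻ (conflicts E) {xs = E} q∈)
        l , _ , q∈l = find (∈.∈-concatMap⁻ (λ l → map (λ e' → at l e , at l e') (filter (neighbour? l e) E)) {xs = allFin i} q∈e)
        e' , e'∈ , eq = ∈.∈-map⁻ (λ e' → at l e , at l e') q∈l
    in subst (λ q → proj₁ q ≢ proj₂ q) (sym eq) (proj₂ (proj₂ (∈.∈-filter⁻ (neighbour? l e) {xs = E} e'∈)))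

  ∈-conflicts : ∀ E e e' l → e' ∈ E → Neighbour l e e' → (at l e , at l e') ∈ conflicts E e
  ∈-conflicts E e e' l e'∈ nb = ∈.∈-concatMap⁺ (λ l → map (λ e' → at l e , at l e') (filter (neighbour? l e) E))
    (Any.map (λ { refl → ∈.∈-map⁺ (λ e' → at l e , at l e') (∈.∈-filter⁺ (neighbour? l e) e'∈ nb) }) (∈.∈-allFin l))

  record Selected (E : List Edge) : Set where
    field
      φ         : Fin n → Fin colours
      c₀        : Fin p
      chosen     : List Edge
      chosen-unique : Unique chosen
      subset    : ∀ e → e ∈ chosen → e ∈ E
      large     : length E ≤ 2 * p * length chosen
      separated : ∀ {e e'} → e ∈ chosen → e' ∈ chosen → ∀ l → Neighbour l e e' → key (φ (at l e)) ≢ key (φ (at l e'))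
      constant  : ∀ {e} → e ∈ chosen → value (λ l → φ (at l e)) ≡ c₀

  module _ (0<p : 0 < p) (0<colours : 0 < colours) (E : List Edge) (E-unique : Unique E) (τ : ℕ)
           (low : ∀ e → e ∈ E → ∀ l → codegree E (ι l) e ≤ τ)
           (0<Biτ : 0 < B * (i * τ)) (enough : 2 * (B * (i * τ)) ≤ colours) where
    private
      coloured = good-colouring key 0<colours small-classes (conflicts E) (i * τ) E (conflicts-≢ E)
                   (conflicts-few E τ low) 0<Biτ enough
      φ = proj₁ coloured

      good-edge? : ∀ e → Dec (bad key 0<colours small-classes (conflicts E) φ e ≡ 0)
      good-edge? = good? key 0<colours small-classes (conflicts E) φ

      popular-value = popular 0<p (λ e → value (λ l → φ (at l e))) (filter good-edge? E)
      c₀ = proj₁ popular-value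
      value? : ∀ e → Dec (value (λ l → φ (at l e)) ≡ c₀)
      value? e = value (λ l → φ (at l e)) Fin.≟ c₀

      G = filter value? (filter good-edge? E)

      G⁻ : ∀ {e} → e ∈ G → e ∈ E × bad key 0<colours small-classes (conflicts E) φ e ≡ 0 × value (λ l → φ (at l e)) ≡ c₀
      G⁻ e∈ = let e∈good , v = ∈.∈-filter⁻ value? {xs = filter good-edge? E} e∈
                  e∈E , g = ∈.∈-filter⁻ good-edge? {xs = E} e∈good
              in e∈E , g , v

    select : Selected E
    select = record
      { φ = φ ; c₀ = c₀ ; chosen = G
      ; chosen-unique = Unique.filter⁺ value? (Unique.filter⁺ good-edge? E-unique)
      ; subset = λ e e∈ → proj₁ (G⁻ e∈)
      ; large = ℕ.≤-trans (proj₂ coloured) (ℕ.≤-trans (ℕ.*-monoʳ-≤ 2 (proj₂ popular-value)) (ℕ.≤-reflexive (sym (ℕ.*-assoc 2 p (length G)))))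
      ; separated = λ {e} {e'} e∈ e'∈ l nb eq → ℕ.<⇒≢ (∈.∈-length (∈.∈-filter⁺ (clash? key 0<colours small-classes φ)
          (∈-conflicts E e e' l (proj₁ (G⁻ e'∈)) nb) eq)) (sym (proj₁ (proj₂ (G⁻ e∈))))
      ; constant = λ e∈ → proj₂ (proj₂ (G⁻ e∈))
      }

  module _ {E : List Edge} (sel : Selected E)
           (ι-injective : ∀ {a b} → ι a ≡ ι b → a ≡ b)
           (Ps : Vec (List (Fin n)) r) (Ps-unique : ∀ j → Unique (Vec.lookup Ps j))
           (Ps-edges : ∀ t → t ∈ tuples Ps → t ∈ Selected.chosen sel)
           (root : Fin r → Fin n) (root∈ : ∀ j → root j ∈ Vec.lookup Ps j)
           (l₀ : Fin i) where
    open Selected sel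

    private
      part : Fin i → List (Fin n)
      part l = Vec.lookup Ps (ι l)

      -- Positions that ι misses are filled with the fixed vertex `root j`, because the value of an
      -- edge depends only on its colours at the positions ι l.
      entry : (Fin i → Fin n) → ∀ j → Dec (∃ λ l → ι l ≡ j) → Fin n
      entry g j (yes (l , _)) = g l
      entry g j (no _)        = root j

      assemble : (Fin i → Fin n) → Edge
      assemble g = Vec.tabulate λ j → entry g j (Fin.any? λ l → ι l Fin.≟ j)

      at-assemble : ∀ g l → at l (assemble g) ≡ g l
      at-assemble g l = trans (Vec.lookup∘tabulate _ (ι l)) (entry-at (Fin.any? λ l' → ι l' Fin.≟ ι l))
        where
        entry-at : ∀ d → entry g (ι l) d ≡ g l
        entry-at (yes (l' , eq)) = cong g (ι-injective eq)
        entry-at (no none)       = contradiction (l , refl) none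

      assemble-∈ : ∀ g → (∀ l → g l ∈ part l) → assemble g ∈ chosen
      assemble-∈ g g∈ = Ps-edges _ (∈-tuples⁺ Ps _ λ j →
          subst (_∈ Vec.lookup Ps j) (sym (Vec.lookup∘tabulate _ j)) (entry-∈ j (Fin.any? λ l → ι l Fin.≟ j)))
        where
        entry-∈ : ∀ j d → entry g j d ∈ Vec.lookup Ps j
        entry-∈ j (yes (l , refl)) = g∈ l
        entry-∈ j (no _)           = root∈ j

      assemble-agree : ∀ g l u v → AgreeOff (ι l) (assemble (g [ l ↦ u ])) (assemble (g [ l ↦ v ]))
      assemble-agree g l u v j with j Fin.≟ ι l
      ... | yes eq = inj₁ eq
      ... | no j≢  = inj₂ (trans (Vec.lookup∘tabulate _ j) (trans (same (Fin.any? λ l' → ι l' Fin.≟ j)) (sym (Vec.lookup∘tabulate _ j))))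
        where
        same : ∀ d → entry (g [ l ↦ u ]) j d ≡ entry (g [ l ↦ v ]) j d
        same (no _)         = refl
        same (yes (l' , refl)) = trans ([↦]-off g l u l' λ { refl → j≢ refl }) (sym ([↦]-off g l v l' λ { refl → j≢ refl }))

      ∈-update : ∀ {g} → (∀ l → g l ∈ part l) → ∀ l {u} → u ∈ part l → ∀ l' → (g [ l ↦ u ]) l' ∈ part l'
      ∈-update {g} g∈ l {u} u∈ l' with l' Fin.≟ l
      ... | yes refl = u∈
      ... | no _     = g∈ l'

      keys-differ : ∀ l {u v} → u ∈ part l → v ∈ part l → u ≢ v → key (φ u) ≢ key (φ v)
      keys-differ l {u} {v} u∈ v∈ u≢v eq = separated
          (assemble-∈ gu (∈-update (λ l → root∈ (ι l)) l u∈)) (assemble-∈ gv (∈-update (λ l → root∈ (ι l)) l v∈)) l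
          (assemble-agree (root ∘ ι) l u v , λ same → u≢v (trans (sym at-u) (trans same at-v)))
          (trans (cong (key ∘ φ) at-u) (trans eq (sym (cong (key ∘ φ) at-v))))
        where
        gu = (root ∘ ι) [ l ↦ u ]
        gv = (root ∘ ι) [ l ↦ v ]
        at-u : at l (assemble gu) ≡ u
        at-u = trans (at-assemble gu l) ([↦]-at (root ∘ ι) l u)
        at-v : at l (assemble gv) ≡ v
        at-v = trans (at-assemble gv l) ([↦]-at (root ∘ ι) l v)

    -- The singleton at `l₀` keeps contexts as full tuples while their number is the product of the
    -- sizes of the other parts.
    context-parts : Vec (List (Fin n)) i
    context-parts = Vec.tabulate (part [ l₀ ↦ root (ι l₀) ∷ [] ])

    private
      context-part-off : ∀ l → l ≢ l₀ → Vec.lookup context-parts l ≡ part l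
      context-part-off l l≢ = trans (Vec.lookup∘tabulate _ l) ([↦]-off part l₀ _ l l≢)

      context-part-at : Vec.lookup context-parts l₀ ≡ root (ι l₀) ∷ []
      context-part-at = trans (Vec.lookup∘tabulate _ l₀) ([↦]-at part l₀ _)

      context-unique : ∀ l → Unique (Vec.lookup context-parts l)
      context-unique l with l Fin.≟ l₀
      ... | yes refl = subst Unique (sym context-part-at) ([] ∷ [])
      ... | no l≢    = subst Unique (sym (context-part-off l l≢)) (Ps-unique (ι l))

    -- Tuples over the other parts serve as the S contexts, and the vertices of the part at `l₀` as
    -- their common extensions, so `few-common` bounds that part.
    no-complete-part : S ≤ product (Vec.map length context-parts) → length (Vec.lookup Ps (ι l₀)) ≤ B
    no-complete-part S≤ = few-common l₀ (λ a l → φ (Vec.lookup (ctx a) l)) (φ ∘ y) (λ a b l → φ (full a b l)) c₀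
        (λ a b l l≢ → cong φ ([↦]-off (Vec.lookup (ctx a)) l₀ (y b) l l≢))
        (λ a b → cong φ ([↦]-at (Vec.lookup (ctx a)) l₀ (y b)))
        ctx-differ
        (λ {b} {b'} b≢ → keys-differ l₀ (∈.∈-lookup b) (∈.∈-lookup b')
          λ eq → b≢ (lookup-unique-injective (Ps-unique (ι l₀)) eq))
        (λ a b → trans (value-cong λ l → cong φ (sym (at-assemble (full a b) l)))
                       (constant (assemble-∈ (full a b) (full-∈ a b))))
      where
      contexts = tuples context-parts
      S≤contexts : S ≤ length contexts
      S≤contexts = subst (S ≤_) (sym (length-tuples context-parts)) S≤
      ctx : Fin S → Vec (Fin n) i
      ctx a = lookup contexts (inject≤ a S≤contexts)
      ctx-∈ : ∀ a l → Vec.lookup (ctx a) l ∈ Vec.lookup context-parts l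
      ctx-∈ a = ∈-tuples⁻ context-parts (∈.∈-lookup {xs = contexts} (inject≤ a S≤contexts))
      y : Fin (length (part l₀)) → Fin n
      y = lookup (part l₀)
      full : Fin S → Fin (length (part l₀)) → Fin i → Fin n
      full a b = Vec.lookup (ctx a) [ l₀ ↦ y b ]
      full-∈ : ∀ a b l → full a b l ∈ part l
      full-∈ a b l with l Fin.≟ l₀
      ... | yes refl = ∈.∈-lookup b
      ... | no l≢    = subst (Vec.lookup (ctx a) l ∈_) (context-part-off l l≢) (ctx-∈ a l)
      at-l₀ : ∀ a → Vec.lookup (ctx a) l₀ ≡ root (ι l₀)
      at-l₀ a with subst (Vec.lookup (ctx a) l₀ ∈_) context-part-at (ctx-∈ a l₀)
      ... | here eq = eq
      ctx-differ : ∀ {a a'} → a ≢ a' → ∃ λ l → l ≢ l₀ × key (φ (Vec.lookup (ctx a) l)) ≢ key (φ (Vec.lookup (ctx a') l))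
      ctx-differ {a} {a'} a≢ with Fin.any? (λ l → ¬? (Vec.lookup (ctx a) l Fin.≟ Vec.lookup (ctx a') l))
      ... | yes (l , neq) = l , l≢ , keys-differ l (mem a) (mem a') neq
        where
        l≢ : l ≢ l₀
        l≢ refl = neq (trans (at-l₀ a) (sym (at-l₀ a')))
        mem : ∀ a → Vec.lookup (ctx a) l ∈ part l
        mem a = subst (Vec.lookup (ctx a) l ∈_) (context-part-off l l≢) (ctx-∈ a l)
      ... | no none = contradiction (Fin.inject≤-injective S≤contexts S≤contexts a a'
              (lookup-unique-injective (tuples-unique context-parts context-unique) (vec-ext same))) a≢
        where
        same : ∀ l → Vec.lookup (ctx a) l ≡ Vec.lookup (ctx a') l
        same l with Vec.lookup (ctx a) l Fin.≟ Vec.lookup (ctx a') l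
        ... | yes eq = eq
        ... | no neq = contradiction (l , neq) none

open import Data.Fin.Subset using (⁅_⁆; ⋃; ∣_∣; _∪_; inside; outside) renaming (_∈_ to _∈ˢ_; _∉_ to _∉ˢ_)
open import Defs using (aCoef; sumA; degIn; ContainsK)

-- Hypergraphs and their edges as tuples

-- Repeats the last value beyond the end, which keeps a monotone s monotone and frees later
-- inductions from index bounds.
ext : ∀ {r} → (Fin (suc r) → ℕ) → ℕ → ℕ
ext {zero}  s j       = s Fin.zero
ext {suc r} s zero    = s Fin.zero
ext {suc r} s (suc j) = ext (s ∘ Fin.suc) j

ext-zero : ∀ {r} (s : Fin (suc r) → ℕ) → ext s 0 ≡ s Fin.zero
ext-zero {zero}  s = refl
ext-zero {suc r} s = refl

ext-toℕ : ∀ {r} (s : Fin (suc r) → ℕ) i → ext s (toℕ i) ≡ s i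
ext-toℕ s               Fin.zero    = ext-zero s
ext-toℕ {suc r} s       (Fin.suc i) = ext-toℕ (s ∘ Fin.suc) i

ext-all : ∀ {r} {P : ℕ → Set} (s : Fin (suc r) → ℕ) → (∀ i → P (s i)) → ∀ j → P (ext s j)
ext-all {zero}      s h j       = h Fin.zero
ext-all {suc r}     s h zero    = h Fin.zero
ext-all {suc r} {P} s h (suc j) = ext-all {P = P} (s ∘ Fin.suc) (h ∘ Fin.suc) j

ext-suc : ∀ {r} (s : Fin (suc r) → ℕ) → (∀ i j → i Data.Fin.≤ j → s i ≤ s j) → ∀ j → ext s j ≤ ext s (suc j)
ext-suc {zero}  s h j       = ℕ.≤-refl
ext-suc {suc r} s h zero    = ℕ.≤-trans (h Fin.zero (Fin.suc Fin.zero) z≤n) (ℕ.≤-reflexive (sym (ext-zero (s ∘ Fin.suc))))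
ext-suc {suc r} s h (suc j) = ext-suc (s ∘ Fin.suc) (λ i j le → h (Fin.suc i) (Fin.suc j) (s≤s le)) j

mono : ∀ (u : ℕ → ℕ) → (∀ j → u j ≤ u (suc j)) → ∀ {i j} → i ≤ j → u i ≤ u j
mono u step {i} {j} le = subst (λ z → u i ≤ u z) (ℕ.m+[n∸m]≡n le) (go (j ∸ i))
  where
  go : ∀ d → u i ≤ u (i + d)
  go zero    = ℕ.≤-reflexive (cong u (sym (ℕ.+-identityʳ i)))
  go (suc d) = ℕ.≤-trans (go d) (ℕ.≤-trans (step (i + d)) (ℕ.≤-reflexive (cong u (sym (ℕ.+-suc i d)))))

-- With indices from 0, `partial (ext s) j` is the number a of index j + 1.
partial : (ℕ → ℕ) → ℕ → ℕ
partial u zero    = 1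
partial u (suc j) = partial u j * u j

partial>0 : ∀ u → (∀ j → 0 < u j) → ∀ j → 0 < partial u j
partial>0 u pos zero    = s≤s z≤n
partial>0 u pos (suc j) = ℕ.*-mono-< (partial>0 u pos j) (pos j)

partial-≤ : ∀ u → (∀ j → u j ≤ u (suc j)) → ∀ k → partial u (suc k) ≤ u k ^ suc k
partial-≤ u step zero    = ℕ.≤-reflexive (trans (ℕ.+-identityʳ (u 0)) (sym (ℕ.*-identityʳ (u 0))))
partial-≤ u step (suc k) = ℕ.≤-trans (ℕ.*-monoˡ-≤ (u (suc k)) (ℕ.≤-trans (partial-≤ u step k) (ℕ.^-monoˡ-≤ (suc k) (step k))))
  (ℕ.≤-reflexive (ℕ.*-comm (u (suc k) ^ suc k) (u (suc k))))

-- Remove the largest index M from L. The remaining indices are distinct and below M, so M is at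
-- least their number and u M is at least the last factor of the initial product.
partial-minimal : ∀ u → (∀ {i j} → i ≤ j → u i ≤ u j) → ∀ M L → Unique L → All (_< M) L → partial u (length L) ≤ ∏ L u
partial-minimal u u-mono M       []          uq  lt       = ℕ.≤-refl
partial-minimal u u-mono zero    (x ∷ L)     uq  (() ∷ _)
partial-minimal u u-mono (suc M) L@(_ ∷ _) uq lt with DecMem._∈?_ ℕ._≟_ M L
... | no M∉ = partial-minimal u u-mono M L uq (All.tabulate λ {x} x∈ →
        ℕ.≤∧≢⇒< (ℕ.≤-pred (All.lookup lt x∈)) λ { refl → M∉ x∈ })
... | yes M∈ with ∈.∈-∃++ M∈
...   | as , bs , eq = subst (λ L → partial u (length L) ≤ ∏ L u) (sym eq) (begin
    partial u (length (as ++ M ∷ bs)) ≡⟨ cong (partial u) len ⟩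
    partial u (length (as ++ bs)) * u (length (as ++ bs))
                                           ≤⟨ ℕ.*-mono-≤ (partial-minimal u u-mono M (as ++ bs) uq' lt') (u-mono len≤M) ⟩
    ∏ (as ++ bs) u * u M ≡⟨ sym (split as) ⟩
    ∏ (as ++ M ∷ bs) u ∎)
  where
  open ℕ.≤-Reasoning
  len : length (as ++ M ∷ bs) ≡ suc (length (as ++ bs))
  len = trans (List.length-++ as) (trans (ℕ.+-suc (length as) (length bs)) (cong suc (sym (List.length-++ as))))
  split : ∀ as → ∏ (as ++ M ∷ bs) u ≡ ∏ (as ++ bs) u * u M
  split []       = ℕ.*-comm (u M) (∏ bs u)
  split (x ∷ as) = trans (cong (u x *_) (split as)) (sym (ℕ.*-assoc (u x) (∏ (as ++ bs) u) (u M)))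
  remove : ∀ as → Unique (as ++ M ∷ bs) → Unique (as ++ bs) × M ∉ as ++ bs
  remove []       (M∉ ∷ uq) = uq , λ M∈ → All.lookup M∉ M∈ refl
  remove (x ∷ as) (x∉ ∷ uq) with remove as uq
  ... | uq' , M∉ = All.++⁺ (All.++⁻ˡ as x∉) (All.tail (All.++⁻ʳ as x∉)) ∷ uq' ,
        λ { (here refl) → All.lookup (All.++⁻ʳ as x∉) (here refl) refl ; (there M∈) → M∉ M∈ }
  removed = remove as (subst Unique eq uq)
  uq' = proj₁ removed
  lt' : All (_< M) (as ++ bs)
  lt' = All.tabulate λ {x} x∈ → ℕ.≤∧≢⇒< (ℕ.≤-pred (All.lookup lt (subst (x ∈_) (sym eq) (weaken x∈)))) λ { refl → proj₂ removed x∈ }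
    where
    weaken : ∀ {x} → x ∈ as ++ bs → x ∈ as ++ M ∷ bs
    weaken x∈ with ∈.∈-++⁻ as x∈
    ... | inj₁ p = ∈.∈-++⁺ˡ p
    ... | inj₂ p = ∈.∈-++⁺ʳ as (there p)
  len≤M : length (as ++ bs) ≤ M
  len≤M = subst (length (as ++ bs) ≤_) (List.length-upTo M) (unique⊆⇒length≤ uq' λ x x∈ → ∈.∈-upTo⁺ (All.lookup lt' x∈))

private
  keep : {P : Set} → Dec P → ℕ → ℕ
  keep (yes _) x = x
  keep (no _)  x = 1

  ∏-keep : ∀ {A : Set} {P : A → Set} (P? : ∀ x → Dec (P x)) xs f → ∏ (filter P? xs) f ≡ ∏ xs (λ x → keep (P? x) (f x))
  ∏-keep P? []       f = refl
  ∏-keep P? (x ∷ xs) f with P? x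
  ... | yes _ = cong (f x *_) (∏-keep P? xs f)
  ... | no _  = trans (∏-keep P? xs f) (sym (ℕ.+-identityʳ _))

  keep-suc : ∀ {a m} (d₁ : Dec (a < suc m)) (d₂ : Dec (a < m)) (d₃ : Dec (a ≡ m)) x → keep d₁ x ≡ keep d₂ x * keep d₃ x
  keep-suc (yes _) (yes _)  (no _)     x = sym (ℕ.*-identityʳ x)
  keep-suc (yes _) (no _)   (yes _)    x = sym (ℕ.+-identityʳ x)
  keep-suc (no _)  (no _)   (no _)     x = refl
  keep-suc _       (yes lt) (yes refl) x = contradiction lt (ℕ.<-irrefl refl)
  keep-suc (yes p) (no ¬q)  (no ¬r)    x = contradiction (ℕ.≤∧≢⇒< (ℕ.≤-pred p) ¬r) ¬q
  keep-suc (no ¬p) (yes q)  _          x = contradiction (ℕ.m≤n⇒m≤1+n q) ¬p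
  keep-suc (no ¬p) _        (yes refl) x = contradiction ℕ.≤-refl ¬p

  product-∏ : ∀ {A : Set} (xs : List A) f → productᴸ (map f xs) ≡ ∏ xs f
  product-∏ []       f = refl
  product-∏ (x ∷ xs) f = cong (f x *_) (product-∏ xs f)

  sum-∑ : ∀ {A : Set} (xs : List A) f → sum (map f xs) ≡ ∑ xs f
  sum-∑ []       f = refl
  sum-∑ (x ∷ xs) f = cong (f x +_) (sum-∑ xs f)

module _ {r : ℕ} (s : Fin (suc r) → ℕ) where

  ∏-initial : ∀ m → m ≤ suc r → ∏ (allFin (suc r)) (λ j → keep (toℕ j <? m) (s j)) ≡ partial (ext s) m
  ∏-initial zero    le = ∏-one (allFin (suc r)) λ _ _ → refl
  ∏-initial (suc m) le = begin
    ∏ (allFin (suc r)) (λ j → keep (toℕ j <? suc m) (s j))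
      ≡⟨ ∏-cong (allFin (suc r)) (λ j → keep-suc (toℕ j <? suc m) (toℕ j <? m) (toℕ j ℕ.≟ m) (s j)) ⟩
    ∏ (allFin (suc r)) (λ j → keep (toℕ j <? m) (s j) * keep (toℕ j ℕ.≟ m) (s j))
      ≡⟨ ∏-* (allFin (suc r)) (λ j → keep (toℕ j <? m) (s j)) (λ j → keep (toℕ j ℕ.≟ m) (s j)) ⟩
    ∏ (allFin (suc r)) (λ j → keep (toℕ j <? m) (s j)) * ∏ (allFin (suc r)) (λ j → keep (toℕ j ℕ.≟ m) (s j))
      ≡⟨ cong₂ _*_ (∏-initial m (ℕ.<⇒≤ le)) last ⟩
    partial (ext s) m * ext s m ∎
    where
    open ≡-Reasoning
    i = Data.Fin.fromℕ< le
    i≡m : toℕ i ≡ m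
    i≡m = Fin.toℕ-fromℕ< le
    keep-yes : ∀ {P : Set} (d : Dec P) x → P → keep d x ≡ x
    keep-yes (yes _) x p = refl
    keep-yes (no ¬p) x p = contradiction p ¬p
    keep-no : ∀ {P : Set} (d : Dec P) x → ¬ P → keep d x ≡ 1
    keep-no (yes p) x ¬p = contradiction p ¬p
    keep-no (no _)  x ¬p = refl
    last : ∏ (allFin (suc r)) (λ j → keep (toℕ j ℕ.≟ m) (s j)) ≡ ext s m
    last = trans (∏-single (Unique.allFin⁺ (suc r)) (∈.∈-allFin i) λ j _ j≢ →
                    keep-no (toℕ j ℕ.≟ m) (s j) λ eq → j≢ (Fin.toℕ-injective (trans eq (sym i≡m))))
           (trans (keep-yes (toℕ i ℕ.≟ m) (s i) i≡m) (trans (sym (ext-toℕ s i)) (cong (ext s) i≡m)))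

  aCoef≡partial : ∀ i → aCoef s i ≡ partial (ext s) (toℕ i)
  aCoef≡partial i = trans (product-∏ (filter (λ j → toℕ j <? toℕ i) (allFin (suc r))) s)
    (trans (∏-keep (λ j → toℕ j <? toℕ i) (allFin (suc r)) s) (∏-initial (toℕ i) (ℕ.<⇒≤ (Fin.toℕ<n i))))

  sumA≡∑ : sumA s ≡ ∑ (upTo r) (λ k → partial (ext s) (suc k))
  sumA≡∑ = begin
    sum (map (aCoef s) (filter (λ i → 1 ≤? toℕ i) (tabulate {n = r} Fin.suc)))
      ≡⟨ cong (λ xs → sum (map (aCoef s) xs)) (List.filter-all (λ i → 1 ≤? toℕ i) (All.tabulate⁺ {n = r} {f = Fin.suc} λ _ → s≤s z≤n)) ⟩
    sum (map (aCoef s) (tabulate {n = r} Fin.suc))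
      ≡⟨ sum-∑ (tabulate {n = r} Fin.suc) (aCoef s) ⟩
    ∑ (tabulate {n = r} Fin.suc) (aCoef s)
      ≡⟨ ∑-cong (tabulate {n = r} Fin.suc) aCoef≡partial ⟩
    ∑ (tabulate {n = r} Fin.suc) (λ i → partial (ext s) (toℕ i))
      ≡⟨ reindex r Fin.suc suc (λ _ → refl) ⟩
    ∑ (applyUpTo suc r) (partial (ext s))
      ≡⟨ reindex' r id ⟩
    ∑ (upTo r) (λ k → partial (ext s) (suc k)) ∎
    where
    open ≡-Reasoning
    reindex : ∀ m {M} (f : Fin m → Fin M) (g : ℕ → ℕ) → (∀ i → toℕ (f i) ≡ g (toℕ i)) →
              ∑ (tabulate f) (λ i → partial (ext s) (toℕ i)) ≡ ∑ (applyUpTo g m) (partial (ext s))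
    reindex zero    f g h = refl
    reindex (suc m) f g h = cong₂ _+_ (cong (partial (ext s)) (h Fin.zero)) (reindex m (f ∘ Fin.suc) (g ∘ suc) (h ∘ Fin.suc))
    reindex' : ∀ m (g : ℕ → ℕ) → ∑ (applyUpTo (suc ∘ g) m) (partial (ext s)) ≡ ∑ (applyUpTo g m) (λ k → partial (ext s) (suc k))
    reindex' zero    g = refl
    reindex' (suc m) g = cong (partial (ext s) (suc (g 0)) +_) (reindex' m (g ∘ suc))

  sumA>0 : 0 < r → (∀ i → 0 < s i) → 0 < sumA s
  sumA>0 0<r s>0 = subst (0 <_) (sym sumA≡∑) (ℕ.<-≤-trans (partial>0 (ext s) (ext-all {P = 0 <_} s s>0) 1)
    (∑-term (λ k → partial (ext s) (suc k)) (∈.∈-upTo⁺ 0<r)))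

_≟ˢ_ : ∀ {n} → DecidableEquality (Subset n)
_≟ˢ_ = Vec.≡-dec Bool._≟_

vertexSet : ∀ {n r} → (Fin r → Fin n) → Subset n
vertexSet {r = r} g = ⋃ (map (λ i → ⁅ g i ⁆) (allFin r))

∈-vertexSet⁺ : ∀ {n r} (g : Fin r → Fin n) i → g i ∈ˢ vertexSet g
∈-vertexSet⁺ {r = r} g i = go (∈.∈-allFin i)
  where
  go : ∀ {xs} → i ∈ xs → g i ∈ˢ ⋃ (map (λ i → ⁅ g i ⁆) xs)
  go (here refl) = Subset.x∈p∪q⁺ (inj₁ (Subset.x∈⁅x⁆ (g i)))
  go (there i∈)  = Subset.x∈p∪q⁺ (inj₂ (go i∈))

∈-vertexSet⁻ : ∀ {n r} (g : Fin r → Fin n) {v} → v ∈ˢ vertexSet g → ∃ λ i → v ≡ g i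
∈-vertexSet⁻ {r = r} g {v} = go (allFin r)
  where
  go : ∀ xs → v ∈ˢ ⋃ (map (λ i → ⁅ g i ⁆) xs) → ∃ λ i → v ≡ g i
  go []       v∈ = contradiction v∈ Subset.∉⊥
  go (x ∷ xs) v∈ with Subset.x∈p∪q⁻ ⁅ g x ⁆ (⋃ (map (λ i → ⁅ g i ⁆) xs)) v∈
  ... | inj₁ p = x , Subset.x∈⁅y⁆⇒x≡y (g x) p
  ... | inj₂ p = go xs p

vertexSet-cong : ∀ {n r} {g h : Fin r → Fin n} → (∀ i → g i ≡ h i) → vertexSet g ≡ vertexSet h
vertexSet-cong {r = r} eq = cong ⋃ (List.map-cong (λ i → cong ⁅_⁆ (eq i)) (allFin r))

∣⁅x⁆∪p∣ : ∀ {n} (x : Fin n) (p : Subset n) → x ∉ˢ p → ∣ ⁅ x ⁆ ∪ p ∣ ≡ suc ∣ p ∣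
∣⁅x⁆∪p∣ Fin.zero    (outside ∷ p) x∉ = cong (λ q → suc ∣ q ∣) (Subset.∪-identityˡ p)
∣⁅x⁆∪p∣ Fin.zero    (inside  ∷ p) x∉ = contradiction here x∉
∣⁅x⁆∪p∣ (Fin.suc x) (outside ∷ p) x∉ = ∣⁅x⁆∪p∣ x p (x∉ ∘ there)
∣⁅x⁆∪p∣ (Fin.suc x) (inside  ∷ p) x∉ = cong suc (∣⁅x⁆∪p∣ x p (x∉ ∘ there))

∣vertexSet∣ : ∀ {n r} (g : Fin r → Fin n) → (∀ {i j} → g i ≡ g j → i ≡ j) → ∣ vertexSet g ∣ ≡ r
∣vertexSet∣ {n} {r} g inj = trans (go (allFin r) (Unique.allFin⁺ r)) (length-allFin r)
  where
  index : ∀ {x} xs → g x ∈ˢ ⋃ (map (λ i → ⁅ g i ⁆) xs) → x ∈ xs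
  index []       v∈ = contradiction v∈ Subset.∉⊥
  index (y ∷ xs) v∈ with Subset.x∈p∪q⁻ ⁅ g y ⁆ (⋃ (map (λ i → ⁅ g i ⁆) xs)) v∈
  ... | inj₁ p = here (inj (Subset.x∈⁅y⁆⇒x≡y (g y) p))
  ... | inj₂ p = there (index xs p)
  go : ∀ xs → Unique xs → ∣ ⋃ (map (λ i → ⁅ g i ⁆) xs) ∣ ≡ length xs
  go []       []        = Subset.∣⊥∣≡0 n
  go (x ∷ xs) (x∉ ∷ uq) = trans (∣⁅x⁆∪p∣ (g x) _ λ v∈ → All.lookup x∉ (index xs v∈) refl) (cong suc (go xs uq))

elements : ∀ {n} (e : Subset n) → Vec (Fin n) ∣ e ∣
elements []            = []
elements (outside ∷ e) = Vec.map Fin.suc (elements e)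
elements (inside  ∷ e) = Fin.zero ∷ Vec.map Fin.suc (elements e)

elements-∈ : ∀ {n} (e : Subset n) l → Vec.lookup (elements e) l ∈ˢ e
elements-∈ (outside ∷ e) l           = subst (_∈ˢ outside ∷ e) (sym (Vec.lookup-map l Fin.suc (elements e))) (there (elements-∈ e l))
elements-∈ (inside  ∷ e) Fin.zero    = here
elements-∈ (inside  ∷ e) (Fin.suc l) = subst (_∈ˢ inside ∷ e) (sym (Vec.lookup-map l Fin.suc (elements e))) (there (elements-∈ e l))

elements-complete : ∀ {n} (e : Subset n) {v} → v ∈ˢ e → ∃ λ l → Vec.lookup (elements e) l ≡ v
elements-complete (inside  ∷ e) here = Fin.zero , refl
elements-complete (outside ∷ e) (there v∈) with elements-complete e v∈
... | l , eq = l , trans (Vec.lookup-map l Fin.suc (elements e)) (cong Fin.suc eq)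
elements-complete (inside  ∷ e) (there v∈) with elements-complete e v∈
... | l , eq = Fin.suc l , trans (Vec.lookup-map l Fin.suc (elements e)) (cong Fin.suc eq)

InjectiveTuple : ∀ {n r} → Vec (Fin n) r → Set
InjectiveTuple t = ∀ {l l'} → Vec.lookup t l ≡ Vec.lookup t l' → l ≡ l'

elements-injective : ∀ {n} (e : Subset n) → InjectiveTuple (elements e)
elements-injective (outside ∷ e) {l} {l'} eq = elements-injective e (Fin.suc-injective
  (trans (sym (Vec.lookup-map l Fin.suc (elements e))) (trans eq (Vec.lookup-map l' Fin.suc (elements e)))))
elements-injective (inside ∷ e) {Fin.zero}  {Fin.zero}   eq = refl
elements-injective (inside ∷ e) {Fin.zero}  {Fin.suc l'} eq = contradiction (trans eq (Vec.lookup-map l' Fin.suc (elements e))) λ ()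
elements-injective (inside ∷ e) {Fin.suc l} {Fin.zero}   eq = contradiction (trans (sym eq) (Vec.lookup-map l Fin.suc (elements e))) λ ()
elements-injective (inside ∷ e) {Fin.suc l} {Fin.suc l'} eq = cong Fin.suc (elements-injective e (Fin.suc-injective
  (trans (sym (Vec.lookup-map l Fin.suc (elements e))) (trans eq (Vec.lookup-map l' Fin.suc (elements e))))))

edgeOf : ∀ {n r} → Vec (Fin n) r → Subset n
edgeOf t = vertexSet (Vec.lookup t)

edge-tuple : ∀ {n r} (e : Subset n) → ∣ e ∣ ≡ r → ∃ λ (t : Vec (Fin n) r) → edgeOf t ≡ e × InjectiveTuple t
edge-tuple e refl = elements e , Subset.⊆-antisym
    (λ v∈ → let l , eq = ∈-vertexSet⁻ (Vec.lookup (elements e)) v∈ in subst (_∈ˢ e) (sym eq) (elements-∈ e l))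
    (λ v∈ → let l , eq = elements-complete e v∈ in subst (_∈ˢ edgeOf (elements e)) eq (∈-vertexSet⁺ (Vec.lookup (elements e)) l)) ,
  elements-injective e

edge-tuples : ∀ {n r} (es : List (Subset n)) → All (λ e → ∣ e ∣ ≡ r) es →
              ∃ λ (T : List (Vec (Fin n) r)) → map edgeOf T ≡ es × All InjectiveTuple T
edge-tuples []       []       = [] , refl , []
edge-tuples (e ∷ es) (p ∷ ps) =
  let t , t≡ , inj = edge-tuple e p
      T , T≡ , injs = edge-tuples es ps
  in t ∷ T , cong₂ _∷_ t≡ T≡ , inj ∷ injs

tuple-degree : ∀ {n r} (T : List (Vec (Fin n) r)) v l → # (λ t → Vec.lookup t l Fin.≟ v) T ≤ degIn (map edgeOf T) v
tuple-degree []      v l = z≤n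
tuple-degree (t ∷ T) v l with Vec.lookup t l Fin.≟ v | v Subset.∈? edgeOf t
... | yes eq | no v∉ = contradiction (subst (_∈ˢ edgeOf t) eq (∈-vertexSet⁺ (Vec.lookup t) l)) v∉
... | yes eq | yes _ = s≤s (tuple-degree T v l)
... | no _   | yes _ = ℕ.m≤n⇒m≤1+n (tuple-degree T v l)
... | no _   | no _  = tuple-degree T v l

-- Aligning the edges

argmax : ∀ {m} (h : Fin (suc m) → ℕ) → ∃ λ i → ∀ j → h j ≤ h i
argmax {zero}  h = Fin.zero , λ { Fin.zero → ℕ.≤-refl }
argmax {suc m} h with argmax (h ∘ Fin.suc)
... | i , max with h (Fin.suc i) ≤? h Fin.zero
...   | yes le = Fin.zero , λ { Fin.zero → ℕ.≤-refl ; (Fin.suc j) → ℕ.≤-trans (max j) le }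
...   | no nle = Fin.suc i , λ { Fin.zero → ℕ.<⇒≤ (ℕ.≰⇒> nle) ; (Fin.suc j) → max j }

injective⇒surjective : ∀ {r} (f : Fin r → Fin r) → (∀ {i j} → f i ≡ f j → i ≡ j) → ∀ l → ∃ λ j → f j ≡ l
injective⇒surjective {r} f inj l with Fin.any? (λ j → f j Fin.≟ l)
... | yes p = p
... | no none = contradiction (begin
    suc r ≡⟨ cong suc (sym (trans (List.length-map f (allFin r)) (length-allFin r))) ⟩
    suc (length (map f (allFin r))) ≤⟨ unique⊆⇒length≤ {ys = allFin r} (fresh-l ∷ Unique.map⁺ inj (Unique.allFin⁺ r)) (λ x _ → ∈.∈-allFin x) ⟩
    length (allFin r) ≡⟨ length-allFin r ⟩
    r ∎) ℕ.1+n≰n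
  where
  open ℕ.≤-Reasoning
  fresh-l : All (l ≢_) (map f (allFin r))
  fresh-l = All.tabulate λ x∈ l≡x → let j , _ , eq = ∈.∈-map⁻ f x∈ in none (j , sym (trans l≡x eq))

module Partition {n r : ℕ} (0<r : 0 < r) (T : List (Vec (Fin n) r)) (T-inj : All InjectiveTuple T) where

  -- The smallest number of colours that `good-colouring` admits for colour classes of size 1 and at
  -- most `r * r` conflicts in each edge.
  palette : ℕ
  palette = 2 * (1 * (r * r))

  private
    0<rr : 0 < 1 * (r * r)
    0<rr = subst (0 <_) (sym (ℕ.*-identityˡ (r * r))) (ℕ.*-mono-< 0<r 0<r)

    0<palette : 0 < palette
    0<palette = ℕ.<-≤-trans 0<rr (ℕ.m≤m+n _ _)

    classes : ∀ κ → # (λ c → id c Fin.≟ κ) (allFin palette) ≤ 1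
    classes κ = #≤1 (λ c → c Fin.≟ κ) (Unique.allFin⁺ palette) λ x y _ _ x≡ y≡ → trans x≡ (sym y≡)

    others : Fin r → List (Fin r)
    others l = filter (λ l' → ¬? (l Fin.≟ l')) (allFin r)

    pairsAt : Vec (Fin n) r → Fin r → List (Fin n × Fin n)
    pairsAt t l = map (λ l' → Vec.lookup t l , Vec.lookup t l') (others l)

    pairs : Vec (Fin n) r → List (Fin n × Fin n)
    pairs t = concatMap (pairsAt t) (allFin r)

    ∈-pairs : ∀ t {l l'} → l ≢ l' → (Vec.lookup t l , Vec.lookup t l') ∈ pairs t
    ∈-pairs t {l} {l'} l≢l' = ∈.∈-concatMap⁺ (pairsAt t)
      (Any.map (λ { refl → ∈.∈-map⁺ (λ l' → Vec.lookup t l , Vec.lookup t l')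
        (∈.∈-filter⁺ (λ l' → ¬? (l Fin.≟ l')) (∈.∈-allFin l') l≢l') }) (∈.∈-allFin l))

    pairs-≢ : All (λ p → proj₁ p ≢ proj₂ p) (concatMap pairs T)
    pairs-≢ = All.tabulate λ p∈ →
      let t , t∈ , p∈t = find (∈.∈-concatMap⁻ pairs {xs = T} p∈)
          l , _ , p∈l = find (∈.∈-concatMap⁻ (pairsAt t) {xs = allFin r} p∈t)
          l' , l'∈ , eq = ∈.∈-map⁻ (λ l' → Vec.lookup t l , Vec.lookup t l') p∈l
      in subst (λ p → proj₁ p ≢ proj₂ p) (sym eq) λ same →
           proj₂ (∈.∈-filter⁻ (λ l' → ¬? (l Fin.≟ l')) {xs = allFin r} l'∈) (All.lookup T-inj t∈ same)

    few : ∀ t → t ∈ T → length (pairs t) ≤ r * r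
    few t _ = begin
      length (pairs t) ≡⟨ length-concatMap (pairsAt t) (allFin r) ⟩
      ∑ (allFin r) (λ l → length (pairsAt t l)) ≤⟨ ∑-mono-≤ (allFin r) (λ l _ → ℕ.≤-trans
          (ℕ.≤-reflexive (List.length-map (λ l' → Vec.lookup t l , Vec.lookup t l') (others l)))
          (ℕ.≤-trans (List.length-filter (λ l' → ¬? (l Fin.≟ l')) (allFin r)) (ℕ.≤-reflexive (length-allFin r)))) ⟩
      ∑ (allFin r) (λ _ → r) ≡⟨ trans (∑-const (allFin r) r) (cong (_* r) (length-allFin r)) ⟩
      r * r ∎
      where open ℕ.≤-Reasoning

    coloured = good-colouring id 0<palette classes pairs (r * r) T pairs-≢ few 0<rr ℕ.≤-refl

  colour : Fin n → Fin palette
  colour = proj₁ coloured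

  private
    rainbow? : ∀ t → Dec (bad id 0<palette classes pairs colour t ≡ 0)
    rainbow? = good? id 0<palette classes pairs colour

    pattern-key : Vec (Fin n) r → Fin (palette ^ r)
    pattern-key t = funToFin (λ l → colour (Vec.lookup t l))

    popular-pattern = popular (ℕ.m^n>0 palette {{>-nonZero 0<palette}} r) pattern-key (filter rainbow? T)

    κ = proj₁ popular-pattern
    pattern? : ∀ t → Dec (pattern-key t ≡ κ)
    pattern? t = pattern-key t Fin.≟ κ

  part-colour : Fin r → Fin palette
  part-colour = finToFun κ

  -- Rainbow tuples with one common colour pattern. They form an r-partite r-graph in which the
  -- colour of a vertex reveals its position.
  aligned : List (Vec (Fin n) r)
  aligned = filter pattern? (filter rainbow? T)

  private
    aligned⁻ : ∀ {t} → t ∈ aligned → t ∈ T × bad id 0<palette classes pairs colour t ≡ 0 × pattern-key t ≡ κ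
    aligned⁻ t∈ = let t∈' , eq = ∈.∈-filter⁻ pattern? {xs = filter rainbow? T} t∈
                      t∈T , ok = ∈.∈-filter⁻ rainbow? {xs = T} t∈'
                  in t∈T , ok , eq

  aligned⊆T : ∀ {t} → t ∈ aligned → t ∈ T
  aligned⊆T t∈ = proj₁ (aligned⁻ t∈)

  aligned-unique : Unique T → Unique aligned
  aligned-unique u = Unique.filter⁺ pattern? (Unique.filter⁺ rainbow? u)

  aligned-colour : ∀ {t} → t ∈ aligned → ∀ l → colour (Vec.lookup t l) ≡ part-colour l
  aligned-colour {t} t∈ l = trans (sym (Fin.finToFun-funToFin (λ l → colour (Vec.lookup t l)) l))
    (cong (λ z → finToFun {palette} {r} z l) (proj₂ (proj₂ (aligned⁻ t∈))))

  part-colour-injective : ∀ {t} → t ∈ aligned → ∀ {l l'} → part-colour l ≡ part-colour l' → l ≡ l'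
  part-colour-injective {t} t∈ {l} {l'} eq = decidable-stable (l Fin.≟ l') λ l≢ → contradiction (sym (proj₁ (proj₂ (aligned⁻ t∈)))) (ℕ.<⇒≢ (∈.∈-length
      (∈.∈-filter⁺ (clash? id 0<palette classes colour) (∈-pairs t l≢)
        (trans (aligned-colour t∈ l) (trans eq (sym (aligned-colour t∈ l')))))))

  aligned-degree : ∀ v l → # (λ t → Vec.lookup t l Fin.≟ v) aligned ≤ # (λ t → Vec.lookup t l Fin.≟ v) T
  aligned-degree v l = ℕ.≤-trans (#-filter-≤ (λ t → Vec.lookup t l Fin.≟ v) pattern? (filter rainbow? T))
                                 (#-filter-≤ (λ t → Vec.lookup t l Fin.≟ v) rainbow? T)

  aligned-large : length T ≤ 2 * palette ^ r * length aligned
  aligned-large = ℕ.≤-trans (proj₂ coloured) (ℕ.≤-trans (ℕ.*-monoʳ-≤ 2 (proj₂ popular-pattern))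
    (ℕ.≤-reflexive (sym (ℕ.*-assoc 2 (palette ^ r) (length aligned)))))

record Aligned {n r} (T : List (Vec (Fin n) r)) : Set where
  field
    {palette}             : ℕ
    colour                : Fin n → Fin palette
    part-colour           : Fin r → Fin palette
    aligned               : List (Vec (Fin n) r)
    aligned⊆T             : ∀ {t} → t ∈ aligned → t ∈ T
    aligned-unique        : Unique T → Unique aligned
    aligned-colour        : ∀ {t} → t ∈ aligned → ∀ l → colour (Vec.lookup t l) ≡ part-colour l
    part-colour-injective : ∀ {t} → t ∈ aligned → ∀ {l l'} → part-colour l ≡ part-colour l' → l ≡ l'
    aligned-degree        : ∀ v l → # (λ t → Vec.lookup t l Fin.≟ v) aligned ≤ # (λ t → Vec.lookup t l Fin.≟ v) T
    aligned-large         : length T ≤ 2 * (2 * (1 * (r * r))) ^ r * length aligned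

  -- Colours reveal positions, so the vertex set of an edge determines its tuple.
  edgeOf-injective : ∀ {t t'} → t ∈ aligned → t' ∈ aligned → edgeOf t ≡ edgeOf t' → t ≡ t'
  edgeOf-injective {t} {t'} t∈ t'∈ eq = vec-ext λ l →
    let l' , eq' = ∈-vertexSet⁻ (Vec.lookup t') (subst (Vec.lookup t l ∈ˢ_) eq (∈-vertexSet⁺ (Vec.lookup t) l))
    in trans eq' (cong (Vec.lookup t') (part-colour-injective t∈ (trans (sym (aligned-colour t'∈ l'))
         (trans (cong colour (sym eq')) (aligned-colour t∈ l)))))

align : ∀ {n r} → 0 < r → (T : List (Vec (Fin n) r)) → All InjectiveTuple T → Aligned T
align 0<r T T-inj = record
  { colour = colour ; part-colour = part-colour ; aligned = aligned ; aligned⊆T = aligned⊆T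
  ; aligned-unique = aligned-unique ; aligned-colour = aligned-colour ; part-colour-injective = part-colour-injective
  ; aligned-degree = aligned-degree ; aligned-large = aligned-large }
  where open Partition 0<r T T-inj

-- A copy of K in terms of tuples. Its parts may occupy the positions in any order, and σ records
-- which part lies in which position.
record PositionalK {n r} (s : Fin r → ℕ) (T : List (Vec (Fin n) r)) : Set where
  field
    σ           : Fin r → Fin r
    σ-injective : ∀ {l l'} → σ l ≡ σ l' → l ≡ l'
    parts       : Vec (List (Fin n)) r
    sizes       : ∀ l → length (Vec.lookup parts l) ≡ s (σ l)
    unique      : ∀ l → Unique (Vec.lookup parts l)
    complete    : ∀ t → t ∈ tuples parts → t ∈ T

part-nonempty : ∀ {n r} {s : Fin r → ℕ} {T : List (Vec (Fin n) r)} (K : PositionalK s T) → (∀ i → 0 < s i) →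
                ∀ j → ∃ λ x → x ∈ Vec.lookup (PositionalK.parts K) j
part-nonempty K s>0 j with Vec.lookup (PositionalK.parts K) j | PositionalK.sizes K j
... | []    | eq = contradiction (subst (0 <_) (sym eq) (s>0 (PositionalK.σ K j))) λ ()
... | x ∷ _ | _  = x , here refl

module _ {r : ℕ} {s : Fin r → ℕ} where

  infixl 6 _⟦_↦_⟧
  _⟦_↦_⟧ : (∀ i → Fin (s i)) → ∀ j → Fin (s j) → ∀ i → Fin (s i)
  (c ⟦ j ↦ u ⟧) i with i Fin.≟ j
  ... | yes refl = u
  ... | no _     = c i

  ⟦↦⟧-at : ∀ c j u → (c ⟦ j ↦ u ⟧) j ≡ u
  ⟦↦⟧-at c j u with j Fin.≟ j
  ... | yes refl = refl
  ... | no neq   = contradiction refl neq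

  ⟦↦⟧-off : ∀ c j u {i} → i ≢ j → (c ⟦ j ↦ u ⟧) i ≡ c i
  ⟦↦⟧-off c j u {i} i≢ with i Fin.≟ j
  ... | yes eq = contradiction eq i≢
  ... | no _   = refl

-- All vertices of a part of K lie in the same position, because exchanging one vertex of a transversal
-- leaves only its own position free.
positional : ∀ {n r k} {s : Fin r → ℕ} (T : List (Vec (Fin n) r)) (G : List (Subset n)) →
             (colour : Fin n → Fin k) (q : Fin r → Fin k) →
             (∀ {t} → t ∈ T → ∀ l → colour (Vec.lookup t l) ≡ q l) → (∀ {t} → t ∈ T → ∀ {l l'} → q l ≡ q l' → l ≡ l') →
             (∀ {e} → e ∈ G → ∃ λ t → t ∈ T × e ≡ edgeOf t) →
             (c₀ : ∀ i → Fin (s i)) → ContainsK r s G → PositionalK s T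
positional {n} {r} {k} {s} T G colour q col q-inj from-T c₀ (ψ , ψ-inj , transversal) = record
  { σ = σ ; σ-injective = λ {l} {l'} eq → trans (sym (σ'σ l)) (trans (cong σ' eq) (σ'σ l'))
  ; parts = parts ; sizes = sizes ; unique = unique ; complete = complete }
  where
  tuple : ∀ c → ∃ λ t → t ∈ T × vertexSet (λ i → ψ (i , c i)) ≡ edgeOf t
  tuple c = from-T (transversal c)

  located : ∀ c j → ∃ λ l → ψ (j , c j) ≡ Vec.lookup (proj₁ (tuple c)) l
  located c j = ∈-vertexSet⁻ (Vec.lookup (proj₁ (tuple c)))
    (subst (ψ (j , c j) ∈ˢ_) (proj₂ (proj₂ (tuple c))) (∈-vertexSet⁺ (λ i → ψ (i , c i)) j))

  colour-located : ∀ c j → colour (ψ (j , c j)) ≡ q (proj₁ (located c j))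
  colour-located c j = trans (cong colour (proj₂ (located c j))) (col (proj₁ (proj₂ (tuple c))) _)

  pos : ∀ j → Fin (s j) → Fin r
  pos j u = proj₁ (located (c₀ ⟦ j ↦ u ⟧) j)

  colour-pos : ∀ j u → colour (ψ (j , u)) ≡ q (pos j u)
  colour-pos j u = trans (cong (λ z → colour (ψ (j , z))) (sym (⟦↦⟧-at c₀ j u))) (colour-located (c₀ ⟦ j ↦ u ⟧) j)

  at-pos : ∀ c j → Vec.lookup (proj₁ (tuple c)) (pos j (c j)) ≡ ψ (j , c j)
  at-pos c j = trans (cong (Vec.lookup (proj₁ (tuple c))) (q-inj (proj₁ (proj₂ (tuple c)))
    (trans (sym (colour-pos j (c j))) (colour-located c j)))) (sym (proj₂ (located c j)))

  pos-separates : ∀ j j' u u' → j ≢ j' → pos j u ≢ pos j' u'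
  pos-separates j j' u u' j≢ eq = j≢ (cong proj₁ (ψ-inj {j , u} {j' , u'}
      (trans (sym at-j) (trans (cong (Vec.lookup (proj₁ (tuple c))) eq) at-j'))))
    where
    c = c₀ ⟦ j ↦ u ⟧ ⟦ j' ↦ u' ⟧
    c-j : c j ≡ u
    c-j = trans (⟦↦⟧-off (c₀ ⟦ j ↦ u ⟧) j' u' j≢) (⟦↦⟧-at c₀ j u)
    c-j' : c j' ≡ u'
    c-j' = ⟦↦⟧-at (c₀ ⟦ j ↦ u ⟧) j' u'
    at-j : Vec.lookup (proj₁ (tuple c)) (pos j u) ≡ ψ (j , u)
    at-j = subst (λ z → Vec.lookup (proj₁ (tuple c)) (pos j z) ≡ ψ (j , z)) c-j (at-pos c j)
    at-j' : Vec.lookup (proj₁ (tuple c)) (pos j' u') ≡ ψ (j' , u')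
    at-j' = subst (λ z → Vec.lookup (proj₁ (tuple c)) (pos j' z) ≡ ψ (j' , z)) c-j' (at-pos c j')

  σ' : Fin r → Fin r
  σ' j = pos j (c₀ j)

  σ'-injective : ∀ {j j'} → σ' j ≡ σ' j' → j ≡ j'
  σ'-injective {j} {j'} eq = decidable-stable (j Fin.≟ j') λ j≢ → pos-separates j j' (c₀ j) (c₀ j') j≢ eq

  σ : Fin r → Fin r
  σ l = proj₁ (injective⇒surjective σ' σ'-injective l)

  σ'σ : ∀ l → σ' (σ l) ≡ l
  σ'σ l = proj₂ (injective⇒surjective σ' σ'-injective l)

  -- By surjectivity, the position of u is already taken by some part under `c₀`, and different
  -- parts never share a position.
  pos-constant : ∀ j u → pos j u ≡ σ' j
  pos-constant j u = trans (sym (σ'σ (pos j u))) (cong σ' (sym (decidable-stable (j Fin.≟ σ (pos j u)) λ neq →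
    pos-separates j (σ (pos j u)) u (c₀ (σ (pos j u))) neq (sym (σ'σ (pos j u))))))

  part : Fin r → List (Fin n)
  part l = map (λ u → ψ (σ l , u)) (allFin (s (σ l)))

  parts : Vec (List (Fin n)) r
  parts = Vec.tabulate part

  sizes : ∀ l → length (Vec.lookup parts l) ≡ s (σ l)
  sizes l = trans (cong length (Vec.lookup∘tabulate part l))
    (trans (List.length-map (λ u → ψ (σ l , u)) (allFin (s (σ l)))) (length-allFin (s (σ l))))

  unique : ∀ l → Unique (Vec.lookup parts l)
  unique l = subst Unique (sym (Vec.lookup∘tabulate part l)) (Unique.map⁺ (λ eq → second (ψ-inj eq)) (Unique.allFin⁺ (s (σ l))))
    where
    second : ∀ {u u' : Fin (s (σ l))} → (σ l , u) ≡ (σ l , u') → u ≡ u'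
    second refl = refl

  complete : ∀ t → t ∈ tuples parts → t ∈ T
  complete t t∈ = subst (_∈ T) (vec-ext same) (proj₁ (proj₂ (tuple c)))
    where
    preimage : ∀ i → ∃ λ u → Vec.lookup t (σ' i) ≡ ψ (i , u)
    preimage i = subst (λ z → ∃ λ u → Vec.lookup t (σ' i) ≡ ψ (z , u)) (σ'-injective (σ'σ (σ' i)))
      (let u , _ , eq = ∈.∈-map⁻ (λ u → ψ (σ (σ' i) , u)) (subst (Vec.lookup t (σ' i) ∈_) (Vec.lookup∘tabulate part (σ' i)) (∈-tuples⁻ parts t∈ (σ' i)))
       in u , eq)
    c : ∀ i → Fin (s i)
    c i = proj₁ (preimage i)
    same : ∀ l → Vec.lookup (proj₁ (tuple c)) l ≡ Vec.lookup t l
    same l = subst (λ z → Vec.lookup (proj₁ (tuple c)) z ≡ Vec.lookup t z) (σ'σ l)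
      (trans (cong (Vec.lookup (proj₁ (tuple c))) (sym (pos-constant (σ l) (c (σ l))))) (trans (at-pos c (σ l)) (sym (proj₂ (preimage (σ l))))))

product-tabulate : ∀ {A : Set} {i} (g : Fin i → List A) → product (Vec.map length (Vec.tabulate g)) ≡ ∏ (allFin i) (length ∘ g)
product-tabulate {A} {i} g = go i id g (λ _ → refl)
  where
  go : ∀ m {M} (f : Fin m → Fin M) {g'} (g : Fin m → List A) → (∀ l → length (g l) ≡ g' (f l)) →
       product (Vec.map length (Vec.tabulate g)) ≡ ∏ (Data.List.tabulate f) g'
  go zero    f g h = refl
  go (suc m) f g h = cong₂ _*_ (h Fin.zero) (go m (f ∘ Fin.suc) (g ∘ Fin.suc) (h ∘ Fin.suc))

module _ {n r' i' p : ℕ} {s : Fin (suc r') → ℕ} (s-mono : ∀ i j → i Data.Fin.≤ j → s i ≤ s j) (s-pos : ∀ i → 0 < s i)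
         {ι : Fin (suc i') → Fin (suc r')} (ι-injective : ∀ {a b} → ι a ≡ ι b → a ≡ b)
         (large : suc (bound (suc i') (partial (ext s) i')) ≤ ext s i')
         (scheme : ColourScheme p (suc i') (partial (ext s) i') (bound (suc i') (partial (ext s) i'))) where

  private
    u = ext s
    u-mono : ∀ {i j} → i ≤ j → u i ≤ u j
    u-mono = mono u (ext-suc s s-mono)

  -- Among the i' + 1 low positions let `l₀` carry the part that comes last in the order of s. Its
  -- index is at least i', so its size exceeds the bound; the other i' parts have at least the
  -- product of the i' smallest sizes as their product, which supplies the required contexts.
  no-positional-K : ∀ {E} (sel : Selection.Selected {n} scheme ι E) → ¬ PositionalK s (Selection.Selected.chosen sel)
  no-positional-K sel K = ℕ.<⇒≱ big (no-complete-part sel ι-injective parts unique complete root root∈ l₀ enough)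
    where
    open Selection {n} scheme ι
    open PositionalK K
    τ : Fin (suc i') → ℕ
    τ l = toℕ (σ (ι l))
    l₀ = proj₁ (argmax τ)
    τ-injective : ∀ {l l'} → τ l ≡ τ l' → l ≡ l'
    τ-injective eq = ι-injective (σ-injective (Fin.toℕ-injective eq))
    size : ∀ l → length (Vec.lookup parts (ι l)) ≡ u (τ l)
    size l = trans (sizes (ι l)) (sym (ext-toℕ s (σ (ι l))))
    i'≤max : i' ≤ τ l₀
    i'≤max = ℕ.≤-pred (begin
      suc i' ≡⟨ sym (trans (List.length-map τ (allFin (suc i'))) (length-allFin (suc i'))) ⟩
      length (map τ (allFin (suc i'))) ≤⟨ unique⊆⇒length≤ (Unique.map⁺ τ-injective (Unique.allFin⁺ (suc i')))
                                                   (λ x x∈ → let l , _ , eq = ∈.∈-map⁻ τ x∈ in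
                                                     ∈.∈-upTo⁺ (s≤s (subst (_≤ τ l₀) (sym eq) (proj₂ (argmax τ) l)))) ⟩
      length (upTo (suc (τ l₀))) ≡⟨ List.length-upTo (suc (τ l₀)) ⟩
      suc (τ l₀) ∎)
      where open ℕ.≤-Reasoning
    big : bound (suc i') (partial u i') < length (Vec.lookup parts (ι l₀))
    big = ℕ.≤-trans large (ℕ.≤-trans (u-mono i'≤max) (ℕ.≤-reflexive (sym (size l₀))))
    root : Fin (suc r') → Fin n
    root j = proj₁ (part-nonempty K s-pos j)
    root∈ : ∀ j → root j ∈ Vec.lookup parts j
    root∈ j = proj₂ (part-nonempty K s-pos j)
    cparts : Fin (suc i') → List (Fin n)
    cparts = (λ l → Vec.lookup parts (ι l)) [ l₀ ↦ root (ι l₀) ∷ [] ]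
    off? : ∀ l → Dec (l ≢ l₀)
    off? l = ¬? (l Fin.≟ l₀)
    rest = filter off? (allFin (suc i'))
    rest-length : length rest ≡ i'
    rest-length = ℕ.suc-injective (sym (trans (sym (length-allFin (suc i')))
      (trans (#-split (Fin._≟ l₀) (allFin (suc i'))) (cong (_+ length rest)
        (#-unique (Fin._≟ l₀) (Unique.allFin⁺ (suc i')) (∈.∈-allFin l₀) refl (λ _ _ eq → eq))))))
    enough : partial u i' ≤ product (Vec.map length (Vec.tabulate cparts))
    enough = begin
      partial u i' ≡⟨ cong (partial u) (sym (trans (List.length-map τ rest) rest-length)) ⟩
      partial u (length (map τ rest)) ≤⟨ partial-minimal u u-mono (suc r') (map τ rest)
                                                     (Unique.map⁺ τ-injective (Unique.filter⁺ off? (Unique.allFin⁺ (suc i'))))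
                                                     (All.tabulate λ x∈ → let l , _ , eq = ∈.∈-map⁻ τ x∈ in subst (_< suc r') (sym eq) (Fin.toℕ<n (σ (ι l)))) ⟩
      ∏ (map τ rest) u ≡⟨ ∏-map rest ⟩
      ∏ rest (u ∘ τ) ≡⟨ ∏-cong∈ rest (λ l l∈ → sym (trans
                                                     (cong length ([↦]-off (λ l → Vec.lookup parts (ι l)) l₀ (root (ι l₀) ∷ []) l (proj₂ (∈.∈-filter⁻ off? {xs = allFin (suc i')} l∈)))) (size l))) ⟩
      ∏ rest (length ∘ cparts) ≡⟨ sym (∏-filter off? (allFin (suc i')) (λ l _ ¬off → one l ¬off)) ⟩
      ∏ (allFin (suc i')) (length ∘ cparts) ≡⟨ sym (product-tabulate cparts) ⟩
      product (Vec.map length (Vec.tabulate cparts)) ∎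
      where
      open ℕ.≤-Reasoning
      ∏-map : ∀ xs → ∏ (map τ xs) u ≡ ∏ xs (u ∘ τ)
      ∏-map []       = refl
      ∏-map (x ∷ xs) = cong (u (τ x) *_) (∏-map xs)
      one : ∀ l → ¬ (l ≢ l₀) → length (cparts l) ≡ 1
      one l ¬off with l Fin.≟ l₀
      ... | yes refl = refl
      ... | no neq   = contradiction neq ¬off

open import Defs

-- The lower bound

∈-map-unique : ∀ {A B : Set} (f : A → B) {xs} → (∀ {x y} → x ∈ xs → y ∈ xs → f x ≡ f y → x ≡ y) → Unique xs → Unique (map f xs)
∈-map-unique f {[]}     inj []       = []
∈-map-unique f {x ∷ xs} inj (x∉ ∷ u) =
  All.tabulate (λ y∈ eq → let z , z∈ , y≡ = ∈.∈-map⁻ f y∈ in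
    All.lookup x∉ z∈ (inj (here refl) (there z∈) (trans eq y≡))) ∷ ∈-map-unique f (λ p q → inj (there p) (there q)) u

bound>0 : ∀ i S → 0 < bound i S
bound>0 i S = nonempty (dim i S * _)
  where
  nonempty : ∀ {L : Set} {ls : List L} m → 0 < length (wordsUpTo ls m)
  nonempty zero    = s≤s z≤n
  nonempty (suc m) = s≤s z≤n

^-cancelˡ-≤ : ∀ {x y} k → x ^ suc k ≤ y ^ suc k → x ≤ y
^-cancelˡ-≤ {x} {y} k le with x ≤? y
... | yes p = p
... | no ¬p = contradiction le (ℕ.<⇒≱ (ℕ.^-monoˡ-< (suc k) (ℕ.≰⇒> ¬p)))

-- Any sufficiently fast growing function works; this one exceeds bound (suc j) S for all S ≤ x ^ j.
growth : ℕ → ℕ → ℕ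
growth j x = ∑ (upTo (suc (x ^ j))) (λ S → suc (bound (suc j) S))

module LowerBound (r' : ℕ) (0<r' : 0 < r') (s : Fin (suc r') → ℕ) (valid : ValidS s)
                  (grows : ∀ (i j : Fin (suc r')) → toℕ j ≡ suc (toℕ i) → growth (toℕ j) (s i) ≤ s j) where
  r A : ℕ
  r = suc r'
  A = sumA s

  u a : ℕ → ℕ
  u = ext s
  a = partial u

  s>0 : ∀ i → 0 < s i
  s>0 i = ℕ.<-trans (s≤s z≤n) (proj₁ valid i)

  u>0 : ∀ j → 0 < u j
  u>0 = ext-all {P = 0 <_} s s>0

  -- The growth condition sees only the preceding size. By monotonicity `a (suc k)` is at most the
  -- (suc k)-th power of that size, so the required bound is one summand of `growth`.
  large : ∀ k → k < r' → suc (bound (suc (suc k)) (a (suc k))) ≤ u (suc k)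
  large k k<r' = begin
    suc (bound (suc (suc k)) (a (suc k)))
      ≤⟨ ∑-term (λ S → suc (bound (suc (suc k)) S)) (∈.∈-upTo⁺ (s≤s (partial-≤ u (ext-suc s (proj₂ valid)) k))) ⟩
    growth (suc k) (u k)
      ≡⟨ cong₂ growth (sym j≡) (trans (cong u (sym i≡)) (ext-toℕ s i)) ⟩
    growth (toℕ j) (s i)
      ≤⟨ grows i j (trans j≡ (cong suc (sym i≡))) ⟩
    s j
      ≡⟨ trans (sym (ext-toℕ s j)) (cong u j≡) ⟩
    u (suc k) ∎
    where
    open ℕ.≤-Reasoning
    i j : Fin r
    i = fromℕ< (ℕ.m≤n⇒m≤1+n k<r')
    j = fromℕ< (s≤s k<r')
    i≡ : toℕ i ≡ k
    i≡ = Fin.toℕ-fromℕ< (ℕ.m≤n⇒m≤1+n k<r')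
    j≡ : toℕ j ≡ suc k
    j≡ = Fin.toℕ-fromℕ< (s≤s k<r')

  -- The thresholds are chosen so that their exponents a₂, ..., a_r add up to A; this is how A
  -- enters the lower bound.
  ways-power : ∀ {n} (T : List (Vec (Fin n) r)) (T-unique : Unique T) Δ
               (degree : ∀ v l → # (λ t → Vec.lookup t l Fin.≟ v) T ≤ Δ) m →
               Regularisation.ways T T-unique Δ degree (λ k → m ^ a k) r' ≡ m ^ A
  ways-power T T-unique Δ degree m = trans (go r') (cong (m ^_) (sym (sumA≡∑ s)))
    where
    open Regularisation T T-unique Δ degree (λ k → m ^ a k)
    go : ∀ k → ways k ≡ m ^ ∑ (upTo k) (λ j → a (suc j))
    go zero    = refl
    go (suc k) = trans (cong (m ^ a (suc k) *_) (go k)) (trans (sym (ℕ.^-distribˡ-+-* m (a (suc k)) (∑ (upTo k) (λ j → a (suc j)))))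
      (cong (m ^_) (trans (ℕ.+-comm (a (suc k)) _) (sym (∑-upTo-suc k (λ j → a (suc j)))))))

  positional-member : ∀ {n} {T : List (Vec (Fin n) r)} → PositionalK s T → ∃ λ t → t ∈ T
  positional-member K = t , complete t (∈-tuples⁺ parts t λ l → subst (_∈ Vec.lookup parts l) (sym (Vec.lookup∘tabulate (λ l → proj₁ (part-nonempty K s>0 l)) l)) (proj₂ (part-nonempty K s>0 l)))
    where
    open PositionalK K
    t = Vec.tabulate (λ l → proj₁ (part-nonempty K s>0 l))

  module _ (m P : ℕ) (P-prime : Prime P) (0<m : 0 < m)
           (dim≤P : ∀ k → k < r' → dim (suc (suc k)) (a (suc k)) ≤ P)
           (enough : ∀ k → k < r' → 2 * (bound (suc (suc k)) (a (suc k)) * (suc (suc k) * m ^ a (suc k))) ≤ P ^ a (suc k)) where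

    private
      0<P : 0 < P
      0<P = >-nonZero⁻¹ P {{prime⇒nonZero P-prime}}

    K-free-tuples : ∀ {n} (T : List (Vec (Fin n) r)) → Unique T → ∀ Δ →
                    (∀ v l → # (λ t → Vec.lookup t l Fin.≟ v) T ≤ Δ) → r * Δ < m ^ A →
                    ∃ λ T' → Unique T' × (∀ t → t ∈ T' → t ∈ T) ×
                      length T ≤ r' * r ^ r * (2 * P * length T') × ¬ PositionalK s T'
    K-free-tuples {n} T T-unique Δ degree big =
      let open Regularisation T T-unique Δ degree (λ k → m ^ a k)
          k , k<r' , ι , E , E-unique , E⊆T , many , low =
            regular-part 0<r' (subst (r * Δ <_) (sym (ways-power T T-unique Δ degree m)) big)
      in finish k k<r' ι E E-unique E⊆T many low
      where
      finish : ∀ k → k < r' → ∀ (ι : Fin (suc (suc k)) → Fin r) E → Unique E → (∀ e → e ∈ E → e ∈ T) →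
               length T ≤ r' * r ^ r * length E →
               (∀ e → e ∈ E → (∀ {b c} → ι b ≡ ι c → b ≡ c) × (∀ l → codegree E (ι l) e ≤ m ^ a (suc k))) →
               ∃ λ T' → Unique T' × (∀ t → t ∈ T' → t ∈ T) ×
                 length T ≤ r' * r ^ r * (2 * P * length T') × ¬ PositionalK s T'
      finish k k<r' ι E E-unique E⊆T many low =
        chosen , chosen-unique , (λ t t∈ → E⊆T t (subset t t∈)) , ℕ.≤-trans many (ℕ.*-monoʳ-≤ (r' * r ^ r) large-selection) ,
        -- `Low` gives the injectivity of ι only at an edge of E, and the copy of K provides such an
        -- edge.
        λ K → let t , t∈ = positional-member K in
          no-positional-K (proj₂ valid) s>0 (proj₁ (low t (subset t t∈))) (large k k<r') scheme sel K
        where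
        S = a (suc k)
        B = bound (suc (suc k)) S
        scheme : ColourScheme P (suc (suc k)) S B
        scheme = prime-scheme (suc (suc k)) S P-prime (dim≤P k k<r')
        open ColourScheme scheme using (colours; many-colours)
        0<τ : 0 < m ^ S
        0<τ = ℕ.m^n>0 m {{>-nonZero 0<m}} S
        sel : Selection.Selected {n} scheme ι E
        sel = Selection.select {n} scheme ι 0<P
          (ℕ.<-≤-trans (ℕ.m^n>0 P {{>-nonZero 0<P}} S) many-colours) E E-unique (m ^ S)
          (λ e e∈ → proj₂ (low e e∈))
          (ℕ.*-mono-< (bound>0 (suc (suc k)) S) (ℕ.*-mono-< {0} {suc (suc k)} {0} (s≤s z≤n) 0<τ))
          (ℕ.≤-trans (enough k k<r') many-colours)
        open Selection.Selected sel using (chosen; chosen-unique; subset) renaming (large to large-selection)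

    module _ (H : RGraph r) (T : List (Vec (Fin (n H)) r)) (T≡ : map edgeOf T ≡ edges H)
             (al : Aligned T) (T' : List (Vec (Fin (n H)) r)) (T'-unique : Unique T')
             (T'⊆aligned : ∀ t → t ∈ T' → t ∈ Aligned.aligned al) (T'-free : ¬ PositionalK s T') where

      private
        open Aligned

        in-T'? : ∀ x → Dec (x ∈ map edgeOf T')
        in-T'? x = DecMem._∈?_ _≟ˢ_ x (map edgeOf T')

      -- Obtained by filtering `edges H`, since `KFreeSub` asks for a sublist, in the order of H.
      kept : List (Subset (n H))
      kept = filter in-T'? (edges H)

      kept-free : KFreeSub s H kept
      kept-free = Sublist.filter-⊆ in-T'? (edges H) , λ K → T'-free (positional T' kept (colour al) (part-colour al)
        (λ {t} t∈ → aligned-colour al (T'⊆aligned t t∈)) (λ {t} t∈ → part-colour-injective al (T'⊆aligned t t∈))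
        (λ x∈ → ∈.∈-map⁻ edgeOf (proj₂ (∈.∈-filter⁻ in-T'? {xs = edges H} x∈)))
        (λ i → fromℕ< (s>0 i)) K)

      kept-large : length T' ≤ length kept
      kept-large = subst (_≤ length kept) (List.length-map edgeOf T')
        (unique⊆⇒length≤ (∈-map-unique edgeOf (λ {t} {t'} p q → edgeOf-injective al (T'⊆aligned t p) (T'⊆aligned t' q)) T'-unique)
          λ x x∈ → ∈.∈-filter⁺ in-T'? (up x∈) x∈)
        where
        up : ∀ {x} → x ∈ map edgeOf T' → x ∈ edges H
        up {x} x∈ = let t , t∈ , eq = ∈.∈-map⁻ edgeOf x∈ in
          subst (x ∈_) T≡ (subst (_∈ map edgeOf T) (sym eq) (∈.∈-map⁺ edgeOf (aligned⊆T al (T'⊆aligned t t∈))))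

    K-free-subgraph : ∀ (H : RGraph r) Δ → (∀ v → deg H v ≤ Δ) → r * Δ < m ^ A →
                      ∃ λ G → KFreeSub s H G × e H ≤ 2 * (2 * (1 * (r * r))) ^ r * (r' * r ^ r * (2 * P * length G))
    K-free-subgraph H Δ deg≤Δ big =
      let T , T≡ , T-inj = edge-tuples (edges H) (uniform H)
      in go T T≡ (align (s≤s z≤n) T T-inj)
      where
      go : ∀ (T : List (Vec (Fin (n H)) r)) → map edgeOf T ≡ edges H → Aligned T →
           ∃ λ G → KFreeSub s H G × e H ≤ 2 * (2 * (1 * (r * r))) ^ r * (r' * r ^ r * (2 * P * length G))
      go T T≡ al =
        let T' , T'-unique , T'⊆ , many , T'-free = K-free-tuples aligned (aligned-unique T-unique) Δ degree big
        in kept H T T≡ al T' T'-unique T'⊆ T'-free , kept-free H T T≡ al T' T'-unique T'⊆ T'-free ,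
           (begin
             length (edges H) ≡⟨ trans (cong length (sym T≡)) (List.length-map edgeOf T) ⟩
             length T ≤⟨ aligned-large ⟩
             K₁ * length aligned ≤⟨ ℕ.*-monoʳ-≤ K₁ many ⟩
             K₁ * (r' * r ^ r * (2 * P * length T')) ≤⟨ ℕ.*-monoʳ-≤ K₁ (ℕ.*-monoʳ-≤ (r' * r ^ r) (ℕ.*-monoʳ-≤ (2 * P)
                                                  (kept-large H T T≡ al T' T'-unique T'⊆ T'-free))) ⟩
             K₁ * (r' * r ^ r * (2 * P * length (kept H T T≡ al T' T'-unique T'⊆ T'-free))) ∎)
        where
        open ℕ.≤-Reasoning
        open Aligned al
        K₁ = 2 * (2 * (1 * (r * r))) ^ r
        T-unique : Unique T
        T-unique = AllPairs.map (λ neq eq → neq (cong edgeOf eq)) (AllPairs.map⁻ (subst Unique (sym T≡) (unique H)))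
        degree : ∀ v l → # (λ t → Vec.lookup t l Fin.≟ v) aligned ≤ Δ
        degree v l = ℕ.≤-trans (aligned-degree v l)
          (ℕ.≤-trans (tuple-degree T v l) (subst (λ es → degIn es v ≤ Δ) (sym T≡) (deg≤Δ v)))

  0<A : 0 < A
  0<A = sumA>0 s 0<r' s>0

  -- What c must dominate at each level: the first summand makes the colours outnumber the
  -- conflicts, the second makes the field large enough for distinct Vandermonde nodes.
  demand : ℕ → ℕ
  demand k = 2 * (bound (suc (suc k)) (a (suc k)) * suc (suc k)) + dim (suc (suc k)) (a (suc k))

  -- K collects the constant losses: aligning the edges, choosing a round and its low positions, and
  -- discarding the half of the edges with clashes.
  c K : ℕ
  c = suc (∑ (upTo r') demand)
  K = 2 * (2 * (1 * (r * r))) ^ r * (r' * r ^ r) * 2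

  module _ (q : ℕ) where

    -- In Δ₀ the first summand makes m large enough for `prime-near q`; the second lets a single
    -- factor Δ absorb all constants.
    C₂ Δ₀ : ℕ
    C₂ = K ^ (A * q * suc q) * ((c * 2) ^ A * r) ^ (suc (suc q) * q)
    Δ₀ = suc (proj₁ (prime-near q) ^ A + C₂)

    -- With m ≈ (r Δ)^(1/A) and a prime P ≥ c m, P^(q+1) ≤ (c m)^(q+2), the loss K P is at most Δ^(1/A + 1/q) for large Δ.
    loss : ∀ Δ m P → Δ₀ ≤ Δ → m ^ A ≤ 2 ^ A * (r * Δ) → P ^ suc q ≤ (c * m) ^ suc (suc q) → (K * P) ^ (A * q) ≤ Δ ^ (q + A)
    loss Δ m P Δ₀≤Δ m≤ P≤ = ^-cancelˡ-≤ q (begin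
      ((K * P) ^ (A * q)) ^ suc q ≡⟨ ℕ.^-*-assoc (K * P) (A * q) (suc q) ⟩
      (K * P) ^ (A * q * suc q) ≡⟨ ^-distribʳ-* (A * q * suc q) K P ⟩
      K ^ (A * q * suc q) * P ^ (A * q * suc q) ≤⟨ ℕ.*-monoʳ-≤ (K ^ (A * q * suc q)) P-bound ⟩
      K ^ (A * q * suc q) * (((c * 2) ^ A * r) ^ N * Δ ^ N) ≡⟨ sym (ℕ.*-assoc (K ^ (A * q * suc q)) _ _) ⟩
      C₂ * Δ ^ N ≤⟨ ℕ.*-monoˡ-≤ (Δ ^ N) (ℕ.≤-trans (ℕ.m≤n⇒m≤1+n (ℕ.m≤n+m C₂ _)) Δ₀≤Δ) ⟩
      Δ ^ suc N ≤⟨ ℕ.^-monoʳ-≤ Δ {{>-nonZero 0<Δ}} exponent ⟩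
      Δ ^ ((q + A) * suc q) ≡⟨ sym (ℕ.^-*-assoc Δ (q + A) (suc q)) ⟩
      (Δ ^ (q + A)) ^ suc q ∎)
      where
      open ℕ.≤-Reasoning
      open +-*-Solver
      N = suc (suc q) * q
      0<Δ : 0 < Δ
      0<Δ = ℕ.<-≤-trans (s≤s z≤n) Δ₀≤Δ
      exponent : suc N ≤ (q + A) * suc q
      exponent = begin
        suc (suc (suc q) * q) ≡⟨ solve 1 (λ q → con 1 :+ (con 2 :+ q) :* q := q :* (con 1 :+ q) :+ (q :+ con 1)) refl q ⟩
        q * suc q + (q + 1) ≡⟨ cong (q * suc q +_) (ℕ.+-comm q 1) ⟩
        q * suc q + suc q ≤⟨ ℕ.+-monoʳ-≤ (q * suc q) (ℕ.m≤n*m (suc q) A {{>-nonZero 0<A}}) ⟩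
        q * suc q + A * suc q ≡⟨ sym (ℕ.*-distribʳ-+ (suc q) q A) ⟩
        (q + A) * suc q ∎
      P-bound : P ^ (A * q * suc q) ≤ ((c * 2) ^ A * r) ^ N * Δ ^ N
      P-bound = begin
        P ^ (A * q * suc q) ≡⟨ trans (cong (P ^_) (ℕ.*-comm (A * q) (suc q))) (sym (ℕ.^-*-assoc P (suc q) (A * q))) ⟩
        (P ^ suc q) ^ (A * q) ≤⟨ ℕ.^-monoˡ-≤ (A * q) P≤ ⟩
        ((c * m) ^ suc (suc q)) ^ (A * q) ≡⟨ ℕ.^-*-assoc (c * m) (suc (suc q)) (A * q) ⟩
        (c * m) ^ (suc (suc q) * (A * q)) ≡⟨ cong ((c * m) ^_) (solve 2 (λ A q → (con 2 :+ q) :* (A :* q) := A :* ((con 2 :+ q) :* q)) refl A q) ⟩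
        (c * m) ^ (A * N) ≡⟨ sym (ℕ.^-*-assoc (c * m) A N) ⟩
        ((c * m) ^ A) ^ N ≤⟨ ℕ.^-monoˡ-≤ N cm ⟩
        ((c * 2) ^ A * r * Δ) ^ N ≡⟨ ^-distribʳ-* N ((c * 2) ^ A * r) Δ ⟩
        ((c * 2) ^ A * r) ^ N * Δ ^ N ∎
        where
        cm : (c * m) ^ A ≤ (c * 2) ^ A * r * Δ
        cm = begin
          (c * m) ^ A ≡⟨ ^-distribʳ-* A c m ⟩
          c ^ A * m ^ A ≤⟨ ℕ.*-monoʳ-≤ (c ^ A) m≤ ⟩
          c ^ A * (2 ^ A * (r * Δ)) ≡⟨ trans (sym (ℕ.*-assoc (c ^ A) (2 ^ A) (r * Δ))) (cong (_* (r * Δ)) (sym (^-distribʳ-* A c 2))) ⟩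
          (c * 2) ^ A * (r * Δ) ≡⟨ sym (ℕ.*-assoc ((c * 2) ^ A) r Δ) ⟩
          (c * 2) ^ A * r * Δ ∎

    good-subgraph : ∀ p → 1 ≤ p → ∀ Δ → Δ₀ ≤ Δ → ∀ (H : RGraph r) → MaxDegree H Δ →
      Σ (List (Subset (n H))) λ G → KFreeSub s H G × e H ^ (A * q) ≤ length G ^ (A * q) * Δ ^ (q + p * A)
    good-subgraph p 1≤p Δ Δ₀≤Δ H (deg≤Δ , _) =
      let x , x^A≤ , <x+1 = crossing (_^ A) (suc (r * Δ)) (ℕ.≤-trans (ℕ.≤-reflexive (0^n≡0 0<A)) z≤n)
                              (m≤m^n (suc (r * Δ)) 0<A)
      in build x x^A≤ <x+1
      where
      0<Δ : 0 < Δ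
      0<Δ = ℕ.<-≤-trans (s≤s z≤n) Δ₀≤Δ
      M₀ = proj₁ (prime-near q)
      build : ∀ x → x ^ A ≤ r * Δ → r * Δ < suc x ^ A →
        Σ (List (Subset (n H))) λ G → KFreeSub s H G × e H ^ (A * q) ≤ length G ^ (A * q) * Δ ^ (q + p * A)
      build zero lo hi = contradiction (subst (r * Δ <_) (ℕ.^-zeroˡ A) hi) (ℕ.≤⇒≯ (ℕ.*-mono-≤ {1} {r} (s≤s z≤n) 0<Δ))
      build x@(suc _) lo hi = G , free , (begin
        e H ^ (A * q) ≤⟨ ℕ.^-monoˡ-≤ (A * q) size ⟩
        (K₁ * (r' * r ^ r * (2 * P * length G))) ^ (A * q)
                                                  ≡⟨ cong (_^ (A * q)) (solve 4 (λ k l P g → k :* (l :* (con 2 :* P :* g)) := g :* (k :* l :* con 2 :* P)) refl K₁ (r' * r ^ r) P (length G)) ⟩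
        (length G * (K * P)) ^ (A * q) ≡⟨ ^-distribʳ-* (A * q) (length G) (K * P) ⟩
        length G ^ (A * q) * (K * P) ^ (A * q) ≤⟨ ℕ.*-monoʳ-≤ (length G ^ (A * q)) (loss Δ m P Δ₀≤Δ m≤ P≤) ⟩
        -- The case p = 1 is the strongest one; a larger p only weakens the claim.
        length G ^ (A * q) * Δ ^ (q + A) ≤⟨ ℕ.*-monoʳ-≤ (length G ^ (A * q)) (ℕ.^-monoʳ-≤ Δ {{>-nonZero 0<Δ}} (ℕ.+-monoʳ-≤ q (ℕ.m≤n*m A p {{>-nonZero 1≤p}}))) ⟩
        length G ^ (A * q) * Δ ^ (q + p * A) ∎)
        where
        open ℕ.≤-Reasoning
        open +-*-Solver
        K₁ = 2 * (2 * (1 * (r * r))) ^ r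
        -- Here x is the integer part of (r Δ)^(1/A). Adding one gives r Δ < m^A, and m ≤ 2x keeps
        -- m^A within a constant factor of r Δ.
        m = suc x
        m≤ : m ^ A ≤ 2 ^ A * (r * Δ)
        m≤ = begin
          suc x ^ A ≤⟨ ℕ.^-monoˡ-≤ A (ℕ.+-mono-≤ {1} {x} {x} {x + 0} (s≤s z≤n) (ℕ.m≤m+n x 0)) ⟩
          (2 * x) ^ A ≡⟨ ^-distribʳ-* A 2 x ⟩
          2 ^ A * x ^ A ≤⟨ ℕ.*-monoʳ-≤ (2 ^ A) lo ⟩
          2 ^ A * (r * Δ) ∎
        M₀≤m : M₀ ≤ m
        M₀≤m = ℕ.≮⇒≥ λ m<M₀ → ℕ.<⇒≱ hi (ℕ.≤-trans (ℕ.^-monoˡ-≤ A (ℕ.<⇒≤ m<M₀))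
                (ℕ.≤-trans (ℕ.m≤m+n (M₀ ^ A) C₂) (ℕ.≤-trans (ℕ.n≤1+n _) (ℕ.≤-trans Δ₀≤Δ (ℕ.m≤n*m Δ r)))))
        prime = proj₂ (prime-near q) (c * m) (ℕ.≤-trans M₀≤m (ℕ.m≤n*m m c))
        P = proj₁ prime
        P-prime = proj₁ (proj₂ prime)
        cm≤P = proj₁ (proj₂ (proj₂ prime))
        P≤ = proj₂ (proj₂ (proj₂ prime))
        demand≤c : ∀ k → k < r' → demand k ≤ c
        demand≤c k k<r' = ℕ.≤-trans (∑-term demand (∈.∈-upTo⁺ k<r')) (ℕ.n≤1+n _)
        dim≤P : ∀ k → k < r' → dim (suc (suc k)) (a (suc k)) ≤ P
        dim≤P k k<r' = ℕ.≤-trans (ℕ.m≤n+m _ (2 * (bound (suc (suc k)) (a (suc k)) * suc (suc k))))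
          (ℕ.≤-trans (demand≤c k k<r') (ℕ.≤-trans (ℕ.m≤m*n c m) cm≤P))
        enough : ∀ k → k < r' → 2 * (bound (suc (suc k)) (a (suc k)) * (suc (suc k) * m ^ a (suc k))) ≤ P ^ a (suc k)
        enough k k<r' = begin
          2 * (B * (i * m ^ S)) ≡⟨ solve 3 (λ B i τ → con 2 :* (B :* (i :* τ)) := con 2 :* (B :* i) :* τ) refl B i (m ^ S) ⟩
          2 * (B * i) * m ^ S ≤⟨ ℕ.*-monoˡ-≤ (m ^ S) (ℕ.≤-trans (ℕ.m≤m+n (2 * (B * i)) (dim i S)) (demand≤c k k<r')) ⟩
          c * m ^ S ≤⟨ ℕ.*-monoˡ-≤ (m ^ S) (m≤m^n c (partial>0 u u>0 (suc k))) ⟩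
          c ^ S * m ^ S ≡⟨ sym (^-distribʳ-* S c m) ⟩
          (c * m) ^ S ≤⟨ ℕ.^-monoˡ-≤ S cm≤P ⟩
          P ^ S ∎
          where
          S = a (suc k)
          i = suc (suc k)
          B = bound i S
        result = K-free-subgraph m P P-prime (s≤s z≤n) dim≤P enough H Δ deg≤Δ hi
        G = proj₁ result
        free = proj₁ (proj₂ result)
        size = proj₂ (proj₂ result)

-- The final inequality is |G| ≥ Δ^(-1/A - p/q) e(H) raised to the power A q. The term o(1) becomes
-- an arbitrary positive rational p/q with its own Δ₀.
lower-bound : ∀ (r : ℕ) → 2 ≤ r →
  ∃ λ (f : ℕ → ℕ → ℕ) →
    ∀ (s : Fin r → ℕ) → ValidS s →
      (∀ (i j : Fin r) → toℕ j ≡ suc (toℕ i) → f (toℕ j) (s i) ≤ s j) →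
      ∀ (p q : ℕ) → 1 ≤ p → 1 ≤ q →
        ∃ λ (Δ₀ : ℕ) → ∀ (Δ : ℕ) → Δ₀ ≤ Δ →
          ∀ (H : RGraph r) → MaxDegree H Δ →
            Σ (List (Subset (n H))) λ G → KFreeSub s H G ×
              e H ^ (sumA s * q) ≤ length G ^ (sumA s * q) * Δ ^ (q + p * sumA s)
lower-bound (suc r') (s≤s 0<r') = growth , λ s valid grows p q 1≤p _ →
  LowerBound.Δ₀ r' 0<r' s valid grows q , LowerBound.good-subgraph r' 0<r' s valid grows q p 1≤p

-- Complete r-partite subgraphs of dense r-partite hypergraphs

falling : ℕ → ℕ → ℕ
falling d       zero    = 1
falling zero    (suc s) = 0
falling (suc d) (suc s) = suc d * falling d s

E^s≤falling : ∀ E s d → E + s ≤ d → E ^ s ≤ falling d s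
E^s≤falling E zero    d       le = ℕ.≤-refl
E^s≤falling E (suc s) zero    le = contradiction (ℕ.≤-trans (ℕ.m≤n+m (suc s) E) le) λ ()
E^s≤falling E (suc s) (suc d) le =
  ℕ.*-mono-≤ (ℕ.≤-trans (ℕ.m≤m+n E (suc s)) le) (E^s≤falling E s d (ℕ.≤-pred (subst (_≤ suc d) (ℕ.+-suc E s) le)))

-- A linear lower bound that replaces convexity.
falling-linear : ∀ E s d → E ^ s * d ≤ falling d (suc s) + E ^ s * (E + suc s)
falling-linear E s d with d ≤? E + suc s
... | yes le = ℕ.≤-trans (ℕ.*-monoʳ-≤ (E ^ s) le) (ℕ.m≤n+m _ (falling d (suc s)))
falling-linear E s zero    | no gt = contradiction z≤n gt
falling-linear E s (suc d) | no gt = ℕ.≤-trans (ℕ.≤-trans (ℕ.≤-reflexive (ℕ.*-comm (E ^ s) (suc d)))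
  (ℕ.*-monoʳ-≤ (suc d) (E^s≤falling E s d (ℕ.≤-trans (ℕ.+-monoʳ-≤ E (ℕ.n≤1+n s)) (ℕ.≤-pred (ℕ.≰⇒> gt)))))) (ℕ.m≤m+n _ _)

module _ {Y Z : Set} (_≟ʸ_ : DecidableEquality Y) {Adj : Y → Z → Set} (adj? : ∀ v t → Dec (Adj v t)) where

  private
    degree : List Y → Z → ℕ
    degree V t = # (λ v → adj? v t) V

    without : Y → List Y → List Y
    without v = filter (λ w → ¬? (w ≟ʸ v))

    common? : ∀ U t → Dec (All (λ u → Adj u t) U)
    common? U t = All.all? (λ u → adj? u t) U

  degree-without : ∀ {V v t} → Unique V → v ∈ V → Adj v t → suc (degree (without v V) t) ≡ degree V t
  degree-without {w ∷ V} {v} {t} (w∉ ∷ uq) (here refl) a with v ≟ʸ v | adj? v t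
  ... | no neq | _     = contradiction refl neq
  ... | yes _  | no ¬a = contradiction a ¬a
  ... | yes _  | yes _ = cong (λ xs → suc (degree xs t)) (List.filter-all (λ w → ¬? (w ≟ʸ v)) (All.map (λ neq eq → neq (sym eq)) w∉))
  degree-without {w ∷ V} {v} {t} (w∉ ∷ uq) (there v∈) a with w ≟ʸ v
  ... | yes refl = contradiction refl (All.lookup w∉ v∈)
  ... | no _ with adj? w t
  ...   | yes _ = cong suc (degree-without uq v∈ a)
  ...   | no _  = degree-without uq v∈ a

  -- The ordered tuples of suc s distinct neighbours of t are sorted by their first member.
  stars : ∀ V → Unique V → ∀ s t →
          falling (degree V t) (suc s) ≤ ∑ V (λ v → ind (adj? v t) * falling (degree (without v V) t) s)
  stars V uq s t = begin
    falling (degree V t) (suc s)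
      ≡⟨ unfold (degree V t) ⟩
    degree V t * falling (degree V t ∸ 1) s
      ≡⟨ cong (_* falling (degree V t ∸ 1) s) (#≡∑ (λ v → adj? v t) V) ⟩
    ∑ V (λ v → ind (adj? v t)) * falling (degree V t ∸ 1) s
      ≡⟨ sym (∑-*ʳ V (falling (degree V t ∸ 1) s) (λ v → ind (adj? v t))) ⟩
    ∑ V (λ v → ind (adj? v t) * falling (degree V t ∸ 1) s)
      ≤⟨ ∑-mono-≤ V (λ v v∈ → term v v∈ (adj? v t)) ⟩
    ∑ V (λ v → ind (adj? v t) * falling (degree (without v V) t) s) ∎
    where
    open ℕ.≤-Reasoning
    unfold : ∀ d → falling d (suc s) ≡ d * falling (d ∸ 1) s
    unfold zero    = refl
    unfold (suc d) = refl
    term : ∀ v → v ∈ V → (a : Dec (Adj v t)) → ind a * falling (degree V t ∸ 1) s ≤ ind a * falling (degree (without v V) t) s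
    term v v∈ (no _)  = z≤n
    term v v∈ (yes a) = ℕ.≤-reflexive (cong (λ d → 1 * falling (d ∸ 1) s) (sym (degree-without uq v∈ a)))

  -- In place of a pigeonhole over all N^s tuples, the vertices are picked one by one, each
  -- maximising the number of stars that remain. Positivity of this number guarantees a vertex to
  -- pick.
  common-neighbourhood : ∀ s V → Unique V → ∀ (X : List Z) N → length V ≤ N →
    0 < ∑ X (λ t → falling (degree V t) s) →
    ∃ λ U → length U ≡ s × Unique U × (∀ u → u ∈ U → u ∈ V) ×
      ∑ X (λ t → falling (degree V t) s) ≤ N ^ s * # (common? U) X
  common-neighbourhood zero V uq X N V≤N pos = [] , refl , [] , (λ _ ()) , ℕ.≤-reflexive
    (trans (sym (length≡∑ X)) (sym (trans (ℕ.+-identityʳ _) (#-all (common? []) X (λ _ _ → [])))))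
  common-neighbourhood (suc s) V uq X N V≤N pos =
    let v , v∈ , le = ∑≤max V inner (ℕ.n≢0⇒n>0 λ V≡0 → ℕ.<⇒≱ pos (ℕ.≤-trans total (ℕ.≤-reflexive (empty V V≡0))))
        bound = ℕ.≤-trans total le
        U , len , uqU , U⊆ , count = common-neighbourhood s (without v V) (Unique.filter⁺ (λ w → ¬? (w ≟ʸ v)) uq)
          (filter (adj? v) X) N (ℕ.≤-trans (List.length-filter (λ w → ¬? (w ≟ʸ v)) V) V≤N)
          (ℕ.n≢0⇒n>0 λ z → ℕ.<⇒≱ pos (ℕ.≤-trans bound (ℕ.≤-reflexive (trans (cong (length V *_) z) (ℕ.*-zeroʳ (length V))))))
    in v ∷ U , cong suc len ,
       All.tabulate (λ u∈ v≡u → proj₂ (∈.∈-filter⁻ (λ w → ¬? (w ≟ʸ v)) {xs = V} (U⊆ _ u∈)) (sym v≡u)) ∷ uqU ,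
       (λ { u (here refl) → v∈ ; u (there u∈) → proj₁ (∈.∈-filter⁻ (λ w → ¬? (w ≟ʸ v)) {xs = V} (U⊆ u u∈)) }) ,
       (begin
         ∑ X (λ t → falling (degree V t) (suc s)) ≤⟨ bound ⟩
         length V * inner v ≤⟨ ℕ.*-mono-≤ V≤N count ⟩
         N * (N ^ s * # (common? U) (filter (adj? v) X)) ≡⟨ sym (ℕ.*-assoc N (N ^ s) _) ⟩
         N ^ suc s * # (common? U) (filter (adj? v) X) ≤⟨ ℕ.*-monoʳ-≤ (N ^ suc s) (nested v U X) ⟩
         N ^ suc s * # (common? (v ∷ U)) X ∎)
    where
    open ℕ.≤-Reasoning
    inner : Y → ℕ
    inner v = ∑ (filter (adj? v) X) (λ t → falling (degree (without v V) t) s)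
    empty : ∀ V' → length V' ≡ 0 → ∑ V' inner ≡ 0
    empty [] _ = refl
    restrict : ∀ v (f : Z → ℕ) X → ∑ X (λ t → ind (adj? v t) * f t) ≡ ∑ (filter (adj? v) X) f
    restrict v f []      = refl
    restrict v f (t ∷ X) with adj? v t
    ... | yes _ = cong₂ _+_ (ℕ.+-identityʳ (f t)) (restrict v f X)
    ... | no _  = restrict v f X
    total : ∑ X (λ t → falling (degree V t) (suc s)) ≤ ∑ V inner
    total = begin
      ∑ X (λ t → falling (degree V t) (suc s))
        ≤⟨ ∑-mono-≤ X (λ t _ → stars V uq s t) ⟩
      ∑ X (λ t → ∑ V (λ v → ind (adj? v t) * falling (degree (without v V) t) s))
        ≡⟨ ∑-swap X V (λ t v → ind (adj? v t) * falling (degree (without v V) t) s) ⟩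
      ∑ V (λ v → ∑ X (λ t → ind (adj? v t) * falling (degree (without v V) t) s))
        ≡⟨ ∑-cong V (λ v → restrict v (λ t → falling (degree (without v V) t) s) X) ⟩
      ∑ V inner ∎
    nested : ∀ v U X → # (common? U) (filter (adj? v) X) ≤ # (common? (v ∷ U)) X
    nested v U []      = z≤n
    nested v U (t ∷ X) with nested v U X | adj? v t
    ... | ih | no _ = ih
    ... | ih | yes a with All.all? (λ u → adj? u t) U
    ...   | yes _ = s≤s ih
    ...   | no _  = ih

  -- The Kővári-Sós-Turán argument. With E about |V|/(8Λ), the average degree is at least 2 (E + s +
  -- 1), so `falling-linear` yields E^(s+1) |X| stars, distributed over at most (8ΛE)^(s+1) tuples.
  -- The factor 8 leaves room for rounding E up.
  dense⇒common : ∀ s V → Unique V → ∀ (X : List Z) Λ → 0 < Λ → 0 < length X → 8 * suc s * Λ ≤ length V →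
    length V * length X ≤ Λ * ∑ X (degree V) →
    ∃ λ U → length U ≡ suc s × Unique U × (∀ u → u ∈ U → u ∈ V) × length X ≤ (8 * Λ) ^ suc s * # (common? U) X
  dense⇒common s V uq X Λ 0<Λ 0<X large dense =
    let U , len , uqU , U⊆ , count = common-neighbourhood (suc s) V uq X (8 * Λ * E) V≤ positive
    in U , len , uqU , U⊆ , ℕ.*-cancelˡ-≤ (E ^ suc s) {{ℕ.m^n≢0 E (suc s)}} (begin
         E ^ suc s * length X ≤⟨ many-stars ⟩
         ∑ X (λ t → falling (degree V t) (suc s)) ≤⟨ count ⟩
         (8 * Λ * E) ^ suc s * # (common? U) X ≡⟨ cong (_* # (common? U) X) (^-distribʳ-* (suc s) (8 * Λ) E) ⟩
         (8 * Λ) ^ suc s * E ^ suc s * # (common? U) X ≡⟨ solve 3 (λ a b c → a :* b :* c := b :* (a :* c)) refl ((8 * Λ) ^ suc s) (E ^ suc s) (# (common? U) X) ⟩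
         E ^ suc s * ((8 * Λ) ^ suc s * # (common? U) X) ∎)
    where
    open ℕ.≤-Reasoning
    open +-*-Solver
    instance
      Λ≢0 : NonZero Λ
      Λ≢0 = >-nonZero 0<Λ
      8Λ≢0 : NonZero (8 * Λ)
      8Λ≢0 = >-nonZero (ℕ.<-≤-trans 0<Λ (ℕ.m≤n*m Λ 8))
    ℓ = length V
    E = suc (ℓ / (8 * Λ))
    D = E + suc s
    V≤ : ℓ ≤ 8 * Λ * E
    V≤ = begin
      ℓ ≡⟨ m≡m%n+[m/n]*n ℓ (8 * Λ) ⟩
      _ + ℓ / (8 * Λ) * (8 * Λ) ≤⟨ ℕ.+-monoˡ-≤ (ℓ / (8 * Λ) * (8 * Λ)) (ℕ.<⇒≤ (m%n<n ℓ (8 * Λ))) ⟩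
      8 * Λ + ℓ / (8 * Λ) * (8 * Λ) ≡⟨ ℕ.*-comm E (8 * Λ) ⟩
      8 * Λ * E ∎
    few : 2 * D * Λ ≤ ℓ
    few = ℕ.*-cancelˡ-≤ 4 (begin
      4 * (2 * D * Λ) ≡⟨ solve 3 (λ k s l → con 4 :* (con 2 :* (con 1 :+ k :+ (con 1 :+ s)) :* l)
                                                                   := k :* (con 8 :* l) :+ con 8 :* l :+ con 8 :* (con 1 :+ s) :* l) refl (ℓ / (8 * Λ)) s Λ ⟩
      ℓ / (8 * Λ) * (8 * Λ) + 8 * Λ + 8 * suc s * Λ ≤⟨ ℕ.+-mono-≤ (ℕ.+-mono-≤ (m/n*n≤m ℓ (8 * Λ))
                                                                  (ℕ.≤-trans (ℕ.*-monoˡ-≤ Λ (ℕ.*-monoʳ-≤ 8 {1} {suc s} (s≤s z≤n))) large)) large ⟩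
      ℓ + ℓ + ℓ ≤⟨ ℕ.m≤m+n (ℓ + ℓ + ℓ) ℓ ⟩
      ℓ + ℓ + ℓ + ℓ ≡⟨ solve 1 (λ ℓ → ℓ :+ ℓ :+ ℓ :+ ℓ := con 4 :* ℓ) refl ℓ ⟩
      4 * ℓ ∎)
    d-total = ∑ X (degree V)
    dense′ : 2 * D * length X ≤ d-total
    dense′ = ℕ.*-cancelˡ-≤ Λ (begin
      Λ * (2 * D * length X) ≡⟨ solve 3 (λ l d x → l :* (con 2 :* d :* x) := con 2 :* d :* l :* x) refl Λ D (length X) ⟩
      2 * D * Λ * length X ≤⟨ ℕ.*-monoˡ-≤ (length X) few ⟩
      ℓ * length X ≤⟨ dense ⟩
      Λ * d-total ∎)
    F = ∑ X (λ t → falling (degree V t) (suc s))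
    linear : E ^ s * d-total ≤ F + E ^ s * D * length X
    linear = begin
      E ^ s * d-total ≡⟨ sym (∑-*ˡ X (E ^ s) (degree V)) ⟩
      ∑ X (λ t → E ^ s * degree V t) ≤⟨ ∑-mono-≤ X (λ t _ → falling-linear E s (degree V t)) ⟩
      ∑ X (λ t → falling (degree V t) (suc s) + E ^ s * D) ≡⟨ ∑-+ X (λ t → falling (degree V t) (suc s)) (λ _ → E ^ s * D) ⟩
      F + ∑ X (λ _ → E ^ s * D) ≡⟨ cong (F +_) (trans (∑-const X (E ^ s * D)) (ℕ.*-comm (length X) (E ^ s * D))) ⟩
      F + E ^ s * D * length X ∎
    many-stars : E ^ suc s * length X ≤ F
    many-stars = ℕ.+-cancelʳ-≤ (E ^ s * D * length X) _ _ (begin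
      E ^ suc s * length X + E ^ s * D * length X ≤⟨ ℕ.+-monoˡ-≤ (E ^ s * D * length X) (ℕ.*-monoˡ-≤ (length X)
                                                        (ℕ.≤-trans (ℕ.≤-reflexive (ℕ.*-comm E (E ^ s))) (ℕ.*-monoʳ-≤ (E ^ s) (ℕ.m≤m+n E (suc s))))) ⟩
      E ^ s * D * length X + E ^ s * D * length X ≡⟨ solve 3 (λ e d x → e :* d :* x :+ e :* d :* x := e :* (con 2 :* d :* x)) refl (E ^ s) D (length X) ⟩
      E ^ s * (2 * D * length X) ≤⟨ ℕ.*-monoʳ-≤ (E ^ s) dense′ ⟩
      E ^ s * d-total ≤⟨ linear ⟩
      F + E ^ s * D * length X ∎)
    positive : 0 < F
    positive = ℕ.<-≤-trans (ℕ.*-mono-< {0} {E ^ suc s} {0} (ℕ.m^n>0 E (suc s)) 0<X) many-stars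

abstract
  -- If tuples have density 1/Λ, some s vertices of the first part are jointly completed by a
  -- proportion 1/`next Λ s` of the tuples of the other parts.
  next : ℕ → ℕ → ℕ
  next Λ s = (8 * Λ) ^ s

  next-≡ : ∀ Λ s → next Λ s ≡ (8 * Λ) ^ s
  next-≡ Λ s = refl

next>0 : ∀ Λ s → 0 < Λ → 0 < next Λ s
next>0 Λ s 0<Λ = subst (0 <_) (sym (next-≡ Λ s)) (ℕ.m^n>0 (8 * Λ) {{>-nonZero (ℕ.<-≤-trans 0<Λ (ℕ.m≤n*m Λ 8))}} s)

-- The reciprocal of the density that remains when part l is reached.
chain : ∀ {r} → ℕ → Vec ℕ r → Fin r → ℕ
chain Λ (s ∷ ss) Fin.zero    = Λ
chain Λ (s ∷ ss) (Fin.suc l) = chain (next Λ s) ss l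

#-cartesian : ∀ {A B C : Set} {P : C → Set} (P? : ∀ z → Dec (P z)) (f : A → B → C) xs ys →
              # P? (cartesianProductWith f xs ys) ≡ ∑ xs (λ x → # (λ y → P? (f x y)) ys)
#-cartesian P? f []       ys = refl
#-cartesian P? f (x ∷ xs) ys = trans (#-++ P? (map (f x) ys) (cartesianProductWith f xs ys)) (cong₂ _+_ (mapped ys) (#-cartesian P? f xs ys))
  where
  mapped : ∀ ys → # P? (map (f x) ys) ≡ # (λ y → P? (f x y)) ys
  mapped []       = refl
  mapped (y ∷ ys) with P? (f x y)
  ... | yes _ = cong suc (mapped ys)
  ... | no _  = mapped ys

module _ {Y : Set} (_≟ʸ_ : DecidableEquality Y) where

  -- Induction on the number of parts: once vertices U of the first part are fixed, the predicate on
  -- the remaining tuples becomes that every member of U completes them.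
  complete-subtuple : ∀ {r} (ss : Vec ℕ r) (Ps : Vec (List Y) r) (Λ : ℕ) → 0 < Λ →
    (∀ l → 0 < Vec.lookup ss l) → (∀ l → Unique (Vec.lookup Ps l)) →
    (∀ l → 8 * Vec.lookup ss l * chain Λ ss l ≤ length (Vec.lookup Ps l)) →
    ∀ {P : Vec Y r → Set} (P? : ∀ t → Dec (P t)) → product (Vec.map length Ps) ≤ Λ * # P? (tuples Ps) →
    ∃ λ (Us : Vec (List Y) r) → (∀ l → length (Vec.lookup Us l) ≡ Vec.lookup ss l) × (∀ l → Unique (Vec.lookup Us l)) ×
      (∀ t → t ∈ tuples Us → P t)
  complete-subtuple [] [] Λ 0<Λ ss>0 uq large {P} P? dense = [] , (λ ()) , (λ ()) , λ { t (here refl) → holds (P? []) }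
    where
    holds : Dec (P []) → P []
    holds (yes p) = p
    holds (no ¬p) = contradiction (subst (1 ≤_)
      (trans (cong (Λ *_) (#-zero P? ([] ∷ []) λ { t (here refl) → ¬p })) (ℕ.*-zeroʳ Λ)) dense) λ ()
  complete-subtuple (zero ∷ ss) Ps Λ 0<Λ ss>0 uq large P? dense = contradiction (ss>0 Fin.zero) λ ()
  complete-subtuple (suc s ∷ ss) (V ∷ Ps) Λ 0<Λ ss>0 uq large {P} P? dense = result
      (dense⇒common _≟ʸ_ adj? s V (uq Fin.zero) (tuples Ps) Λ 0<Λ nonempty (large Fin.zero)
        (subst₂ _≤_ (cong (length V *_) (sym (length-tuples Ps))) (cong (Λ *_) recount) dense))
    where
    adj? : ∀ v t → Dec (P (v ∷ t))
    adj? v t = P? (v ∷ t)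
    recount : # P? (tuples (V ∷ Ps)) ≡ ∑ (tuples Ps) (λ t → # (λ v → adj? v t) V)
    recount = trans (#-cartesian P? _∷_ V (tuples Ps)) (double-count adj? V (tuples Ps))
    positive : ∀ {r} (Ps : Vec (List Y) r) → (∀ l → 0 < length (Vec.lookup Ps l)) → 0 < product (Vec.map length Ps)
    positive []       h = s≤s z≤n
    positive (P ∷ Ps) h = ℕ.*-mono-< {0} {length P} {0} (h Fin.zero) (positive Ps (h ∘ Fin.suc))
    chain>0 : ∀ {r} Λ → 0 < Λ → ∀ (ss : Vec ℕ r) l → 0 < chain Λ ss l
    chain>0 Λ 0<Λ (s ∷ ss) Fin.zero    = 0<Λ
    chain>0 Λ 0<Λ (s ∷ ss) (Fin.suc l) = chain>0 (next Λ s) (next>0 Λ s 0<Λ) ss l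
    nonempty : 0 < length (tuples Ps)
    nonempty = subst (0 <_) (sym (length-tuples Ps)) (positive Ps λ l →
      ℕ.<-≤-trans (ℕ.*-mono-< {0} {8 * Vec.lookup ss l} {0} (ℕ.<-≤-trans (ss>0 (Fin.suc l)) (ℕ.m≤n*m _ 8))
        (chain>0 (next Λ (suc s)) (next>0 Λ (suc s) 0<Λ) ss l)) (large (Fin.suc l)))

    Result : Set
    Result = ∃ λ (Us : Vec (List Y) _) → (∀ l → length (Vec.lookup Us l) ≡ Vec.lookup (suc s ∷ ss) l) ×
               (∀ l → Unique (Vec.lookup Us l)) × (∀ t → t ∈ tuples Us → P t)

    prepend : ∀ U → length U ≡ suc s → Unique U →
      (∃ λ (Us : Vec (List Y) _) → (∀ l → length (Vec.lookup Us l) ≡ Vec.lookup ss l) × (∀ l → Unique (Vec.lookup Us l)) ×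
        (∀ t → t ∈ tuples Us → All (λ u → P (u ∷ t)) U)) → Result
    prepend U len uqU (Us , lens , uqs , holds) = U ∷ Us , lens' , uqs' , holds'
      where
      lens' : ∀ l → length (Vec.lookup (U ∷ Us) l) ≡ Vec.lookup (suc s ∷ ss) l
      lens' Fin.zero    = len
      lens' (Fin.suc l) = lens l
      uqs' : ∀ l → Unique (Vec.lookup (U ∷ Us) l)
      uqs' Fin.zero    = uqU
      uqs' (Fin.suc l) = uqs l
      holds' : ∀ t → t ∈ tuples (U ∷ Us) → P t
      holds' t t∈ = let u , t' , u∈ , t'∈ , eq = ∈.∈-cartesianProductWith⁻ _∷_ U (tuples Us) t∈
                    in subst P (sym eq) (All.lookup (holds t' t'∈) u∈)

    result : (∃ λ U → length U ≡ suc s × Unique U × (∀ u → u ∈ U → u ∈ V) ×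
               length (tuples Ps) ≤ (8 * Λ) ^ suc s * # (λ t → All.all? (λ u → adj? u t) U) (tuples Ps)) → Result
    result (U , len , uqU , _ , count) = prepend U len uqU (complete-subtuple ss Ps (next Λ (suc s)) (next>0 Λ (suc s) 0<Λ)
      (ss>0 ∘ Fin.suc) (uq ∘ Fin.suc) (large ∘ Fin.suc) (λ t → All.all? (λ u → adj? u t) U)
      (subst₂ _≤_ (length-tuples Ps) (cong (_* # (λ t → All.all? (λ u → adj? u t) U) (tuples Ps)) (sym (next-≡ Λ (suc s)))) count))

-- The sparse host

infixl 6 _⊞_
_⊞_ : ∀ {m} → Fin (suc m) → Fin (suc m) → Fin (suc m)
_⊞_ {m} a b = fromℕ< (m%n<n (toℕ a + toℕ b) (suc m))

⊞-comm : ∀ {m} (a b : Fin (suc m)) → a ⊞ b ≡ b ⊞ a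
⊞-comm {m} a b = Fin.fromℕ<-cong _ _ (cong (_% suc m) (ℕ.+-comm (toℕ a) (toℕ b))) _ _

⊞-injectiveʳ : ∀ {m} (a : Fin (suc m)) {x y} → a ⊞ x ≡ a ⊞ y → x ≡ y
⊞-injectiveʳ {m} a {x} {y} eq = Fin.toℕ-injective (trans (sym (recover x)) (trans (cong undo same) (recover y)))
  where
  open ≡-Reasoning
  M = suc m
  undo : ℕ → ℕ
  undo z = (z + (M ∸ toℕ a) % M) % M
  same : (toℕ a + toℕ x) % M ≡ (toℕ a + toℕ y) % M
  same = trans (sym (Fin.toℕ-fromℕ< (m%n<n (toℕ a + toℕ x) M))) (trans (cong toℕ eq) (Fin.toℕ-fromℕ< (m%n<n (toℕ a + toℕ y) M)))
  recover : ∀ x → undo ((toℕ a + toℕ x) % M) ≡ toℕ x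
  recover x = begin
    ((toℕ a + toℕ x) % M + (M ∸ toℕ a) % M) % M ≡⟨ sym (%-distribˡ-+ (toℕ a + toℕ x) (M ∸ toℕ a) M) ⟩
    (toℕ a + toℕ x + (M ∸ toℕ a)) % M ≡⟨ cong (_% M) (trans (cong (_+ (M ∸ toℕ a)) (ℕ.+-comm (toℕ a) (toℕ x)))
                                                    (trans (ℕ.+-assoc (toℕ x) (toℕ a) (M ∸ toℕ a)) (cong (toℕ x +_) (ℕ.m+[n∸m]≡n (ℕ.<⇒≤ (Fin.toℕ<n a)))))) ⟩
    (toℕ x + M) % M ≡⟨ [m+n]%n≡m%n (toℕ x) M ⟩
    toℕ x % M ≡⟨ m<n⇒m%n≡m (Fin.toℕ<n x) ⟩
    toℕ x ∎

⊞-injectiveˡ : ∀ {m} (d : Fin (suc m)) {x y} → x ⊞ d ≡ y ⊞ d → x ≡ y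
⊞-injectiveˡ d {x} {y} eq = ⊞-injectiveʳ d (trans (⊞-comm d x) (trans eq (⊞-comm y d)))

initial : ∀ L → ℕ → List (Fin L)
initial L q = filter (λ u → toℕ u <? q) (allFin L)

initial-length : ∀ {L q} → q ≤ L → length (initial L q) ≡ q
initial-length {L} {q} q≤L = ℕ.≤-antisym
  (subst₂ _≤_ (List.length-map toℕ (initial L q)) (List.length-upTo q)
    (unique⊆⇒length≤ (Unique.map⁺ Fin.toℕ-injective (Unique.filter⁺ (λ u → toℕ u <? q) (Unique.allFin⁺ L)))
      λ x x∈ → let u , u∈ , eq = ∈.∈-map⁻ toℕ x∈ in
        ∈.∈-upTo⁺ (subst (_< q) (sym eq) (proj₂ (∈.∈-filter⁻ (λ u → toℕ u <? q) {xs = allFin L} u∈)))))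
  (subst (_≤ length (initial L q)) (trans (List.length-map (λ u → inject≤ u q≤L) (allFin q)) (length-allFin q))
    (unique⊆⇒length≤ (Unique.map⁺ (λ eq → Fin.inject≤-injective q≤L q≤L _ _ eq) (Unique.allFin⁺ q))
      λ x x∈ → let u , _ , eq = ∈.∈-map⁻ (λ u → inject≤ u q≤L) x∈ in
        ∈.∈-filter⁺ (λ u → toℕ u <? q) (∈.∈-allFin x) (subst (_< q) (sym (trans (cong toℕ eq) (Fin.toℕ-inject≤ u q≤L))) (Fin.toℕ<n u))))

sublist-unique : ∀ {A : Set} {xs ys : List A} → xs ⊆ ys → Unique ys → Unique xs × (∀ x → x ∈ xs → x ∈ ys)
sublist-unique []         []       = [] , λ _ ()
sublist-unique (y Sublist.∷ʳ sub) (_ ∷ u)  = let u' , m = sublist-unique sub u in u' , λ x x∈ → there (m x x∈)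
sublist-unique {xs = x ∷ xs} (refl ∷ sub) (y∉ ∷ u) = let u' , m = sublist-unique sub u in
  All.tabulate (λ z∈ → All.lookup y∉ (m _ z∈)) ∷ u' , λ { z (here refl) → here refl ; z (there z∈) → there (m z z∈) }

-- The r-graph with parts Y = ℤ/N × ℤ/L and edges (x, x + d₁, …, x + d_r'), for x in Y and d in a set of
-- N^r' · ∏ q + ρ directions.  The core directions have dₗ in ℤ/N × [0, qₗ), so the core edges with
-- x in ℤ/N × {b} form a complete r-partite block; the ρ spare directions only adjust the degree.
module Construction (N' r'' L₀ ρ : ℕ) (qs : Vec ℕ (suc r'')) (q≤L₀ : ∀ l → Vec.lookup qs l ≤ L₀) where
  r r' N L : ℕ
  r' = suc r''
  r = suc r'
  N = suc N'
  L = suc (L₀ + ρ)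

  Y : Set
  Y = Fin N × Fin L

  _≟ʸ_ : DecidableEquality Y
  _≟ʸ_ = Product.≡-dec Fin._≟_ Fin._≟_

  infixl 6 _⊕_
  _⊕_ : Y → Y → Y
  (w , b) ⊕ (v , u) = w ⊞ v , b ⊞ u

  allY : List Y
  allY = cartesianProduct (allFin N) (allFin L)

  allY-unique : Unique allY
  allY-unique = Unique.cartesianProduct⁺ (Unique.allFin⁺ N) (Unique.allFin⁺ L)

  ∈-allY : ∀ y → y ∈ allY
  ∈-allY (w , b) = ∈.∈-cartesianProduct⁺ (∈.∈-allFin w) (∈.∈-allFin b)

  tuple : Y → Vec Y r' → Vec Y r
  tuple x d = x ∷ Vec.map (x ⊕_) d

  tuple-injective : ∀ {x d x' d'} → tuple x d ≡ tuple x' d' → x ≡ x' × d ≡ d'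
  tuple-injective {w , b} {d} {_} {d'} eq with Vec.∷-injective eq
  ... | refl , eq' = refl , vec-ext λ l →
    let e = trans (sym (Vec.lookup-map l ((w , b) ⊕_) d)) (trans (cong (λ t → Vec.lookup t l) eq') (Vec.lookup-map l ((w , b) ⊕_) d'))
    in cong₂ _,_ (⊞-injectiveʳ w (cong proj₁ e)) (⊞-injectiveʳ b (cong proj₂ e))

  core-parts : Vec (List Y) r'
  core-parts = Vec.map (λ q → cartesianProduct (allFin N) (initial L q)) qs

  -- The second coordinates are L₀ or more, whereas those of core directions stay below L₀, so no
  -- direction occurs twice.
  spare : Fin ρ → Vec Y r'
  spare i = Vec.replicate r' (Fin.zero , fromℕ< (s≤s (ℕ.+-monoʳ-≤ L₀ (ℕ.<⇒≤ (Fin.toℕ<n i)))))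

  spares directions : List (Vec Y r')
  spares     = map spare (allFin ρ)
  directions = tuples core-parts ++ spares

  tuples-of-edges : List (Vec Y r)
  tuples-of-edges = cartesianProductWith tuple allY directions

  core-lookup : ∀ l → Vec.lookup core-parts l ≡ cartesianProduct (allFin N) (initial L (Vec.lookup qs l))
  core-lookup l = Vec.lookup-map l _ qs

  q≤L : ∀ l → Vec.lookup qs l ≤ L
  q≤L l = ℕ.≤-trans (q≤L₀ l) (ℕ.≤-trans (ℕ.m≤m+n L₀ ρ) (ℕ.n≤1+n _))

  core-size : length (tuples core-parts) ≡ N ^ r' * product qs
  core-size = trans (length-tuples core-parts) (sizes qs q≤L)
    where
    sizes : ∀ {k} (qs : Vec ℕ k) → (∀ l → Vec.lookup qs l ≤ L) →
            product (Vec.map length (Vec.map (λ q → cartesianProduct (allFin N) (initial L q)) qs)) ≡ N ^ k * product qs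
    sizes []       h = refl
    sizes {suc k} (q ∷ qs) h = trans (cong₂ _*_ (trans (length-cartesian _,_ (allFin N) (initial L q)) (cong₂ _*_ (length-allFin N) (initial-length (h Fin.zero))))
                                        (sizes qs (h ∘ Fin.suc)))
                             (ℕ.[m*n]*[o*p]≡[m*o]*[n*p] N q (N ^ k) (product qs))

  spare-index : ∀ i → toℕ (proj₂ (Vec.lookup (spare i) Fin.zero)) ≡ L₀ + toℕ i
  spare-index i = Fin.toℕ-fromℕ< (s≤s (ℕ.+-monoʳ-≤ L₀ (ℕ.<⇒≤ (Fin.toℕ<n i))))

  directions-unique : Unique directions
  directions-unique = Unique.++⁺ (tuples-unique core-parts λ l → subst Unique (sym (core-lookup l))
      (Unique.cartesianProduct⁺ (Unique.allFin⁺ N) (Unique.filter⁺ (λ u → toℕ u <? Vec.lookup qs l) (Unique.allFin⁺ L))))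
    (Unique.map⁺ (λ {i} {j} eq → Fin.toℕ-injective (ℕ.+-cancelˡ-≡ L₀ _ _ (trans (sym (spare-index i))
      (trans (cong (λ d → toℕ (proj₂ (Vec.lookup d Fin.zero))) eq) (spare-index j))))) (Unique.allFin⁺ ρ))
    λ { (d∈core , d∈spare) → disjoint d∈core (∈.∈-map⁻ spare d∈spare) }
    where
    disjoint : ∀ {d} → d ∈ tuples core-parts → ¬ (∃ λ i → i ∈ allFin ρ × d ≡ spare i)
    disjoint d∈ (i , _ , refl) = ℕ.<⇒≱ (subst (_< Vec.lookup qs Fin.zero) (spare-index i)
        (proj₂ (∈.∈-filter⁻ (λ u → toℕ u <? Vec.lookup qs Fin.zero) {xs = allFin L} (proj₂ (∈.∈-cartesianProduct⁻ (allFin N) (initial L (Vec.lookup qs Fin.zero))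
          (subst (Vec.lookup (spare i) Fin.zero ∈_) (core-lookup Fin.zero) (∈-tuples⁻ core-parts d∈ Fin.zero)))))))
      (ℕ.≤-trans (q≤L₀ Fin.zero) (ℕ.m≤m+n L₀ (toℕ i)))

  tuples-of-edges-unique : Unique tuples-of-edges
  tuples-of-edges-unique = Unique.cartesianProductWith⁺ tuple tuple-injective allY-unique directions-unique

  vertices : ℕ
  vertices = r * (N * L)

  vertex : Fin r → Y → Fin vertices
  vertex l (w , u) = combine l (combine w u)

  vertex-injective : ∀ l y l' y' → vertex l y ≡ vertex l' y' → l ≡ l' × y ≡ y'
  vertex-injective l (w , u) l' (w' , u') eq with Fin.combine-injective l (combine w u) l' (combine w' u') eq
  ... | refl , eq' with Fin.combine-injective w u w' u' eq'
  ...   | refl , refl = refl , refl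

  vertex-surjective : ∀ v → ∃ λ l → ∃ λ y → vertex l y ≡ v
  vertex-surjective v with Fin.combine-surjective {r} {N * L} v
  ... | l , k , refl with Fin.combine-surjective {N} {L} k
  ...   | w , u , refl = l , (w , u) , refl

  edge : Vec Y r → Subset vertices
  edge t = vertexSet (λ l → vertex l (Vec.lookup t l))

  ∈-edge : ∀ t l y → vertex l y ∈ˢ edge t → Vec.lookup t l ≡ y
  ∈-edge t l y y∈ with ∈-vertexSet⁻ (λ l → vertex l (Vec.lookup t l)) y∈
  ... | l' , eq with vertex-injective l y l' (Vec.lookup t l') eq
  ...   | refl , refl = refl

  edge-injective : ∀ {t t'} → edge t ≡ edge t' → t ≡ t'
  edge-injective {t} {t'} eq = vec-ext λ l → sym (∈-edge t' l (Vec.lookup t l)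
    (subst (vertex l (Vec.lookup t l) ∈ˢ_) eq (∈-vertexSet⁺ (λ l → vertex l (Vec.lookup t l)) l)))

  H : RGraph r
  H = record
    { n = vertices
    ; edges = map edge tuples-of-edges
    ; unique = Unique.map⁺ edge-injective tuples-of-edges-unique
    ; uniform = All.map⁺ (All.tabulate λ {t} _ → ∣vertexSet∣ (λ l → vertex l (Vec.lookup t l)) λ {l} {l'} eq → proj₁ (vertex-injective l (Vec.lookup t l) l' (Vec.lookup t l') eq))
    }

  M : ℕ
  M = length allY

  Δ : ℕ
  Δ = length directions

  size-H : e H ≡ M * Δ
  size-H = trans (List.length-map edge tuples-of-edges) (length-cartesian tuple allY directions)

  Δ≡ : Δ ≡ N ^ r' * product qs + ρ
  Δ≡ = trans (List.length-++ (tuples core-parts)) (cong₂ _+_ core-size (trans (List.length-map spare (allFin ρ)) (length-allFin ρ)))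

  -- Translation by a fixed direction permutes Y. Each direction thus contributes exactly one edge
  -- at every vertex, and the degree is the number of directions, whatever these are.
  shift-unique : ∀ l d y → # (λ x → Vec.lookup (tuple x d) l ≟ʸ y) allY ≡ 1
  shift-unique Fin.zero    d y = #-unique (λ x → x ≟ʸ y) allY-unique (∈-allY y) refl λ _ _ eq → eq
  shift-unique (Fin.suc l) d (w , b) = #-unique (λ x → Vec.lookup (Vec.map (x ⊕_) d) l ≟ʸ (w , b)) allY-unique (∈-allY x₀)
      (trans (Vec.lookup-map l (x₀ ⊕_) d) (cong₂ _,_ (proj₂ w₀) (proj₂ b₀)))
      λ { (w' , b') _ eq → let eq' = trans (sym (Vec.lookup-map l ((w' , b') ⊕_) d)) eq in
          cong₂ _,_ (⊞-injectiveˡ v (trans (cong proj₁ eq') (sym (proj₂ w₀)))) (⊞-injectiveˡ u (trans (cong proj₂ eq') (sym (proj₂ b₀)))) }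
    where
    v = proj₁ (Vec.lookup d l)
    u = proj₂ (Vec.lookup d l)
    w₀ = injective⇒surjective (_⊞ v) (⊞-injectiveˡ v) w
    b₀ = injective⇒surjective (_⊞ u) (⊞-injectiveˡ u) b
    x₀ : Y
    x₀ = proj₁ w₀ , proj₁ b₀

  regular : Regular H Δ
  regular v with vertex-surjective v
  ... | l , y , refl = begin
    degIn (map edge tuples-of-edges) (vertex l y) ≡⟨ incident tuples-of-edges ⟩
    # (λ t → Vec.lookup t l ≟ʸ y) tuples-of-edges ≡⟨ #-cartesian (λ t → Vec.lookup t l ≟ʸ y) tuple allY directions ⟩
    ∑ allY (λ x → # (λ d → Vec.lookup (tuple x d) l ≟ʸ y) directions) ≡⟨ double-count (λ x d → Vec.lookup (tuple x d) l ≟ʸ y) allY directions ⟩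
    ∑ directions (λ d → # (λ x → Vec.lookup (tuple x d) l ≟ʸ y) allY) ≡⟨ ∑-cong directions (λ d → shift-unique l d y) ⟩
    ∑ directions (λ _ → 1) ≡⟨ sym (length≡∑ directions) ⟩
    Δ ∎
    where
    open ≡-Reasoning
    incident : ∀ ts → degIn (map edge ts) (vertex l y) ≡ # (λ t → Vec.lookup t l ≟ʸ y) ts
    incident []       = refl
    incident (t ∷ ts) with vertex l y Subset.∈? edge t | Vec.lookup t l ≟ʸ y
    ... | yes _  | yes _  = cong suc (incident ts)
    ... | no _   | no _   = incident ts
    ... | yes p  | no neq = contradiction (∈-edge t l y p) neq
    ... | no ∉   | yes eq = contradiction (subst (λ z → vertex l z ∈ˢ edge t) eq (∈-vertexSet⁺ (λ l → vertex l (Vec.lookup t l)) l)) ∉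

  block : Fin L → Vec (List Y) r
  block b = map (λ w → w , b) (allFin N) ∷ Vec.map (λ q → cartesianProduct (allFin N) (map (b ⊞_) (initial L q))) qs

  sizes : Vec ℕ r
  sizes = N ∷ Vec.map (N *_) qs

  block-tail : ∀ b l → Vec.lookup (block b) (Fin.suc l) ≡ cartesianProduct (allFin N) (map (b ⊞_) (initial L (Vec.lookup qs l)))
  block-tail b l = Vec.lookup-map l _ qs

  block-size : ∀ b l → length (Vec.lookup (block b) l) ≡ Vec.lookup sizes l
  block-size b Fin.zero    = trans (List.length-map (λ w → w , b) (allFin N)) (length-allFin N)
  block-size b (Fin.suc l) = trans (cong length (block-tail b l)) (trans (length-cartesian _,_ (allFin N) (map (b ⊞_) (initial L (Vec.lookup qs l))))
    (trans (cong₂ _*_ (length-allFin N) (trans (List.length-map (b ⊞_) (initial L (Vec.lookup qs l))) (initial-length (q≤L l))))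
           (sym (Vec.lookup-map l (N *_) qs))))

  block-unique : ∀ b l → Unique (Vec.lookup (block b) l)
  block-unique b Fin.zero    = Unique.map⁺ (cong proj₁) (Unique.allFin⁺ N)
  block-unique b (Fin.suc l) = subst Unique (sym (block-tail b l)) (Unique.cartesianProduct⁺ (Unique.allFin⁺ N)
    (Unique.map⁺ (⊞-injectiveʳ b) (Unique.filter⁺ (λ u → toℕ u <? Vec.lookup qs l) (Unique.allFin⁺ L))))

  block-product : ∀ b → product (Vec.map length (block b)) ≡ N * (N ^ r' * product qs)
  block-product b = trans (vec-product (block b) sizes (block-size b)) (cong (N *_) (scaled qs))
    where
    vec-product : ∀ {k} (Ps : Vec (List Y) k) ms → (∀ l → length (Vec.lookup Ps l) ≡ Vec.lookup ms l) → product (Vec.map length Ps) ≡ product ms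
    vec-product []       []       h = refl
    vec-product (P ∷ Ps) (m ∷ ms) h = cong₂ _*_ (h Fin.zero) (vec-product Ps ms (h ∘ Fin.suc))
    scaled : ∀ {k} (qs : Vec ℕ k) → product (Vec.map (N *_) qs) ≡ N ^ k * product qs
    scaled []       = refl
    scaled {suc k} (q ∷ qs) = trans (cong (N * q *_) (scaled qs)) (ℕ.[m*n]*[o*p]≡[m*o]*[n*p] N q (N ^ k) (product qs))

  core⇒block : ∀ w b d → d ∈ tuples core-parts → tuple (w , b) d ∈ tuples (block b)
  core⇒block w b d d∈ = ∈-tuples⁺ (block b) (tuple (w , b) d) member
    where
    member : ∀ l → Vec.lookup (tuple (w , b) d) l ∈ Vec.lookup (block b) l
    member Fin.zero    = ∈.∈-map⁺ (λ w → w , b) (∈.∈-allFin w)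
    member (Fin.suc l) = subst₂ _∈_ (sym (Vec.lookup-map l ((w , b) ⊕_) d)) (sym (block-tail b l))
      (∈.∈-cartesianProduct⁺ (∈.∈-allFin _) (∈.∈-map⁺ (b ⊞_) (proj₂ (∈.∈-cartesianProduct⁻ (allFin N) (initial L (Vec.lookup qs l))
        (subst (Vec.lookup d l ∈_) (core-lookup l) (∈-tuples⁻ core-parts d∈ l))))))

  module _ (s : Fin r → ℕ) (s>0 : ∀ i → 0 < s i) (Λ : ℕ) (0<Λ : 0 < Λ)
           (large : ∀ l → 8 * Vec.lookup (Vec.tabulate s) l * chain Λ (Vec.tabulate s) l ≤ Vec.lookup sizes l) where

    private
      ss : Vec ℕ r
      ss = Vec.tabulate s

    module _ (G : List (Subset vertices)) where

      kept? : ∀ t → Dec (edge t ∈ G)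
      kept? t = DecMem._∈?_ _≟ˢ_ (edge t) G

      complete⇒K : (∃ λ (Us : Vec (List Y) r) → (∀ l → length (Vec.lookup Us l) ≡ Vec.lookup ss l) ×
                     (∀ l → Unique (Vec.lookup Us l)) × (∀ t → t ∈ tuples Us → edge t ∈ G)) → ContainsK r s G
      complete⇒K (Us , lens , uqs , all-in) = φ , φ-injective , λ c →
          subst (_∈ G) (vertexSet-cong λ l → cong (vertex l) (Vec.lookup∘tabulate (λ l → u l (c l)) l))
            (all-in (Vec.tabulate λ l → u l (c l)) (∈-tuples⁺ Us _ λ l →
              subst (_∈ Vec.lookup Us l) (sym (Vec.lookup∘tabulate (λ l → u l (c l)) l)) (∈.∈-lookup (inject≤ (c l) (fits l)))))
        where
        fits : ∀ l → s l ≤ length (Vec.lookup Us l)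
        fits l = ℕ.≤-reflexive (sym (trans (lens l) (Vec.lookup∘tabulate s l)))
        u : ∀ l → Fin (s l) → Y
        u l k = lookup (Vec.lookup Us l) (inject≤ k (fits l))
        φ : Σ (Fin r) (λ l → Fin (s l)) → Fin vertices
        φ (l , k) = vertex l (u l k)
        φ-injective : ∀ {x y} → φ x ≡ φ y → x ≡ y
        φ-injective {l , k} {l' , k'} eq with vertex-injective l (u l k) l' (u l' k') eq
        ... | refl , eq' = cong (l ,_) (Fin.inject≤-injective (fits l) (fits l) k k' (lookup-unique-injective (uqs l) eq'))

      module _ (free : ¬ ContainsK r s G) (G⊆ : G ⊆ edges H) where

        block-sparse : ∀ b → Λ * # kept? (tuples (block b)) ≤ N * (N ^ r' * product qs)
        block-sparse b = ℕ.≮⇒≥ λ dense → free (complete⇒K (complete-subtuple _≟ʸ_ ss (block b) Λ 0<Λ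
          (λ l → subst (0 <_) (sym (Vec.lookup∘tabulate s l)) (s>0 l)) (block-unique b)
          (λ l → ℕ.≤-trans (large l) (ℕ.≤-reflexive (sym (block-size b l)))) kept?
          (ℕ.≤-trans (ℕ.≤-reflexive (block-product b)) (ℕ.<⇒≤ dense))))

        core-kept spare-kept : List (Vec Y r)
        core-kept  = concatMap (λ b → filter kept? (tuples (block b))) (allFin L)
        spare-kept = cartesianProductWith tuple allY spares

        cover : ∀ g → g ∈ G → g ∈ map edge (core-kept ++ spare-kept)
        cover g g∈ with ∈.∈-map⁻ edge (proj₂ (sublist-unique G⊆ (unique H)) g g∈)
        ... | t , t∈ , refl with ∈.∈-cartesianProductWith⁻ tuple allY directions t∈
        ...   | (w , b) , d , x∈ , d∈ , refl with ∈.∈-++⁻ (tuples core-parts) d∈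
        ...     | inj₁ core = ∈.∈-map⁺ edge (∈.∈-++⁺ˡ (∈.∈-concatMap⁺ (λ b → filter kept? (tuples (block b)))
                    (Any.map (λ { refl → ∈.∈-filter⁺ kept? (core⇒block w b d core) g∈ }) (∈.∈-allFin b))))
        ...     | inj₂ rest = ∈.∈-map⁺ edge (∈.∈-++⁺ʳ core-kept (∈.∈-cartesianProductWith⁺ tuple x∈ rest))

        -- The blocks cover the core edges, and none of them contains more than a proportion 1/Λ of
        -- kept edges; the `M * ρ` spare edges are all conceded to G.
        sparse : Λ * length G ≤ M * Δ + Λ * (M * ρ)
        sparse = begin
          Λ * length G ≤⟨ ℕ.*-monoʳ-≤ Λ (unique⊆⇒length≤ (proj₁ (sublist-unique G⊆ (unique H))) cover) ⟩
          Λ * length (map edge (core-kept ++ spare-kept)) ≡⟨ cong (Λ *_) (trans (List.length-map edge (core-kept ++ spare-kept)) (List.length-++ core-kept)) ⟩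
          Λ * (length core-kept + length spare-kept) ≡⟨ ℕ.*-distribˡ-+ Λ (length core-kept) (length spare-kept) ⟩
          Λ * length core-kept + Λ * length spare-kept ≤⟨ ℕ.+-mono-≤ core-bound (ℕ.≤-reflexive (cong (Λ *_) spare-size)) ⟩
          M * Δ + Λ * (M * ρ) ∎
          where
          open ℕ.≤-Reasoning
          spare-size : length spare-kept ≡ M * ρ
          spare-size = trans (length-cartesian tuple allY spares) (cong (M *_) (trans (List.length-map spare (allFin ρ)) (length-allFin ρ)))
          core-bound : Λ * length core-kept ≤ M * Δ
          core-bound = begin
            Λ * length core-kept ≡⟨ cong (Λ *_) (concat-length (allFin L)) ⟩
            Λ * ∑ (allFin L) (λ b → # kept? (tuples (block b))) ≡⟨ sym (∑-*ˡ (allFin L) Λ (λ b → # kept? (tuples (block b)))) ⟩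
            ∑ (allFin L) (λ b → Λ * # kept? (tuples (block b))) ≤⟨ ∑-mono-≤ (allFin L) (λ b _ → block-sparse b) ⟩
            ∑ (allFin L) (λ _ → N * (N ^ r' * product qs)) ≡⟨ ∑-const (allFin L) (N * (N ^ r' * product qs)) ⟩
            length (allFin L) * (N * (N ^ r' * product qs)) ≡⟨ trans (sym (ℕ.*-assoc (length (allFin L)) N _)) (cong (_* (N ^ r' * product qs))
                                                                               (trans (ℕ.*-comm (length (allFin L)) N) (trans (cong (_* length (allFin L)) (sym (length-allFin N)))
                                                                                 (sym (length-cartesian _,_ (allFin N) (allFin L)))))) ⟩
            M * (N ^ r' * product qs) ≤⟨ ℕ.*-monoʳ-≤ M (ℕ.≤-trans (ℕ.m≤m+n _ ρ) (ℕ.≤-reflexive (sym Δ≡))) ⟩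
            M * Δ ∎
            where
            concat-length : ∀ bs → length (concatMap (λ b → filter kept? (tuples (block b))) bs) ≡ ∑ bs (λ b → # kept? (tuples (block b)))
            concat-length []       = refl
            concat-length (b ∷ bs) = trans (List.length-++ (filter kept? (tuples (block b)))) (cong (# kept? (tuples (block b)) +_) (concat-length bs))

-- The part sizes of the host

prefix : ∀ {r} → Vec ℕ r → Fin r → ℕ
prefix (s ∷ ss) Fin.zero    = 1
prefix (s ∷ ss) (Fin.suc l) = s * prefix ss l

-- Separates constants from powers of Λ: the reciprocal density at part l grows with the product of
-- the preceding part sizes as exponent, which is why block parts of size N^(aₗ) suffice.
chain-scale : ∀ {r} κ Λ e (ss : Vec ℕ r) l → chain (κ * Λ ^ e) ss l ≡ chain κ ss l * Λ ^ (e * prefix ss l)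
chain-scale κ Λ e (s ∷ ss) Fin.zero    = cong (λ z → κ * Λ ^ z) (sym (ℕ.*-identityʳ e))
chain-scale κ Λ e (s ∷ ss) (Fin.suc l) = begin
  chain (next (κ * Λ ^ e) s) ss l ≡⟨ cong (λ z → chain z ss l) step ⟩
  chain (next κ s * Λ ^ (e * s)) ss l ≡⟨ chain-scale (next κ s) Λ (e * s) ss l ⟩
  chain (next κ s) ss l * Λ ^ (e * s * prefix ss l) ≡⟨ cong (λ z → chain (next κ s) ss l * Λ ^ z) (ℕ.*-assoc e s (prefix ss l)) ⟩
  chain (next κ s) ss l * Λ ^ (e * (s * prefix ss l)) ∎
  where
  open ≡-Reasoning
  step : next (κ * Λ ^ e) s ≡ next κ s * Λ ^ (e * s)
  step = begin
    next (κ * Λ ^ e) s ≡⟨ next-≡ (κ * Λ ^ e) s ⟩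
    (8 * (κ * Λ ^ e)) ^ s ≡⟨ cong (_^ s) (sym (ℕ.*-assoc 8 κ (Λ ^ e))) ⟩
    (8 * κ * Λ ^ e) ^ s ≡⟨ ^-distribʳ-* s (8 * κ) (Λ ^ e) ⟩
    (8 * κ) ^ s * (Λ ^ e) ^ s ≡⟨ cong₂ _*_ (sym (next-≡ κ s)) (ℕ.^-*-assoc Λ e s) ⟩
    next κ s * Λ ^ (e * s) ∎

partial-front : ∀ u j → partial u (suc j) ≡ u 0 * partial (u ∘ suc) j
partial-front u zero    = ℕ.*-comm 1 (u 0)
partial-front u (suc j) = trans (cong (_* u (suc j)) (partial-front u j)) (ℕ.*-assoc (u 0) (partial (u ∘ suc) j) (u (suc j)))

prefix≡partial : ∀ {r} (s : Fin (suc r) → ℕ) l → prefix (Vec.tabulate s) l ≡ partial (ext s) (toℕ l)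
prefix≡partial s         Fin.zero    = refl
prefix≡partial {suc r} s (Fin.suc l) = trans (cong (s Fin.zero *_) (prefix≡partial (s ∘ Fin.suc) l)) (sym (partial-front (ext s) (toℕ l)))

product-∷ʳ : ∀ {k} (qs : Vec ℕ k) q → product (qs ∷ʳ q) ≡ product qs * q
product-∷ʳ []       q = ℕ.*-comm q 1
product-∷ʳ (p ∷ qs) q = trans (cong (p *_) (product-∷ʳ qs q)) (sym (ℕ.*-assoc p (product qs) q))

lookup≤sum : ∀ {k} (qs : Vec ℕ k) l → Vec.lookup qs l ≤ Vec.sum qs
lookup≤sum (q ∷ qs) Fin.zero    = ℕ.m≤m+n q _
lookup≤sum (q ∷ qs) (Fin.suc l) = ℕ.≤-trans (lookup≤sum qs l) (ℕ.m≤n+m _ q)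

lookup-∷ʳ-≥ : ∀ k (f : ℕ → ℕ) {x} → f k ≤ x → ∀ l → f (toℕ l) ≤ Vec.lookup (Vec.tabulate {n = k} (f ∘ toℕ) ∷ʳ x) l
lookup-∷ʳ-≥ zero    f le Fin.zero    = le
lookup-∷ʳ-≥ (suc k) f le Fin.zero    = ℕ.≤-refl
lookup-∷ʳ-≥ (suc k) f le (Fin.suc l) = lookup-∷ʳ-≥ k (f ∘ suc) le l

∑-upTo-front : ∀ k (h : ℕ → ℕ) → ∑ (upTo (suc k)) h ≡ h 0 + ∑ (upTo k) (h ∘ suc)
∑-upTo-front k h = cong (h 0 +_) (go k id)
  where
  go : ∀ m (g : ℕ → ℕ) → ∑ (applyUpTo (suc ∘ g) m) h ≡ ∑ (applyUpTo g m) (h ∘ suc)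
  go zero    g = refl
  go (suc m) g = cong (h (suc (g 0)) +_) (go m (g ∘ suc))

split-power : ∀ N h → 1 ≤ h → N * N ^ (h ∸ 1) ≡ N ^ h
split-power N (suc h) _ = refl

power-product : ∀ N k (h : ℕ → ℕ) → (∀ j → 1 ≤ h j) →
                N ^ k * product (Vec.tabulate {n = k} (λ l → N ^ (h (toℕ l) ∸ 1))) ≡ N ^ ∑ (upTo k) h
power-product N zero    h pos = refl
power-product N (suc k) h pos = begin
  N * N ^ k * (N ^ (h 0 ∸ 1) * rest) ≡⟨ ℕ.[m*n]*[o*p]≡[m*o]*[n*p] N (N ^ k) (N ^ (h 0 ∸ 1)) rest ⟩
  N * N ^ (h 0 ∸ 1) * (N ^ k * rest) ≡⟨ cong₂ _*_ (split-power N (h 0) (pos 0)) (power-product N k (h ∘ suc) (pos ∘ suc)) ⟩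
  N ^ h 0 * N ^ ∑ (upTo k) (h ∘ suc) ≡⟨ sym (ℕ.^-distribˡ-+-* N (h 0) _) ⟩
  N ^ (h 0 + ∑ (upTo k) (h ∘ suc)) ≡⟨ cong (N ^_) (sym (∑-upTo-front k h)) ⟩
  N ^ ∑ (upTo (suc k)) h ∎
  where
  open ≡-Reasoning
  rest = product (Vec.tabulate {n = k} (λ l → N ^ (h (suc (toℕ l)) ∸ 1)))

module UpperBound (r'' : ℕ) (s : Fin (suc (suc r'')) → ℕ) (valid : ValidS s) where
  r r' A c : ℕ
  r' = suc r''
  r = suc r'
  A = sumA s

  u a : ℕ → ℕ
  u = ext s
  a = partial u

  ss : Vec ℕ r
  ss = Vec.tabulate s

  -- The constant factor in the size that part l must have; the remaining factor is a power of Λ by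
  -- `chain-scale`.
  demand : Fin r → ℕ
  demand l = 8 * Vec.lookup ss l * chain 1 ss l

  c = suc (∑ (allFin r) demand)

  s>0 : ∀ i → 0 < s i
  s>0 i = ℕ.<-trans (s≤s z≤n) (proj₁ valid i)

  a>0 : ∀ j → 0 < a j
  a>0 = partial>0 u (ext-all {P = 0 <_} s s>0)

  0<A : 0 < A
  0<A = sumA>0 s (s≤s z≤n) s>0

  -- N = c Λ, and all parts of a block have size N^(aₗ), except for the last one, which takes what is left of Δ.
  module _ (Λ' N' : ℕ) (N≡ : suc N' ≡ c * suc Λ') (Δ : ℕ) (N^A≤Δ : suc N' ^ A ≤ Δ) where
    private
      Λ N : ℕ
      Λ = suc Λ'
      N = suc N'

    -- The factor ℤ/N of Y contributes one N to every part, so the exponent is lowered by one.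
    inits : Vec ℕ r''
    inits = Vec.tabulate (λ l → N ^ (a (suc (toℕ l)) ∸ 1))

    R : ℕ
    R = N ^ r' * product inits

    R-power : R * N ^ (a r' ∸ 1) ≡ N ^ A
    R-power = begin
      N * N ^ r'' * product inits * N ^ (a r' ∸ 1) ≡⟨ solve 4 (λ n p q t → n :* p :* q :* t := (p :* q) :* (n :* t)) refl N (N ^ r'') (product inits) (N ^ (a r' ∸ 1)) ⟩
      N ^ r'' * product inits * (N * N ^ (a r' ∸ 1)) ≡⟨ cong₂ _*_ (power-product N r'' (a ∘ suc) (a>0 ∘ suc)) (split-power N (a r') (a>0 r')) ⟩
      N ^ ∑ (upTo r'') (a ∘ suc) * N ^ a r' ≡⟨ sym (ℕ.^-distribˡ-+-* N (∑ (upTo r'') (a ∘ suc)) (a r')) ⟩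
      N ^ (∑ (upTo r'') (a ∘ suc) + a r') ≡⟨ cong (N ^_) (trans (sym (∑-upTo-suc r'' (a ∘ suc))) (sym (sumA≡∑ s))) ⟩
      N ^ A ∎
      where
      open ≡-Reasoning
      open +-*-Solver

    instance
      R≢0 : NonZero R
      R≢0 = ℕ.m*n≢0⇒m≢0 R {N ^ (a r' ∸ 1)} {{subst NonZero (sym R-power) (ℕ.m^n≢0 N A)}}

    Q ρ : ℕ
    Q = Δ / R
    ρ = Δ % R

    qs : Vec ℕ r'
    qs = inits ∷ʳ Q

    Q-large : N ^ (a r' ∸ 1) ≤ Q
    Q-large = subst (_≤ Q) (m*n/n≡m (N ^ (a r' ∸ 1)) R)
      (/-monoˡ-≤ R (ℕ.≤-trans (ℕ.≤-reflexive (trans (ℕ.*-comm (N ^ (a r' ∸ 1)) R) R-power)) N^A≤Δ))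

    -- Since a_r is at least 2, R N ≤ N^A ≤ Δ, and the remainder ρ is less than R. Spare directions
    -- are thus at most a proportion 1/Λ of all and do not spoil the density.
    Λρ≤Δ : Λ * ρ ≤ Δ
    Λρ≤Δ = begin
      Λ * ρ ≤⟨ ℕ.*-monoʳ-≤ Λ (ℕ.<⇒≤ (m%n<n Δ R)) ⟩
      Λ * R ≤⟨ ℕ.*-monoˡ-≤ R (ℕ.≤-trans (ℕ.m≤n*m Λ c) (ℕ.≤-reflexive (sym N≡))) ⟩
      N * R ≡⟨ ℕ.*-comm N R ⟩
      R * N ≤⟨ ℕ.*-monoʳ-≤ R (m≤m^n N (ℕ.m<n⇒0<n∸m a>1)) ⟩
      R * N ^ (a r' ∸ 1) ≡⟨ R-power ⟩
      N ^ A ≤⟨ N^A≤Δ ⟩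
      Δ ∎
      where
      open ℕ.≤-Reasoning
      a>1 : 1 < a r'
      a>1 = ℕ.≤-trans (ext-all {P = 2 ≤_} s (proj₁ valid) r'') (ℕ.m≤n*m (u r'') (a r'') {{>-nonZero (a>0 r'')}})

    open Construction N' r'' (Vec.sum qs) ρ qs (lookup≤sum qs) using (sizes; H; M; Δ≡; size-H; regular; sparse) renaming (Δ to Δᴴ)

    Δᴴ≡Δ : Δᴴ ≡ Δ
    Δᴴ≡Δ = begin
      Δᴴ ≡⟨ Δ≡ ⟩
      N ^ r' * product (inits ∷ʳ Q) + ρ ≡⟨ cong (λ z → N ^ r' * z + ρ) (product-∷ʳ inits Q) ⟩
      N ^ r' * (product inits * Q) + ρ ≡⟨ cong (_+ ρ) (sym (ℕ.*-assoc (N ^ r') (product inits) Q)) ⟩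
      R * Q + ρ ≡⟨ trans (ℕ.+-comm (R * Q) ρ) (cong (ρ +_) (ℕ.*-comm R Q)) ⟩
      ρ + Q * R ≡⟨ sym (m≡m%n+[m/n]*n Δ R) ⟩
      Δ ∎
      where open ≡-Reasoning

    sizes-large : ∀ l → N ^ a (toℕ l) ≤ Vec.lookup sizes l
    sizes-large Fin.zero    = ℕ.≤-reflexive (ℕ.*-identityʳ N)
    sizes-large (Fin.suc l) = begin
      N ^ a (suc (toℕ l)) ≡⟨ sym (split-power N (a (suc (toℕ l))) (a>0 (suc (toℕ l)))) ⟩
      N * N ^ (a (suc (toℕ l)) ∸ 1) ≤⟨ ℕ.*-monoʳ-≤ N (lookup-∷ʳ-≥ r'' (λ j → N ^ (a (suc j) ∸ 1)) Q-large l) ⟩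
      N * Vec.lookup qs l ≡⟨ sym (Vec.lookup-map l (N *_) qs) ⟩
      Vec.lookup (Vec.map (N *_) qs) l ∎
      where open ℕ.≤-Reasoning

    large : ∀ l → 8 * Vec.lookup ss l * chain Λ ss l ≤ Vec.lookup sizes l
    large l = begin
      8 * Vec.lookup ss l * chain Λ ss l
        ≡⟨ cong (8 * Vec.lookup ss l *_) (trans (cong (λ z → chain z ss l) (sym (trans (ℕ.+-identityʳ (Λ * 1)) (ℕ.*-identityʳ Λ)))) (chain-scale 1 Λ 1 ss l)) ⟩
      8 * Vec.lookup ss l * (chain 1 ss l * Λ ^ (1 * prefix ss l))
        ≡⟨ trans (sym (ℕ.*-assoc (8 * Vec.lookup ss l) (chain 1 ss l) _)) (cong (λ z → demand l * Λ ^ z) (trans (ℕ.+-identityʳ (prefix ss l)) (prefix≡partial s l))) ⟩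
      demand l * Λ ^ a (toℕ l)
        ≤⟨ ℕ.*-monoˡ-≤ (Λ ^ a (toℕ l)) (ℕ.≤-trans (ℕ.≤-trans (∑-term demand (∈.∈-allFin l)) (ℕ.n≤1+n _)) (m≤m^n c (a>0 (toℕ l)))) ⟩
      c ^ a (toℕ l) * Λ ^ a (toℕ l)
        ≡⟨ trans (sym (^-distribʳ-* (a (toℕ l)) c Λ)) (cong (_^ a (toℕ l)) (sym N≡)) ⟩
      N ^ a (toℕ l)
        ≤⟨ sizes-large l ⟩
      Vec.lookup sizes l ∎
      where open ℕ.≤-Reasoning

    H-regular : Regular H Δ
    H-regular = subst (Regular H) Δᴴ≡Δ regular

    sparse-subgraph : ∀ G → KFreeSub s H G → Λ * length G ≤ 2 * e H
    sparse-subgraph G (G⊆ , free) = begin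
      Λ * length G ≤⟨ sparse s s>0 Λ (s≤s z≤n) large G free G⊆ ⟩
      M * Δᴴ + Λ * (M * ρ) ≡⟨ cong (M * Δᴴ +_) (trans (sym (ℕ.*-assoc Λ M ρ)) (trans (cong (_* ρ) (ℕ.*-comm Λ M)) (ℕ.*-assoc M Λ ρ))) ⟩
      M * Δᴴ + M * (Λ * ρ) ≤⟨ ℕ.+-monoʳ-≤ (M * Δᴴ) (ℕ.*-monoʳ-≤ M (ℕ.≤-trans Λρ≤Δ (ℕ.≤-reflexive (sym Δᴴ≡Δ)))) ⟩
      M * Δᴴ + M * Δᴴ ≡⟨ cong (M * Δᴴ +_) (sym (ℕ.+-identityʳ (M * Δᴴ))) ⟩
      2 * (M * Δᴴ) ≡⟨ cong (2 *_) (sym size-H) ⟩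
      2 * e H ∎
      where open ℕ.≤-Reasoning

  -- Take Λ with (cΛ)^A ≤ Δ < (c (Λ + 1))^A; then Δ is at most (2cΛ)^A. This factor 2 and the one in
  -- `sparse-subgraph` give the constant 4c.
  sparse-host : ∀ Δ → c ^ A ≤ Δ → Σ (RGraph r) λ H → 1 ≤ n H × Regular H Δ ×
    (∀ (G : List (Subset (n H))) → KFreeSub s H G → length G ^ A * Δ ≤ (4 * c) ^ A * e H ^ A)
  sparse-host Δ c^A≤Δ =
    let Λ , lo , hi = crossing (λ Λ → (c * Λ) ^ A) (suc Δ) (ℕ.≤-trans (ℕ.≤-reflexive (trans (cong (_^ A) (ℕ.*-zeroʳ c)) (0^n≡0 0<A))) z≤n)
                        (ℕ.≤-trans (ℕ.m≤n*m (suc Δ) c) (m≤m^n (c * suc Δ) 0<A))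
    in build Λ lo hi
    where
    open ℕ.≤-Reasoning
    open +-*-Solver
    build : ∀ Λ → (c * Λ) ^ A ≤ Δ → Δ < (c * suc Λ) ^ A → Σ (RGraph r) λ H → 1 ≤ n H × Regular H Δ ×
      (∀ (G : List (Subset (n H))) → KFreeSub s H G → length G ^ A * Δ ≤ (4 * c) ^ A * e H ^ A)
    -- Λ = 0 would mean Δ < c^A.
    build zero    lo hi = contradiction (subst (λ z → Δ < z ^ A) (ℕ.*-identityʳ c) hi) (ℕ.≤⇒≯ c^A≤Δ)
    build (suc Λ') lo hi = H , s≤s z≤n , H-regular Λ' N' refl Δ lo , λ G KG → begin
      length G ^ A * Δ ≤⟨ ℕ.*-monoʳ-≤ (length G ^ A) Δ≤ ⟩
      length G ^ A * (c * (2 * Λ)) ^ A ≡⟨ sym (^-distribʳ-* A (length G) (c * (2 * Λ))) ⟩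
      (length G * (c * (2 * Λ))) ^ A ≡⟨ cong (_^ A) (solve 3 (λ g c l → g :* (c :* (con 2 :* l)) := con 2 :* c :* (l :* g)) refl (length G) c Λ) ⟩
      (2 * c * (Λ * length G)) ^ A ≤⟨ ℕ.^-monoˡ-≤ A (ℕ.*-monoʳ-≤ (2 * c) (sparse-subgraph Λ' N' refl Δ lo G KG)) ⟩
      (2 * c * (2 * e H)) ^ A ≡⟨ cong (_^ A) (solve 2 (λ c e → con 2 :* c :* (con 2 :* e) := con 4 :* c :* e) refl c (e H)) ⟩
      (4 * c * e H) ^ A ≡⟨ ^-distribʳ-* A (4 * c) (e H) ⟩
      (4 * c) ^ A * e H ^ A ∎
      where
      Λ = suc Λ'
      N' = Data.Nat.pred (c * Λ)
      H = Construction.H N' r'' (Vec.sum (qs Λ' N' refl Δ lo)) (ρ Λ' N' refl Δ lo) (qs Λ' N' refl Δ lo) (lookup≤sum (qs Λ' N' refl Δ lo))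
      Δ≤ : Δ ≤ (c * (2 * Λ)) ^ A
      Δ≤ = ℕ.≤-trans (ℕ.<⇒≤ hi) (ℕ.^-monoˡ-≤ A (ℕ.*-monoʳ-≤ c (ℕ.+-mono-≤ {1} {Λ} {Λ} {Λ + 0} (s≤s z≤n) (ℕ.m≤m+n Λ 0))))

-- The bound |G| ≤ C Δ^(-1/A) e(H) is raised to the power A to stay within ℕ, and `1 ≤ n H` excludes
-- the host without vertices.
upper-bound : ∀ (r : ℕ) → 2 ≤ r → (s : Fin r → ℕ) → ValidS s →
  ∃ λ (C : ℕ) → ∃ λ (Δ₀ : ℕ) → ∀ (Δ : ℕ) → Δ₀ ≤ Δ →
    Σ (RGraph r) λ H → 1 ≤ n H × Regular H Δ ×
      (∀ (G : List (Subset (n H))) → KFreeSub s H G →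
        length G ^ sumA s * Δ ≤ C ^ sumA s * e H ^ sumA s)
upper-bound (suc (suc r'')) (s≤s (s≤s z≤n)) s valid =
  4 * UpperBound.c r'' s valid , UpperBound.c r'' s valid ^ sumA s , UpperBound.sparse-host r'' s valid

theorem1p2 : (∀ (r : ℕ) → 2 ≤ r → (s : Fin r → ℕ) → ValidS s →
    ∃ λ (C : ℕ) → ∃ λ (Δ₀ : ℕ) → ∀ (Δ : ℕ) → Δ₀ ≤ Δ →
    Σ (RGraph r) λ H → 1 ≤ n H × Regular H Δ ×
    (∀ (G : List (Subset (n H))) → KFreeSub s H G →
    length G ^ sumA s * Δ ≤ C ^ sumA s * e H ^ sumA s))
    ×
    (∀ (r : ℕ) → 2 ≤ r →
    ∃ λ (f : ℕ → ℕ → ℕ) →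
    ∀ (s : Fin r → ℕ) → ValidS s →
    (∀ (i j : Fin r) → toℕ j ≡ suc (toℕ i) → f (toℕ j) (s i) ≤ s j) →
    ∀ (p q : ℕ) → 1 ≤ p → 1 ≤ q →
    ∃ λ (Δ₀ : ℕ) → ∀ (Δ : ℕ) → Δ₀ ≤ Δ →
    ∀ (H : RGraph r) → MaxDegree H Δ →
    Σ (List (Subset (n H))) λ G → KFreeSub s H G ×
    e H ^ (sumA s * q) ≤ length G ^ (sumA s * q) * Δ ^ (q + p * sumA s))
theorem1p2 = upper-bound , lower-bound
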